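{- Let $k\ge 2$ be an integer and let $G$ be a connected graph of order $n+s$ and size $m+s$ in which $s$ vertices are of degree $1$ and all the other $n$ vertices are of degree $k$. Then, for any integer $r\ge 0$, $$t(L(S_r(G)))=k^{m+s-n-1}(rk+2)^{m-n+1}\,t(G).$$
   Context: Graphs are finite, have no loops, but may have parallel edges. The order of a graph is its number of vertices and its size is its number of edges. $t(G)$ is the number of spanning trees of $G$ (as edge sets). $L(G)$ is the line graph: its vertices are the edges of $G$, and two distinct edges $e,e'$ of $G$ are joined in $L(G)$ by as many edges as they have common ends (so two parallel edges of $G$ are joined by two parallel edges in $L(G)$). $S_r(G)$ is the graph obtained from $G$ by replacing each edge $e$ by a path of length $r+1$ connecting the two ends of $e$ (so $S_0(G)=G$). -}

module Defs where

open import Data.Empty using (⊥-elim)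
open import Data.Fin.Base using (Fin; zero; suc; _<_; _↑ˡ_; _↑ʳ_; combine; remQuot; splitAt; inject₁)
import Data.Fin.Properties as Fin
open import Data.Fin.Relation.Unary.Top using (view; ‵fromℕ; ‵inject₁)
open import Data.Fin.Subset using (Subset; _∈_; ⊤; inside; outside)
open import Data.Fin.Subset.Properties using (_∈?_)
open import Data.Integer.Base using (ℤ; +_; -[1+_])
open import Data.List.Base using (List; []; _∷_; _++_; map; length; lookup; filter; allFin; cartesianProduct)
import Data.List.Membership.Propositional as List
open import Data.List.Membership.Propositional.Properties using (∈-lookup)
open import Data.List.Relation.Unary.All as All using (All; []; _∷_)
open import Data.List.Relation.Unary.All.Properties using (all-filter; ¬Any⇒All¬)
import Data.List.Relation.Unary.Any as Any
open import Data.List.Relation.Unary.AllPairs using ([]; _∷_)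
open import Data.List.Relation.Unary.Unique.Propositional using (Unique)
import Data.List.Relation.Unary.Unique.DecPropositional as UniqueDec
open import Data.Nat.Base as ℕ using (ℕ; zero; suc; NonZero)
import Data.Nat.Properties as ℕ
open import Data.Product.Base using (∃-syntax; ∃₂; _×_; _,_; proj₁; proj₂)
open import Data.Product.Properties using (≡-dec)
open import Data.Rational.Base using (ℚ; _/_)
open import Data.Sum.Base using (_⊎_; inj₁; inj₂)
import Data.Vec.Base as Vec
open import Function.Base using (_∘_)
open import Function.Definitions using (Injective)
open import Relation.Binary.PropositionalEquality using (_≡_; _≢_; refl; sym; trans; cong; subst)
open import Relation.Nullary.Decidable using (Dec; yes; no; ¬?; _×-dec_; _⊎-dec_; map′)
open import Relation.Nullary.Negation using (¬_)
open import Relation.Unary using (Decidable)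

-- The order in which `ends` lists the two ends of an edge is irrelevant.
record Graph : Set where
  field
    order    : ℕ
    size     : ℕ
    ends     : Fin size → Fin order × Fin order
    loopless : ∀ e → proj₁ (ends e) ≢ proj₂ (ends e)

  Vertex Edge : Set
  Vertex = Fin order
  Edge   = Fin size

  IsEnd : Vertex → Edge → Set
  IsEnd v e = v ≡ proj₁ (ends e) ⊎ v ≡ proj₂ (ends e)

  isEnd? : ∀ v e → Dec (IsEnd v e)
  isEnd? v e = (v Fin.≟ proj₁ (ends e)) ⊎-dec (v Fin.≟ proj₂ (ends e))

  Joins : Edge → Vertex → Vertex → Set
  Joins e u v = ends e ≡ (u , v) ⊎ ends e ≡ (v , u)

  joins? : ∀ e u v → Dec (Joins e u v)
  joins? e u v = (ends e ≟ (u , v)) ⊎-dec (ends e ≟ (v , u))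
    where _≟_ = ≡-dec Fin._≟_ Fin._≟_

  degree : Vertex → ℕ
  degree v = length (filter (isEnd? v) (allFin size))

  -- Walk T u vs es v : a walk from u to v with all its edges in T, where es
  -- lists its edges and vs its vertices except the last one.
  data Walk (T : Subset size) : Vertex → List Vertex → List Edge → Vertex → Set where
    []   : ∀ {v} → Walk T v [] [] v
    step : ∀ {u v w vs es} e → e ∈ T → Joins e u w → Walk T w vs es v →
           Walk T u (u ∷ vs) (e ∷ es) v

  -- The remaining notions concern the spanning subgraph with edge set T.

  -- The graph without vertices is not connected.
  IsConnectedBy : Subset size → Set
  IsConnectedBy T = NonZero order × (∀ u v → ∃₂ λ vs es → Walk T u vs es v)

  -- Both lists must be repetition-free: distinct vertices alone would allow
  -- going back and forth along a single edge, while a pair of parallel edges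
  -- is a cycle of length 2.
  HasCycle : Subset size → Set
  HasCycle T = ∃[ v ] ∃₂ λ vs es → Walk T v vs es v × es ≢ [] × Unique vs × Unique es

  IsSpanningTree : Subset size → Set
  IsSpanningTree T = IsConnectedBy T × ¬ HasCycle T

  Connected : Set
  Connected = IsConnectedBy ⊤

------------------------------------------------------------------------
-- Decidability of being a spanning tree

lookup-injective : ∀ {A : Set} {xs : List A} → Unique xs → Injective _≡_ _≡_ (lookup xs)
lookup-injective (_ ∷ _)   {zero}  {zero}  _  = refl
lookup-injective (px ∷ _)  {zero}  {suc j} eq = ⊥-elim (All.lookup px (∈-lookup j) eq)
lookup-injective (px ∷ _)  {suc i} {zero}  eq = ⊥-elim (All.lookup px (∈-lookup i) (sym eq))
lookup-injective (_ ∷ pxs) {suc i} {suc j} eq = cong suc (lookup-injective pxs eq)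

unique⇒length≤ : ∀ {n} {xs : List (Fin n)} → Unique xs → length xs ℕ.≤ n
unique⇒length≤ = Fin.injective⇒≤ ∘ lookup-injective

module _ (G : Graph) where
  open Graph G

  WalkSuchThat : Subset size → (List Vertex → List Edge → Set) → ℕ → Vertex → Vertex → Set
  WalkSuchThat T P b u v = ∃₂ λ vs es → Walk T u vs es v × length es ℕ.≤ b × P vs es

  walkSuchThat? : ∀ T {P : List Vertex → List Edge → Set} → (∀ vs es → Dec (P vs es)) →
                  ∀ b u v → Dec (WalkSuchThat T P b u v)
  walkSuchThat? T {P} P? zero u v = map′ to from ((u Fin.≟ v) ×-dec P? [] [])
    where
    to : u ≡ v × P [] [] → WalkSuchThat T P zero u v
    to (refl , p) = [] , [] , [] , ℕ.z≤n , p
    from : WalkSuchThat T P zero u v → u ≡ v × P [] []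
    from (_ , _ , [] , _ , p) = refl , p
  walkSuchThat? T {P} P? (suc b) u v = map′ to from
    (((u Fin.≟ v) ×-dec P? [] []) ⊎-dec
     Fin.any? λ e → Fin.any? λ w → (e ∈? T) ×-dec joins? e u w ×-dec
       walkSuchThat? T (λ vs es → P? (u ∷ vs) (e ∷ es)) b w v)
    where
    Q : Set
    Q = (u ≡ v × P [] []) ⊎
        (∃[ e ] ∃[ w ] e ∈ T × Joins e u w ×
          WalkSuchThat T (λ vs es → P (u ∷ vs) (e ∷ es)) b w v)
    to : Q → WalkSuchThat T P (suc b) u v
    to (inj₁ (refl , p)) = [] , [] , [] , ℕ.z≤n , p
    to (inj₂ (e , w , e∈T , j , vs , es , W , l , p)) =
      u ∷ vs , e ∷ es , step e e∈T j W , ℕ.s≤s l , p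
    from : WalkSuchThat T P (suc b) u v → Q
    from (_ , _ , [] , _ , p) = inj₁ (refl , p)
    from (_ , _ , step e e∈T j W , ℕ.s≤s l , p) = inj₂ (e , _ , e∈T , j , _ , _ , W , l , p)

  walk-lengths : ∀ {T u vs es v} → Walk T u vs es v → length es ≡ length vs
  walk-lengths []             = refl
  walk-lengths (step _ _ _ W) = cong suc (walk-lengths W)

  Path : Subset size → Vertex → Vertex → Set
  Path T u v = ∃₂ λ vs es → Walk T u vs es v × Unique vs

  path-from : ∀ {T u v w vs es} → Walk T w vs es v → Unique vs → u List.∈ vs → Path T u v
  path-from W@(step _ _ _ _) p       (Any.here refl) = _ , _ , W , p
  path-from (step _ _ _ W)   (_ ∷ p) (Any.there u∈)  = path-from W p u∈

  walk⇒path : ∀ {T u vs es v} → Walk T u vs es v → Path T u v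
  walk⇒path [] = [] , [] , [] , []
  walk⇒path {u = u} (step e e∈T j W) with walk⇒path W
  ... | vs , es , W′ , p with Any.any? (u Fin.≟_) vs
  ...   | yes u∈vs = path-from W′ p u∈vs
  ...   | no  u∉vs = u ∷ vs , e ∷ es , step e e∈T j W′ , ¬Any⇒All¬ vs u∉vs ∷ p

  unique? : ∀ {n} (xs : List (Fin n)) → Dec (Unique xs)
  unique? = UniqueDec.unique? Fin._≟_

  isConnectedBy? : Decidable IsConnectedBy
  isConnectedBy? T = ℕ.nonZero? order ×-dec Fin.all? λ u → Fin.all? λ v →
    map′ (λ (vs , es , W , _) → vs , es , W)
         (λ (_ , _ , W) → let (vs , es , W′ , p) = walk⇒path W in
            vs , es , W′ , subst (ℕ._≤ order) (sym (walk-lengths W′)) (unique⇒length≤ p) , p)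
         (walkSuchThat? T (λ vs _ → unique? vs) order u v)

  hasCycle? : Decidable HasCycle
  hasCycle? T = Fin.any? λ v →
    map′ (λ (vs , es , W , _ , p) → vs , es , W , p)
         (λ (vs , es , W , p@(_ , _ , u)) → vs , es , W , unique⇒length≤ u , p)
         (walkSuchThat? T (λ vs es → ¬? (nil? es) ×-dec unique? vs ×-dec unique? es) size v v)
    where
    nil? : (es : List Edge) → Dec (es ≡ [])
    nil? []      = yes refl
    nil? (_ ∷ _) = no λ ()

  isSpanningTree? : Decidable IsSpanningTree
  isSpanningTree? T = isConnectedBy? T ×-dec ¬? (hasCycle? T)

------------------------------------------------------------------------

subsets : ∀ n → List (Subset n)
subsets zero    = Vec.[] ∷ []
subsets (suc n) = map (inside Vec.∷_) (subsets n) ++ map (outside Vec.∷_) (subsets n)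

t : Graph → ℕ
t G = length (filter (isSpanningTree? G) (subsets (Graph.size G)))

-- The edges of the line graph are the triples (e , e′ , v) such that e < e′
-- and v is a common end of e and e′; such a triple joins e and e′.
module _ (G : Graph) where
  open Graph G

  Triple : Set
  Triple = Edge × Edge × Vertex

  Meet : Triple → Set
  Meet (e , e′ , v) = e < e′ × IsEnd v e × IsEnd v e′

  meet? : Decidable Meet
  meet? (e , e′ , v) = (e Fin.<? e′) ×-dec isEnd? v e ×-dec isEnd? v e′

  triples lineEdges : List Triple
  triples   = cartesianProduct (allFin size) (cartesianProduct (allFin size) (allFin order))
  lineEdges = filter meet? triples

  L : Graph
  L = record
    { order    = size
    ; size     = length lineEdges
    ; ends     = λ i → let (e , e′ , _) = lookup lineEdges i in e , e′
    ; loopless = λ i → Fin.<⇒≢ (proj₁ (All.lookup (all-filter meet? triples) (∈-lookup {xs = lineEdges} i)))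
    }

-- An edge e with ends (u , w) becomes the path u, x₀, …, xᵣ₋₁, w, where
-- xⱼ = inner e j; the edge (e , j), for 0 ≤ j ≤ r, joins its vertices number
-- j and j + 1.
module _ (r : ℕ) (G : Graph) where
  open Graph G

  private
    V′ : Set
    V′ = Fin (order ℕ.+ size ℕ.* r)

  old : Vertex → V′
  old v = v ↑ˡ (size ℕ.* r)

  inner : Edge → Fin r → V′
  inner e j = order ↑ʳ combine e j

  source : Edge → Fin (suc r) → V′
  source e zero    = old (proj₁ (ends e))
  source e (suc j) = inner e j

  target : Edge → Fin (suc r) → V′
  target e j with view j
  ... | ‵fromℕ     = old (proj₂ (ends e))
  ... | ‵inject₁ i = inner e i

  old≢inner : ∀ v e j → old v ≢ inner e j
  old≢inner v e j eq
    with () ← trans (sym (Fin.splitAt-↑ˡ order v _))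
                    (trans (cong (splitAt order) eq) (Fin.splitAt-↑ʳ order _ _))

  source≢end : ∀ e j → source e j ≢ old (proj₂ (ends e))
  source≢end e zero    eq = loopless e (Fin.↑ˡ-injective _ _ _ eq)
  source≢end e (suc j) eq = old≢inner _ _ _ (sym eq)

  source≢inner : ∀ e i → source e (inject₁ i) ≢ inner e i
  source≢inner e zero    eq = old≢inner _ _ _ eq
  source≢inner e (suc i) eq = inject₁≢suc i
    (Fin.combine-injectiveʳ e (inject₁ i) e (suc i) (Fin.↑ʳ-injective order _ _ eq))
    where
    inject₁≢suc : ∀ {n} (i : Fin n) → inject₁ i ≢ suc i
    inject₁≢suc (suc i) eq = inject₁≢suc i (Fin.suc-injective eq)

  source≢target : ∀ e j → source e j ≢ target e j
  source≢target e j with view j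
  ... | ‵fromℕ     = source≢end e j
  ... | ‵inject₁ i = source≢inner e i

  S : Graph
  S = record
    { order    = order ℕ.+ size ℕ.* r
    ; size     = size ℕ.* suc r
    ; ends     = λ f → let (e , j) = remQuot (suc r) f in source e j , target e j
    ; loopless = λ f → let (e , j) = remQuot (suc r) f in source≢target e j
    }

infixr 8 _^ᶻ_
_^ᶻ_ : (b : ℕ) .{{_ : NonZero b}} → ℤ → ℚ
b ^ᶻ (+ i)    = + (b ℕ.^ i) / 1
b ^ᶻ -[1+ i ] = _/_ (+ 1) (b ℕ.^ suc i) {{ℕ.m^n≢0 b (suc i)}}

{-# OPTIONS --safe #-}

-- In L(H) the edges at a vertex v of H form a clique.  The star-mesh
-- transformation turns this clique into a star with centre v and weights
-- deg v, at the cost of a factor (deg v)²; the result is the graph H with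
-- every edge subdivided, the two halves of an edge uv having weights deg u
-- and deg v.  Series reduction undoes the subdivision, so that
--   ∏ (deg v)² t(L(H)) = Σ_T ∏_{uv ∈ T} deg u deg v ∏_{uv ∉ T} (deg u + deg v).
-- For H = S_r(G) further series reductions give the same formula for G, up to
-- powers of 4, with deg u + deg v + r deg u deg v for the edges outside T.
-- These edges are never pendant, so their factor is k(rk + 2); their number is
-- the same for all T, and the remaining products of degrees are evaluated by
-- counting incidences.

module Submission where

open import Defs

-- Electrical reductions call for division, yet everything up to the last step stays in ℕ: an edge
-- carries the numerator and the denominator of its conductance, missing factors are multiplied in
-- on both sides, and positive ones are cancelled later. Sums over trees are never handled as sums
-- over sets: `treeSum` is a deletion-contraction recursion along a list of edges, and contraction
-- is recorded by relabelling the vertices of an unchanged type. Local identities pass to the whole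
-- graph by induction on the remaining edges, provided that these avoid the vertex to be eliminated.
-- The price is to show that the order of the edges does not matter (`treeSum-swap`) and that the
-- recursion counts the spanning trees defined by walks and cycles (`t≡treeSum`). The weight deg v
-- of the spokes is the one that gives the mesh unit weights: d spokes of weight w become a mesh of
-- weights w w / (d w) = w / d with the factor d w, the total weight of the star, and w = d turns
-- these into 1 and d d.

module _ where

  open import Data.Bool.Base using (Bool; true; false)
  open import Data.Empty using (⊥)
  open import Data.Fin.Base as Fin using (Fin; zero; suc; toℕ; fromℕ; inject₁; _↑ʳ_; splitAt; combine; remQuot)
  import Data.Fin.Properties as Fin
  open import Data.Fin.Properties using (toℕ-injective; toℕ<n)
  open import Data.Fin.Relation.Unary.Top using (view; ‵fromℕ; ‵inject₁; view-fromℕ; view-inject₁)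
  open import Data.Fin.Subset using (Subset; _∈_; _∉_; ∣_∣; inside; outside)
  open import Data.List.Base using (List; []; _∷_; _++_; map; length; filter; allFin; tabulate; concatMap; lookup)
  open import Data.List.Membership.Propositional using (find; lose) renaming (_∈_ to _∈ˡ_; _∉_ to _∉ˡ_)
  open import Data.List.Membership.Propositional.Properties using (∈-allFin; ∈-map⁺; ∈-map⁻; ∈-++⁺ˡ; ∈-++⁺ʳ; ∈-++⁻; ∈-filter⁺; ∈-filter⁻; ∈-concatMap⁺; ∈-concatMap⁻; ∈-tabulate⁺; ∈-tabulate⁻; ∈-cartesianProduct⁺)
  open import Data.List.Membership.Propositional.Properties.WithK using (unique∧set⇒bag)
  open import Data.List.Properties using (length-map; length-tabulate; length-++; filter-++; filter-≐; tabulate-cong; tabulate-lookup; map-tabulate; map-∘; map-cong; map-++; map-concatMap; concatMap-cong; ++-identityʳ; ++-assoc)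
  open import Data.List.Relation.Binary.BagAndSetEquality using (∼bag⇒↭)
  open import Data.List.Relation.Binary.Permutation.Propositional as Perm using (_↭_; ↭-sym; ↭-trans; ↭-refl; ↭-reflexive; prep)
  import Data.List.Relation.Binary.Permutation.Propositional.Properties as Perm
  open import Data.List.Relation.Binary.Pointwise as Pointwise using (Pointwise; []; _∷_)
  open import Data.List.Relation.Unary.All as All using (All; []; _∷_)
  import Data.List.Relation.Unary.All.Properties as All
  open import Data.List.Relation.Unary.All.Properties using (¬Any⇒All¬)
  open import Data.List.Relation.Unary.AllPairs as AllPairs using (AllPairs; []; _∷_)
  import Data.List.Relation.Unary.AllPairs.Properties as AllPairs
  open import Data.List.Relation.Unary.Any as Any using (here; there)
  open import Data.List.Relation.Unary.Unique.Propositional using (Unique)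
  import Data.List.Relation.Unary.Unique.Propositional.Properties as Unique
  open import Data.Nat.Base using (ℕ; zero; suc; _+_; _*_; _^_; _≤_; NonZero; ≢-nonZero⁻¹)
  open import Data.Nat.ListAction using (product)
  open import Data.Nat.ListAction.Properties using (product-++; product-↭)
  open import Data.Nat.Properties using (_≟_; +-comm; +-suc; +-identityʳ; +-cancelˡ-≡; *-comm; *-assoc; *-identityˡ; *-identityʳ; *-zeroʳ; *-cancelˡ-≡; ^-distribˡ-+-*; m*n≢0; m^n≢0; m≤m+n; <⇒≱; suc-injective)
  open import Data.Nat.Tactic.RingSolver using (solve-∀)
  open import Data.Product.Base using (∃-syntax; ∃₂; _×_; _,_; proj₁; proj₂)
  open import Data.Sum.Base as Sum using (_⊎_; inj₁; inj₂; [_,_]′)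
  open import Data.Sum.Properties using (inj₂-injective)
  open import Data.Vec.Base using ([]; _∷_; here; there) renaming (lookup to lookupᵛ)
  open import Data.Vec.Properties using (lookup⇒[]=; []=⇒lookup)
  open import Function.Base using (_∘_; id)
  open import Function.Bundles using (mk⇔)
  open import Relation.Binary.PropositionalEquality
  open import Relation.Nullary.Decidable using (Dec; yes; no; ¬?; _×-dec_)
  open import Relation.Nullary.Negation using (¬_; contradiction)
  open import Relation.Unary using (Decidable)

  -- Weighted sums over spanning trees of contracted graphs

  indicator : {P : Set} → Dec P → ℕ
  indicator (yes _) = 1
  indicator (no _)  = 0

  indicator-cong : {P Q : Set} (p? : Dec P) (q? : Dec Q) → (P → Q) → (Q → P) →
                   indicator p? ≡ indicator q?
  indicator-cong (yes _) (yes _) _ _ = refl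
  indicator-cong (no _)  (no _)  _ _ = refl
  indicator-cong (yes p) (no ¬q) f _ = contradiction (f p) ¬q
  indicator-cong (no ¬p) (yes q) _ g = contradiction (g q) ¬p

  if-yes : {P : Set} → Dec P → ℕ → ℕ → ℕ
  if-yes (yes _) a _ = a
  if-yes (no _)  _ b = b

  unlessLoop : {P : Set} → Dec P → ℕ → ℕ
  unlessLoop p? a = if-yes p? 0 a

  -- A labelling describes the vertices of a contracted graph: vertices with the
  -- same label have been identified.
  Labelling : Set → Set
  Labelling V = V → ℕ

  -- The two numbers are the numerator and the denominator of the conductance of the edge. Fractions
  -- are not reduced: a common factor reappears in front of the sum (`treeSum-scaleAll`).
  WEdge : Set → Set
  WEdge V = (V × V) × (ℕ × ℕ)

  -- Partitions of the vertices and the merging of two classes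

  module _ {V : Set} where

    infix 4 _⊑_ _≈_
    -- Only the partition into classes carries meaning; the label values make it decidable.
    -- Contracted graphs are therefore compared up to `_≈_`.
    record _⊑_ (ρ σ : Labelling V) : Set where
      constructor coarser
      field weaken : ∀ {x y} → ρ x ≡ ρ y → σ x ≡ σ y
    open _⊑_ public

    _≈_ : Labelling V → Labelling V → Set
    ρ ≈ σ = ρ ⊑ σ × σ ⊑ ρ

    ⊑-refl : ∀ {ρ} → ρ ⊑ ρ
    ⊑-refl = coarser id

    ⊑-trans : ∀ {ρ σ τ} → ρ ⊑ σ → σ ⊑ τ → ρ ⊑ τ
    ⊑-trans (coarser f) (coarser g) = coarser (g ∘ f)

    ≈-refl : ∀ {ρ} → ρ ≈ ρ
    ≈-refl = ⊑-refl , ⊑-refl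

    opaque
      -- Opaque, because what counts is that the result is the finest coarsening of `ρ` that
      -- identifies `u` and `v`. The label values themselves matter only for counting classes, which
      -- is the purpose of `merge-label`.
      merge : Labelling V → V → V → Labelling V
      merge ρ u v x = if-yes (ρ x ≟ ρ v) (ρ u) (ρ x)

      merge-⊒ : ∀ ρ u v → ρ ⊑ merge ρ u v
      merge-⊒ ρ u v .weaken {x} {y} eq with ρ x ≟ ρ v | ρ y ≟ ρ v
      ... | yes _ | yes _ = refl
      ... | no _  | no _  = eq
      ... | yes p | no q  = contradiction (trans (sym eq) p) q
      ... | no p  | yes q = contradiction (trans eq q) p

      merge-joins : ∀ ρ u v → merge ρ u v u ≡ merge ρ u v v
      merge-joins ρ u v with ρ u ≟ ρ v | ρ v ≟ ρ v
      ... | yes _ | yes _ = refl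
      ... | no _  | yes _ = refl
      ... | _     | no q  = contradiction refl q

      merge-≡⁻ : ∀ ρ u v {x y} → merge ρ u v x ≡ merge ρ u v y →
                 ρ x ≡ ρ y ⊎ (ρ x ≡ ρ u × ρ y ≡ ρ v) ⊎ (ρ x ≡ ρ v × ρ y ≡ ρ u)
      merge-≡⁻ ρ u v {x} {y} eq with ρ x ≟ ρ v | ρ y ≟ ρ v
      ... | yes p | yes q = inj₁ (trans p (sym q))
      ... | no _  | no _  = inj₁ eq
      ... | yes p | no _  = inj₂ (inj₂ (p , sym eq))
      ... | no _  | yes q = inj₂ (inj₁ (eq , q))

      merge-label : ∀ ρ u v x → (ρ x ≡ ρ v × merge ρ u v x ≡ ρ u) ⊎ (ρ x ≢ ρ v × merge ρ u v x ≡ ρ x)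
      merge-label ρ u v x with ρ x ≟ ρ v
      ... | yes p = inj₁ (p , refl)
      ... | no  p = inj₂ (p , refl)

    -- The classes of `merge ρ u v` form the equivalence generated by `ρ` and the pair `u`, `v`. The
    -- relation is left open for two instances: equal labels under a coarser labelling, and
    -- connection by contracted edges.
    merge-least : ∀ (R : V → V → Set) → (∀ {x y} → R x y → R y x) →
                  (∀ {x y z} → R x y → R y z → R x z) →
                  ∀ ρ u v → (∀ {x y} → ρ x ≡ ρ y → R x y) → R u v →
                  ∀ {x y} → merge ρ u v x ≡ merge ρ u v y → R x y
    merge-least R symR transR ρ u v R⊇ Ruv eq with merge-≡⁻ ρ u v eq
    ... | inj₁ p              = R⊇ p
    ... | inj₂ (inj₁ (p , q)) = transR (R⊇ p) (transR Ruv (R⊇ (sym q)))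
    ... | inj₂ (inj₂ (p , q)) = transR (R⊇ p) (transR (symR Ruv) (R⊇ (sym q)))

    merge-⊑ : ∀ {ρ σ u v} → ρ ⊑ σ → σ u ≡ σ v → merge ρ u v ⊑ σ
    merge-⊑ {ρ} {σ} {u} {v} le eq =
      coarser (merge-least (λ x y → σ x ≡ σ y) sym trans ρ u v (weaken le) eq)

    merge-≢ : ∀ {ρ} u v {x y} → ρ x ≢ ρ u → ρ x ≢ ρ v → ρ x ≢ ρ y → merge ρ u v x ≢ merge ρ u v y
    merge-≢ {ρ} u v xu xv xy eq with merge-≡⁻ ρ u v eq
    ... | inj₁ p              = xy p
    ... | inj₂ (inj₁ (p , _)) = xu p
    ... | inj₂ (inj₂ (p , _)) = xv p

    merge-flip : ∀ ρ u v → merge ρ u v ≈ merge ρ v u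
    merge-flip ρ u v =
      merge-⊑ (merge-⊒ ρ v u) (sym (merge-joins ρ v u)) ,
      merge-⊑ (merge-⊒ ρ u v) (sym (merge-joins ρ u v))

    merge-swap : ∀ ρ u v x y → merge (merge ρ u v) x y ≈ merge (merge ρ x y) u v
    merge-swap ρ u v x y = half u v x y , half x y u v
      where
      half : ∀ u v x y → merge (merge ρ u v) x y ⊑ merge (merge ρ x y) u v
      half u v x y = merge-⊑
        (merge-⊑ (⊑-trans (merge-⊒ ρ x y) (merge-⊒ _ u v)) (merge-joins _ u v))
        (weaken (merge-⊒ _ u v) (merge-joins ρ x y))

    -- The exchange property of the graphic matroid: if contracting one edge turns another, not a
    -- loop before, into a loop, then the two are parallel and their roles can be interchanged.
    merge-exchange : ∀ ρ u v x y → ρ x ≢ ρ y → merge ρ u v x ≡ merge ρ u v y → merge ρ x y u ≡ merge ρ x y v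
    merge-exchange ρ u v x y ne eq with merge-≡⁻ ρ u v eq
    ... | inj₁ p              = contradiction p ne
    ... | inj₂ (inj₁ (p , q)) = trans (sym (weaken ⊒ p)) (trans (merge-joins ρ x y) (weaken ⊒ q))
      where ⊒ = merge-⊒ ρ x y
    ... | inj₂ (inj₂ (p , q)) = trans (sym (weaken ⊒ q)) (trans (sym (merge-joins ρ x y)) (weaken ⊒ p))
      where ⊒ = merge-⊒ ρ x y

    AllEqual : List V → Labelling V → Set
    AllEqual S ρ = All (λ x → All (λ y → ρ x ≡ ρ y) S) S

    allEqual? : ∀ S ρ → Dec (AllEqual S ρ)
    allEqual? S ρ = All.all? (λ x → All.all? (λ y → ρ x ≟ ρ y) S) S

    allEqual⇒ : ∀ {S ρ x y} → AllEqual S ρ → x ∈ˡ S → y ∈ˡ S → ρ x ≡ ρ y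
    allEqual⇒ eq x∈ y∈ = All.lookup (All.lookup eq x∈) y∈

    ⇒allEqual : ∀ {S ρ} → (∀ {x y} → x ∈ˡ S → y ∈ˡ S → ρ x ≡ ρ y) → AllEqual S ρ
    ⇒allEqual f = All.tabulate λ x∈ → All.tabulate λ y∈ → f x∈ y∈

    -- The sum, over the sets of edges that turn S (and whatever else they touch)
    -- into a tree once the vertices with equal labels have been identified, of
    -- the products of the first weights of the edges in the set and of the
    -- second weights of the others.
    treeSum : List V → Labelling V → List (WEdge V) → ℕ
    treeSum S ρ []                        = indicator (allEqual? S ρ)
    treeSum S ρ (((u , v) , (p , q)) ∷ es) =
      q * treeSum S ρ es + unlessLoop (ρ u ≟ ρ v) (p * treeSum S (merge ρ u v) es)

    treeSum-loop : ∀ S ρ u v p q es → ρ u ≡ ρ v →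
                   treeSum S ρ (((u , v) , (p , q)) ∷ es) ≡ q * treeSum S ρ es
    treeSum-loop S ρ u v p q es eq with ρ u ≟ ρ v
    ... | yes _ = +-identityʳ _
    ... | no ne = contradiction eq ne

    treeSum-link : ∀ S ρ u v p q es → ρ u ≢ ρ v →
                   treeSum S ρ (((u , v) , (p , q)) ∷ es) ≡
                   q * treeSum S ρ es + p * treeSum S (merge ρ u v) es
    treeSum-link S ρ u v p q es ne with ρ u ≟ ρ v
    ... | yes eq = contradiction eq ne
    ... | no _   = refl

  -- R relates the vertices of two graphs that describe the same vertex after
  -- identification.
  module _ {V W : Set} (R : V → W → Set) {S : List V} {S′ : List W}
           (forth : ∀ {x} → x ∈ˡ S → ∃[ x′ ] x′ ∈ˡ S′ × R x x′)
           (back  : ∀ {x′} → x′ ∈ˡ S′ → ∃[ x ] x ∈ˡ S × R x x′) where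

    WEdgeRel : WEdge V → WEdge W → Set
    WEdgeRel ((u , v) , a) ((u′ , v′) , a′) = R u u′ × R v v′ × a ≡ a′

    Compatible : Labelling V → Labelling W → Set
    Compatible ρ σ = ∀ {x x′ y y′} → R x x′ → R y y′ → (ρ x ≡ ρ y → σ x′ ≡ σ y′) × (σ x′ ≡ σ y′ → ρ x ≡ ρ y)

    -- A tree sum looks at labels only through equality tests on the ends of edges and on the
    -- members of the vertex list. A relation that preserves these tests suffices and may be neither
    -- functional nor injective; renaming vertices, moving an end within its class and dropping a
    -- contracted vertex are all instances.
    treeSum-related : ∀ {ρ σ es es′} → Compatible ρ σ → Pointwise WEdgeRel es es′ →
                      treeSum S ρ es ≡ treeSum S′ σ es′
    treeSum-related {ρ} {σ} c [] = indicator-cong (allEqual? S ρ) (allEqual? S′ σ)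
      (λ eq → ⇒allEqual λ x∈ y∈ → let (_ , x∈′ , r) = back x∈ ; (_ , y∈′ , r′) = back y∈ in
        proj₁ (c r r′) (allEqual⇒ {ρ = ρ} eq x∈′ y∈′))
      (λ eq → ⇒allEqual λ x∈ y∈ → let (_ , x∈′ , r) = forth x∈ ; (_ , y∈′ , r′) = forth y∈ in
        proj₂ (c r r′) (allEqual⇒ {ρ = σ} eq x∈′ y∈′))
    treeSum-related {ρ} {σ} {((u , v) , (p , q)) ∷ es} {((u′ , v′) , _) ∷ es′} c ((r , r′ , refl) ∷ rs)
      with ρ u ≟ ρ v | σ u′ ≟ σ v′
    ... | yes _ | yes _ = cong (λ a → q * a + 0) (treeSum-related c rs)
    ... | no _  | no _  = cong₂ (λ a b → q * a + p * b) (treeSum-related c rs)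
                            (treeSum-related merged rs)
      where
      transfer : ∀ {V W : Set} {R : V → W → Set} {ρ : Labelling V} {σ : Labelling W} {u v u′ v′ x y x′ y′} →
                 (∀ {x x′ y y′} → R x x′ → R y y′ → ρ x ≡ ρ y → σ x′ ≡ σ y′) →
                 R u u′ → R v v′ → R x x′ → R y y′ →
                 merge ρ u v x ≡ merge ρ u v y → merge σ u′ v′ x′ ≡ merge σ u′ v′ y′
      transfer {ρ = ρ} {σ} {u} {v} {u′} {v′} f ru rv rx ry eq with merge-≡⁻ ρ u v eq
      ... | inj₁ p = weaken (merge-⊒ σ u′ v′) (f rx ry p)
      ... | inj₂ (inj₁ (p , q)) = trans (weaken ⊒ (f rx ru p)) (trans (merge-joins σ u′ v′) (sym (weaken ⊒ (f ry rv q))))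
        where ⊒ = merge-⊒ σ u′ v′
      ... | inj₂ (inj₂ (p , q)) = trans (weaken ⊒ (f rx rv p)) (trans (sym (merge-joins σ u′ v′)) (sym (weaken ⊒ (f ry ru q))))
        where ⊒ = merge-⊒ σ u′ v′
      merged : Compatible (merge ρ u v) (merge σ u′ v′)
      merged rx ry = transfer {R = R} (λ a b → proj₁ (c a b)) r r′ rx ry ,
        transfer {R = λ a b → R b a} (λ a b → proj₂ (c a b)) r r′ rx ry
    ... | yes a | no b  = contradiction (proj₁ (c r r′) a) b
    ... | no a  | yes b = contradiction (proj₂ (c r r′) b) a

  -- Independence of the labels and of the order of the edges

  module _ {V : Set} where

    SameSet : List V → List V → Set
    SameSet S S′ = (∀ {x} → x ∈ˡ S → x ∈ˡ S′) × (∀ {x} → x ∈ˡ S′ → x ∈ˡ S)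

    treeSum-sameSet : ∀ {S S′} {ρ σ : Labelling V} es → SameSet S S′ → ρ ≈ σ →
                      treeSum S ρ es ≡ treeSum S′ σ es
    treeSum-sameSet {S} {S′} {ρ} {σ} es (f , g) (a , b) = treeSum-related _≡_ {S} {S′}
      (λ x∈ → _ , f x∈ , refl) (λ x∈ → _ , g x∈ , refl) {ρ} {σ} {es}
      (λ where refl refl → weaken a , weaken b) (Pointwise.refl (refl , refl , refl))

    treeSum-cong : ∀ S {ρ σ : Labelling V} es → ρ ≈ σ → treeSum S ρ es ≡ treeSum S σ es
    treeSum-cong S es = treeSum-sameSet es (id , id)

    treeSum-flip : ∀ S ρ (u v : V) a es → treeSum S ρ (((u , v) , a) ∷ es) ≡ treeSum S ρ (((v , u) , a) ∷ es)
    treeSum-flip S ρ u v (p , q) es with ρ u ≟ ρ v | ρ v ≟ ρ u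
    ... | yes _ | yes _ = refl
    ... | no _  | no _  = cong (λ a → q * treeSum S ρ es + p * a) (treeSum-cong S es (merge-flip ρ u v))
    ... | yes a | no b  = contradiction (sym a) b
    ... | no a  | yes b = contradiction (sym b) a

    -- Deletions and contractions of different edges commute. The delicate case is that of parallel
    -- edges, where contracting either makes the other a loop: by `merge-exchange` this happens for
    -- both or for neither, and if it happens, the two contractions agree.
    treeSum-swap : ∀ S ρ (e f : WEdge V) es → treeSum S ρ (e ∷ f ∷ es) ≡ treeSum S ρ (f ∷ e ∷ es)
    treeSum-swap S ρ ((u , v) , (p , q)) ((x , y) , (p′ , q′)) es with ρ u ≟ ρ v | ρ x ≟ ρ y
    ... | yes _ | yes _ = rearrange q q′ (treeSum S ρ es)
      where
      rearrange : ∀ q q′ τ → q * (q′ * τ + 0) + 0 ≡ q′ * (q * τ + 0) + 0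
      rearrange = solve-∀
    ... | yes a | no _ = begin
      q * (q′ * τ + p′ * τ′) + 0          ≡⟨ rearrange q q′ p′ τ τ′ ⟩
      q′ * (q * τ + 0) + p′ * (q * τ′)    ≡⟨ cong (λ z → q′ * (q * τ + 0) + p′ * z) (treeSum-loop S (merge ρ x y) u v p q es (weaken (merge-⊒ ρ x y) a)) ⟨
      _ ∎
      where
      open ≡-Reasoning
      τ = treeSum S ρ es
      τ′ = treeSum S (merge ρ x y) es
      rearrange : ∀ q q′ p′ τ τ′ → q * (q′ * τ + p′ * τ′) + 0 ≡ q′ * (q * τ + 0) + p′ * (q * τ′)
      rearrange = solve-∀
    ... | no _ | yes a = begin
      q * (q′ * τ + 0) + p * _            ≡⟨ cong (λ z → q * (q′ * τ + 0) + p * z) (treeSum-loop S (merge ρ u v) x y p′ q′ es (weaken (merge-⊒ ρ u v) a)) ⟩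
      q * (q′ * τ + 0) + p * (q′ * τ′)    ≡⟨ rearrange q q′ p τ τ′ ⟩
      q′ * (q * τ + p * τ′) + 0           ∎
      where
      open ≡-Reasoning
      τ = treeSum S ρ es
      τ′ = treeSum S (merge ρ u v) es
      rearrange : ∀ q q′ p τ τ′ → q * (q′ * τ + 0) + p * (q′ * τ′) ≡ q′ * (q * τ + p * τ′) + 0
      rearrange = solve-∀
    ... | no a | no b with merge ρ u v x ≟ merge ρ u v y | merge ρ x y u ≟ merge ρ x y v
    ...   | yes c | yes d = begin
      q * (q′ * τ + p′ * τ₂) + p * (q′ * τ₁ + 0) ≡⟨ cong (λ z → q * (q′ * τ + p′ * τ₂) + p * (q′ * z + 0)) (treeSum-cong S es parallel) ⟩
      q * (q′ * τ + p′ * τ₂) + p * (q′ * τ₂ + 0) ≡⟨ rearrange q q′ p p′ τ τ₂ ⟩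
      q′ * (q * τ + p * τ₂) + p′ * (q * τ₂ + 0)  ≡⟨ cong (λ z → q′ * (q * τ + p * z) + p′ * (q * τ₂ + 0)) (treeSum-cong S es parallel) ⟨
      q′ * (q * τ + p * τ₁) + p′ * (q * τ₂ + 0)  ∎
      where
      open ≡-Reasoning
      τ = treeSum S ρ es
      τ₁ = treeSum S (merge ρ u v) es
      τ₂ = treeSum S (merge ρ x y) es
      parallel : merge ρ u v ≈ merge ρ x y
      parallel = merge-⊑ (merge-⊒ ρ x y) d , merge-⊑ (merge-⊒ ρ u v) c
      rearrange : ∀ q q′ p p′ τ τ₂ → q * (q′ * τ + p′ * τ₂) + p * (q′ * τ₂ + 0) ≡ q′ * (q * τ + p * τ₂) + p′ * (q * τ₂ + 0)
      rearrange = solve-∀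
    ...   | no c | no d = begin
      q * (q′ * τ + p′ * τ₂) + p * (q′ * τ₁ + p′ * τ₃) ≡⟨ cong (λ z → q * (q′ * τ + p′ * τ₂) + p * (q′ * τ₁ + p′ * z)) (treeSum-cong S es (merge-swap ρ u v x y)) ⟩
      q * (q′ * τ + p′ * τ₂) + p * (q′ * τ₁ + p′ * τ₄) ≡⟨ rearrange q q′ p p′ τ τ₁ τ₂ τ₄ ⟩
      q′ * (q * τ + p * τ₁) + p′ * (q * τ₂ + p * τ₄)   ∎
      where
      open ≡-Reasoning
      τ = treeSum S ρ es
      τ₁ = treeSum S (merge ρ u v) es
      τ₂ = treeSum S (merge ρ x y) es
      τ₃ = treeSum S (merge (merge ρ u v) x y) es
      τ₄ = treeSum S (merge (merge ρ x y) u v) es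
      rearrange : ∀ q q′ p p′ τ τ₁ τ₂ τ₄ → q * (q′ * τ + p′ * τ₂) + p * (q′ * τ₁ + p′ * τ₄) ≡ q′ * (q * τ + p * τ₁) + p′ * (q * τ₂ + p * τ₄)
      rearrange = solve-∀
    ...   | yes c | no d = contradiction (merge-exchange ρ u v x y b c) d
    ...   | no c | yes d = contradiction (merge-exchange ρ x y u v a d) c

    treeSum-∷ : ∀ S es fs (e : WEdge V) → (∀ ρ → treeSum S ρ es ≡ treeSum S ρ fs) →
                ∀ ρ → treeSum S ρ (e ∷ es) ≡ treeSum S ρ (e ∷ fs)
    treeSum-∷ S es fs ((u , v) , (p , q)) eq ρ =
      cong₂ (λ a b → q * a + unlessLoop (ρ u ≟ ρ v) (p * b)) (eq ρ) (eq (merge ρ u v))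

    treeSum-↭ : ∀ {S es fs} → es ↭ fs → ∀ (ρ : Labelling V) → treeSum S ρ es ≡ treeSum S ρ fs
    treeSum-↭ Perm.refl ρ = refl
    treeSum-↭ {S} {_ ∷ es} {_ ∷ fs} (Perm.prep e π) ρ = treeSum-∷ S es fs e (treeSum-↭ {S} π) ρ
    treeSum-↭ {S} {_ ∷ _ ∷ es} {_ ∷ _ ∷ fs} (Perm.swap e f π) ρ =
      trans (treeSum-∷ S (f ∷ es) (f ∷ fs) e (treeSum-∷ S es fs f (treeSum-↭ {S} π)) ρ) (treeSum-swap S ρ e f fs)
    treeSum-↭ {S} (Perm.trans π π′) ρ = trans (treeSum-↭ {S} π ρ) (treeSum-↭ {S} π′ ρ)

  -- Series reduction and the star-mesh transformation

  module _ {V : Set} where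

    record Fresh (c : V) (ρ : Labelling V) : Set where
      constructor fresh
      field apart : ∀ {x} → x ≢ c → ρ x ≢ ρ c
    open Fresh public

    Avoids : V → List (WEdge V) → Set
    Avoids c = All (λ e → proj₁ (proj₁ e) ≢ c × proj₂ (proj₁ e) ≢ c)

    fresh-merge : ∀ {c ρ u v} → Fresh c ρ → u ≢ c → v ≢ c → Fresh c (merge ρ u v)
    fresh-merge {u = u} {v} fr u≢ v≢ .apart x≢ eq =
      merge-≢ u v (≢-sym (apart fr u≢)) (≢-sym (apart fr v≢)) (≢-sym (apart fr x≢)) (sym eq)

    merge-avoiding : ∀ {c ρ} u {x y} → Fresh c ρ → x ≢ c → y ≢ c → merge ρ u c x ≡ merge ρ u c y → ρ x ≡ ρ y
    merge-avoiding {c} {ρ} u fr x≢ y≢ eq with merge-≡⁻ ρ u c eq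
    ... | inj₁ p              = p
    ... | inj₂ (inj₁ (_ , q)) = contradiction q (apart fr y≢)
    ... | inj₂ (inj₂ (p , _)) = contradiction p (apart fr x≢)

    treeSum-[]-separated : ∀ {S} {ρ : Labelling V} {x y} → x ∈ˡ S → y ∈ˡ S → ρ x ≢ ρ y → treeSum S ρ [] ≡ 0
    treeSum-[]-separated {S} {ρ} x∈ y∈ ne with allEqual? S ρ
    ... | yes eq = contradiction (allEqual⇒ {ρ = ρ} eq x∈ y∈) ne
    ... | no _   = refl

    -- Contracting edges that avoid `c` never enlarges the class of `c`, so `c` and `x` are still
    -- separate when the edges are used up, and every term is zero.
    treeSum-isolated : ∀ {S c x} → c ∈ˡ S → x ∈ˡ S → x ≢ c →
                       ∀ ρ es → Fresh c ρ → Avoids c es → treeSum S ρ es ≡ 0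
    treeSum-isolated c∈ x∈ x≢ ρ [] fr [] = treeSum-[]-separated {ρ = ρ} x∈ c∈ (apart fr x≢)
    treeSum-isolated {S} c∈ x∈ x≢ ρ (((u , v) , (p , q)) ∷ es) fr ((u≢ , v≢) ∷ av)
      with ρ u ≟ ρ v
    ... | yes _ rewrite treeSum-isolated c∈ x∈ x≢ ρ es fr av | *-zeroʳ q = refl
    ... | no _ rewrite treeSum-isolated c∈ x∈ x≢ ρ es fr av | *-zeroʳ q
                     | treeSum-isolated c∈ x∈ x≢ (merge ρ u v) es (fresh-merge {ρ = ρ} fr u≢ v≢) av = *-zeroʳ p

    -- Contraction makes `c` another name of `u`, and no remaining edge uses that name. The relation
    -- `R` sends each vertex to the names in its class that differ from `c`.
    treeSum-eliminate : ∀ {S c u ρ} es → c ∉ˡ S → u ∈ˡ S → Fresh c ρ → Avoids c es →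
                        treeSum (c ∷ S) (merge ρ u c) es ≡ treeSum S ρ es
    treeSum-eliminate {S} {c} {u} {ρ} es c∉ u∈ fr av =
      treeSum-related R {c ∷ S} {S} forth back {μ} {ρ} {es} {es} compat (edges es av)
      where
      μ = merge ρ u c
      R : V → V → Set
      R x x′ = x′ ≢ c × μ x ≡ μ x′
      ∈⇒≢ : ∀ {x} → x ∈ˡ S → x ≢ c
      ∈⇒≢ x∈ refl = c∉ x∈
      forth : ∀ {x} → x ∈ˡ (c ∷ S) → ∃[ x′ ] x′ ∈ˡ S × R x x′
      forth (here refl) = u , u∈ , ∈⇒≢ u∈ , sym (merge-joins ρ u c)
      forth (there x∈)  = _ , x∈ , ∈⇒≢ x∈ , refl
      back : ∀ {x} → x ∈ˡ S → ∃[ x′ ] x′ ∈ˡ (c ∷ S) × R x′ x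
      back x∈ = _ , there x∈ , ∈⇒≢ x∈ , refl
      compat : ∀ {x x′ y y′} → R x x′ → R y y′ → (μ x ≡ μ y → ρ x′ ≡ ρ y′) × (ρ x′ ≡ ρ y′ → μ x ≡ μ y)
      compat (x≢ , p) (y≢ , q) =
        (λ eq → merge-avoiding {ρ = ρ} u fr x≢ y≢ (trans (sym p) (trans eq q))) ,
        (λ eq → trans p (trans (weaken (merge-⊒ ρ u c) eq) (sym q)))
      edges : ∀ es → Avoids c es → Pointwise (WEdgeRel R {c ∷ S} {S} forth back) es es
      edges [] [] = []
      edges (_ ∷ es) ((a , b) ∷ av) = ((a , refl) , (b , refl) , refl) ∷ edges es av

    treeSum-relabel : ∀ S (ρ : Labelling V) {es fs} →
      Pointwise (λ ((u , v) , a) ((u′ , v′) , a′) → ρ u ≡ ρ u′ × ρ v ≡ ρ v′ × a ≡ a′) es fs →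
      treeSum S ρ es ≡ treeSum S ρ fs
    treeSum-relabel S ρ {es} {fs} = treeSum-related R {S} {S}
      (λ x∈ → _ , x∈ , refl) (λ x∈ → _ , x∈ , refl) {ρ} {ρ} {es} {fs} compat
      where
      R : V → V → Set
      R x x′ = ρ x ≡ ρ x′
      compat : ∀ {x x′ y y′} → R x x′ → R y y′ → (ρ x ≡ ρ y → ρ x′ ≡ ρ y′) × (ρ x′ ≡ ρ y′ → ρ x ≡ ρ y)
      compat p q = (λ eq → trans (sym p) (trans eq q)) , (λ eq → trans p (trans eq (sym q)))

    treeSum-relabel₁ : ∀ S (ρ : Labelling V) {u u′ v a} es → ρ u ≡ ρ u′ →
                       treeSum S ρ (((u , v) , a) ∷ es) ≡ treeSum S ρ (((u′ , v) , a) ∷ es)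
    treeSum-relabel₁ S ρ {u} {u′} {v} {a} es eq =
      treeSum-relabel S ρ {((u , v) , a) ∷ es} {((u′ , v) , a) ∷ es} ((eq , refl , refl) ∷ Pointwise.refl (refl , refl , refl))

    -- The weights on the left belong to the resistance `q / p + q′ / p′` of two edges in series.
    -- The right-hand side separates two cases: the first edge is left out, which forces the second
    -- into the tree, or it is used, and then the second acts alone.
    treeSum-scale : ∀ S (ρ : Labelling V) u v p q p′ q′ es →
      treeSum S ρ (((u , v) , (p * p′ , p * q′ + p′ * q)) ∷ es) ≡
      q * (p′ * treeSum S ρ es) + p * treeSum S ρ (((u , v) , (p′ , q′)) ∷ es)
    treeSum-scale S ρ u v p q p′ q′ es with ρ u ≟ ρ v
    ... | yes _ = lemma p q p′ q′ (treeSum S ρ es)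
      where
      lemma : ∀ p q p′ q′ t → (p * q′ + p′ * q) * t + 0 ≡ q * (p′ * t) + p * (q′ * t + 0)
      lemma = solve-∀
    ... | no _ = lemma p q p′ q′ (treeSum S ρ es) (treeSum S (merge ρ u v) es)
      where
      lemma : ∀ p q p′ q′ t t′ → (p * q′ + p′ * q) * t + p * p′ * t′ ≡ q * (p′ * t) + p * (q′ * t + p′ * t′)
      lemma = solve-∀

    treeSum-series : ∀ {S c u v ρ} p q p′ q′ es → c ∉ˡ S → u ∈ˡ S → v ∈ˡ S → Fresh c ρ → Avoids c es →
      treeSum (c ∷ S) ρ (((u , c) , (p , q)) ∷ ((c , v) , (p′ , q′)) ∷ es) ≡
      treeSum S ρ (((u , v) , (p * p′ , p * q′ + p′ * q)) ∷ es)
    treeSum-series {S} {c} {u} {v} {ρ} p q p′ q′ es c∉ u∈ v∈ fr av = begin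
      treeSum (c ∷ S) ρ (((u , c) , (p , q)) ∷ cv ∷ es)
        ≡⟨ treeSum-link (c ∷ S) ρ u c p q (cv ∷ es) (apart fr u≢) ⟩
      q * treeSum (c ∷ S) ρ (cv ∷ es) + p * treeSum (c ∷ S) (merge ρ u c) (cv ∷ es)
        ≡⟨ cong₂ (λ a b → q * a + p * b) deleted contracted ⟩
      q * (p′ * treeSum S ρ es) + p * treeSum S ρ (((u , v) , (p′ , q′)) ∷ es)
        ≡⟨ treeSum-scale S ρ u v p q p′ q′ es ⟨
      treeSum S ρ (((u , v) , (p * p′ , p * q′ + p′ * q)) ∷ es) ∎
      where
      open ≡-Reasoning
      cv = ((c , v) , (p′ , q′))
      u≢ : u ≢ c
      u≢ refl = c∉ u∈
      v≢ : v ≢ c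
      v≢ refl = c∉ v∈
      deleted : treeSum (c ∷ S) ρ (cv ∷ es) ≡ p′ * treeSum S ρ es
      deleted = begin
        treeSum (c ∷ S) ρ (cv ∷ es)
          ≡⟨ treeSum-link (c ∷ S) ρ c v p′ q′ es (≢-sym (apart fr v≢)) ⟩
        q′ * treeSum (c ∷ S) ρ es + p′ * treeSum (c ∷ S) (merge ρ c v) es
          ≡⟨ cong₂ (λ a b → q′ * a + p′ * b)
               (treeSum-isolated (here refl) (there u∈) u≢ ρ es fr av)
               (trans (treeSum-cong (c ∷ S) es (merge-flip ρ c v)) (treeSum-eliminate {ρ = ρ} es c∉ v∈ fr av)) ⟩
        q′ * 0 + p′ * treeSum S ρ es
          ≡⟨ cong (_+ p′ * treeSum S ρ es) (*-zeroʳ q′) ⟩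
        p′ * treeSum S ρ es ∎
      contracted : treeSum (c ∷ S) (merge ρ u c) (cv ∷ es) ≡ treeSum S ρ (((u , v) , (p′ , q′)) ∷ es)
      contracted = trans
        (treeSum-relabel₁ (c ∷ S) (merge ρ u c) {c} {u} {v} {p′ , q′} es (sym (merge-joins ρ u c)))
        (treeSum-eliminate {ρ = ρ} (((u , v) , (p′ , q′)) ∷ es) c∉ u∈ fr ((u≢ , v≢) ∷ av))

    link₁ : ∀ S (ρ : Labelling V) u v p es → ρ u ≢ ρ v →
            treeSum S ρ (((u , v) , (p , 1)) ∷ es) ≡ treeSum S ρ es + p * treeSum S (merge ρ u v) es
    link₁ S ρ u v p es ne =
      trans (treeSum-link S ρ u v p 1 es ne) (cong (_+ p * treeSum S (merge ρ u v) es) (*-identityˡ _))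

    loop₁ : ∀ S (ρ : Labelling V) u v p es → ρ u ≡ ρ v → treeSum S ρ (((u , v) , (p , 1)) ∷ es) ≡ treeSum S ρ es
    loop₁ S ρ u v p es eq = trans (treeSum-loop S ρ u v p 1 es eq) (*-identityˡ _)

    -- Identities between stars and meshes

    spoke : V → ℕ → V → WEdge V
    spoke c w u = (c , u) , (w , 1)

    star : V → ℕ → List V → List (WEdge V)
    star c w = map (spoke c w)

    mesh : List V → List (WEdge V)
    mesh []      = []
    mesh (x ∷ l) = star x 1 l ++ mesh l

    -- The stars are interleaved so that an induction on the leaves meets both spokes of a leaf
    -- together.
    twoStars : V → ℕ → V → ℕ → List V → List (WEdge V)
    twoStars v α c β []      = []
    twoStars v α c β (u ∷ l) = spoke v α u ∷ spoke c β u ∷ twoStars v α c β l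

    module _ (S : List V) where

      -- In a star every class is joined to the centre independently of the others, so the sum is a
      -- product. If a and b are the total weights of the spokes to the classes of `u` and `v`, and
      -- P is the product of the other factors, the claim is (a + b) P = b P + a P.
      star-three : ∀ {u v c} w → u ∈ˡ S → v ∈ˡ S → c ∈ˡ S → ∀ ρ → ρ u ≢ ρ v → ρ u ≢ ρ c → ρ v ≢ ρ c → ∀ l →
        treeSum S (merge ρ u v) (star c w l) ≡ treeSum S (merge ρ u c) (star c w l) + treeSum S (merge ρ v c) (star c w l)
      star-three {u} {v} {c} w u∈ v∈ c∈ ρ uv uc vc [] = begin
        treeSum S (merge ρ u v) []   ≡⟨ treeSum-[]-separated {ρ = merge ρ u v} c∈ u∈ (merge-≢ u v (≢-sym uc) (≢-sym vc) (≢-sym uc)) ⟩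
        0                            ≡⟨ cong₂ _+_ (treeSum-[]-separated {ρ = merge ρ u c} v∈ u∈ (merge-≢ u c (≢-sym uv) vc (≢-sym uv)))
                                                  (treeSum-[]-separated {ρ = merge ρ v c} u∈ v∈ (merge-≢ v c uv uc uv)) ⟨
        treeSum S (merge ρ u c) [] + treeSum S (merge ρ v c) [] ∎
        where open ≡-Reasoning
      star-three {u} {v} {c} w u∈ v∈ c∈ ρ uv uc vc (z ∷ l) with ρ c ≟ ρ z | ρ u ≟ ρ z | ρ v ≟ ρ z
      ... | yes cz | _ | _ = begin
        T (merge ρ u v) (z ∷ l)                             ≡⟨ loop (merge-⊒ ρ u v) ⟩
        T (merge ρ u v) l                                   ≡⟨ star-three w u∈ v∈ c∈ ρ uv uc vc l ⟩
        T (merge ρ u c) l + T (merge ρ v c) l               ≡⟨ cong₂ _+_ (loop (merge-⊒ ρ u c)) (loop (merge-⊒ ρ v c)) ⟨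
        T (merge ρ u c) (z ∷ l) + T (merge ρ v c) (z ∷ l)   ∎
        where
        open ≡-Reasoning
        T = λ σ l → treeSum S σ (star c w l)
        loop : ∀ {σ} → ρ ⊑ σ → T σ (z ∷ l) ≡ T σ l
        loop {σ} le = loop₁ S σ c z w (star c w l) (weaken le cz)
      -- A spoke to the class of `u` is a loop once `u` and `c` are identified. In the other two
      -- labellings its contraction identifies all of `u`, `v` and `c`.
      ... | no cz | yes uz | _ = begin
        T (merge ρ u v) (z ∷ l)
          ≡⟨ link₁ S (merge ρ u v) c z w (star c w l) (merge-≢ u v (≢-sym uc) (≢-sym vc) cz) ⟩
        T (merge ρ u v) l + w * T (merge (merge ρ u v) c z) l
          ≡⟨ cong₂ (λ a b → a + w * b) (star-three w u∈ v∈ c∈ ρ uv uc vc l) (treeSum-cong S (star c w l) all) ⟩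
        T (merge ρ u c) l + T (merge ρ v c) l + w * T (merge (merge ρ v c) c z) l
          ≡⟨ lemma (T (merge ρ u c) l) (T (merge ρ v c) l) (w * T (merge (merge ρ v c) c z) l) ⟩
        T (merge ρ u c) l + (T (merge ρ v c) l + w * T (merge (merge ρ v c) c z) l)
          ≡⟨ cong₂ _+_ (loop₁ S (merge ρ u c) c z w (star c w l) (trans (sym (merge-joins ρ u c)) (weaken (merge-⊒ ρ u c) uz)))
                       (link₁ S (merge ρ v c) c z w (star c w l) (≢-sym (merge-≢ v c (λ e → uv (trans uz e)) (λ e → cz (sym e)) (λ e → cz (sym e))))) ⟨
        T (merge ρ u c) (z ∷ l) + T (merge ρ v c) (z ∷ l)   ∎
        where
        open ≡-Reasoning
        T = λ σ l → treeSum S σ (star c w l)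
        lemma : ∀ a b c → a + b + c ≡ a + (b + c)
        lemma = solve-∀
        all : merge (merge ρ u v) c z ≈ merge (merge ρ v c) c z
        all =
          merge-⊑ (merge-⊑ (⊑-trans (merge-⊒ ρ v c) ⊒₁)
            (trans (weaken (⊑-trans (merge-⊒ ρ v c) ⊒₁) uz)
              (trans (sym (merge-joins _ c z)) (weaken ⊒₁ (sym (merge-joins ρ v c)))))) (merge-joins _ c z) ,
          merge-⊑ (merge-⊑ (⊑-trans (merge-⊒ ρ u v) ⊒₂)
            (trans (weaken ⊒₂ (sym (merge-joins ρ u v)))
              (trans (weaken (⊑-trans (merge-⊒ ρ u v) ⊒₂) uz) (sym (merge-joins _ c z))))) (merge-joins _ c z)
          where
          ⊒₁ = merge-⊒ (merge ρ v c) c z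
          ⊒₂ = merge-⊒ (merge ρ u v) c z
      ... | no cz | no uz | yes vz = begin
        T (merge ρ u v) (z ∷ l)
          ≡⟨ link₁ S (merge ρ u v) c z w (star c w l) (merge-≢ u v (≢-sym uc) (≢-sym vc) cz) ⟩
        T (merge ρ u v) l + w * T (merge (merge ρ u v) c z) l
          ≡⟨ cong₂ (λ a b → a + w * b) (star-three w u∈ v∈ c∈ ρ uv uc vc l) (treeSum-cong S (star c w l) all) ⟩
        T (merge ρ u c) l + T (merge ρ v c) l + w * T (merge (merge ρ u c) c z) l
          ≡⟨ lemma (T (merge ρ u c) l) (T (merge ρ v c) l) (w * T (merge (merge ρ u c) c z) l) ⟩
        T (merge ρ u c) l + w * T (merge (merge ρ u c) c z) l + T (merge ρ v c) l
          ≡⟨ cong₂ _+_ (link₁ S (merge ρ u c) c z w (star c w l) (≢-sym (merge-≢ u c (λ e → uv (trans (sym e) (sym vz))) (≢-sym cz) (≢-sym cz))))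
                       (loop₁ S (merge ρ v c) c z w (star c w l) (trans (sym (merge-joins ρ v c)) (weaken (merge-⊒ ρ v c) vz))) ⟨
        T (merge ρ u c) (z ∷ l) + T (merge ρ v c) (z ∷ l)   ∎
        where
        open ≡-Reasoning
        T = λ σ l → treeSum S σ (star c w l)
        lemma : ∀ a b c → a + b + c ≡ a + c + b
        lemma = solve-∀
        all : merge (merge ρ u v) c z ≈ merge (merge ρ u c) c z
        all =
          merge-⊑ (merge-⊑ (⊑-trans (merge-⊒ ρ u c) ⊒₁)
            (trans (weaken ⊒₁ (merge-joins ρ u c)) (trans (merge-joins _ c z)
              (sym (weaken (⊑-trans (merge-⊒ ρ u c) ⊒₁) vz))))) (merge-joins _ c z) ,
          merge-⊑ (merge-⊑ (⊑-trans (merge-⊒ ρ u v) ⊒₂)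
            (trans (weaken ⊒₂ (merge-joins ρ u v))
              (trans (weaken (⊑-trans (merge-⊒ ρ u v) ⊒₂) vz) (sym (merge-joins _ c z))))) (merge-joins _ c z)
          where
          ⊒₁ = merge-⊒ (merge ρ u c) c z
          ⊒₂ = merge-⊒ (merge ρ u v) c z
      ... | no cz | no uz | no vz = begin
        T (merge ρ u v) (z ∷ l)
          ≡⟨ link₁ S (merge ρ u v) c z w (star c w l) (merge-≢ u v (≢-sym uc) (≢-sym vc) cz) ⟩
        T (merge ρ u v) l + w * T (merge (merge ρ u v) c z) l
          ≡⟨ cong₂ (λ a b → a + w * b) (star-three w u∈ v∈ c∈ ρ uv uc vc l) contracted ⟩
        T (merge ρ u c) l + T (merge ρ v c) l + w * (T (merge (merge ρ u c) c z) l + T (merge (merge ρ v c) c z) l)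
          ≡⟨ lemma (T (merge ρ u c) l) (T (merge ρ v c) l) w (T (merge (merge ρ u c) c z) l) (T (merge (merge ρ v c) c z) l) ⟩
        T (merge ρ u c) l + w * T (merge (merge ρ u c) c z) l + (T (merge ρ v c) l + w * T (merge (merge ρ v c) c z) l)
          ≡⟨ cong₂ _+_ (link₁ S (merge ρ u c) c z w (star c w l) (≢-sym (merge-≢ u c (≢-sym uz) (≢-sym cz) (≢-sym cz))))
                       (link₁ S (merge ρ v c) c z w (star c w l) (≢-sym (merge-≢ v c (≢-sym vz) (≢-sym cz) (≢-sym cz)))) ⟨
        T (merge ρ u c) (z ∷ l) + T (merge ρ v c) (z ∷ l)   ∎
        where
        open ≡-Reasoning
        T = λ σ l → treeSum S σ (star c w l)
        lemma : ∀ a b w d e → a + b + w * (d + e) ≡ a + w * d + (b + w * e)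
        lemma = solve-∀
        contracted : T (merge (merge ρ u v) c z) l ≡ T (merge (merge ρ u c) c z) l + T (merge (merge ρ v c) c z) l
        contracted = begin
          T (merge (merge ρ u v) c z) l
            ≡⟨ treeSum-cong S (star c w l) (merge-swap ρ u v c z) ⟩
          T (merge (merge ρ c z) u v) l
            ≡⟨ star-three w u∈ v∈ c∈ (merge ρ c z) (merge-≢ c z uc uz uv) (merge-≢ c z uc uz uc) (merge-≢ c z vc vz vc) l ⟩
          T (merge (merge ρ c z) u c) l + T (merge (merge ρ c z) v c) l
            ≡⟨ cong₂ _+_ (treeSum-cong S (star c w l) (merge-swap ρ u c c z)) (treeSum-cong S (star c w l) (merge-swap ρ v c c z)) ⟨
          T (merge (merge ρ u c) c z) l + T (merge (merge ρ v c) c z) l ∎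

  module _ {V : Set} where

    star-recentre : ∀ S (ρ : Labelling V) {c v} w l → ρ v ≡ ρ c →
                    treeSum S ρ (star v w l) ≡ treeSum S ρ (star c w l)
    star-recentre S ρ {c} {v} w l eq = treeSum-relabel S ρ (pointwise l)
      where
      pointwise : ∀ l → Pointwise (λ ((u , v) , a) ((u′ , v′) , a′) → ρ u ≡ ρ u′ × ρ v ≡ ρ v′ × a ≡ a′) (star v w l) (star c w l)
      pointwise []      = []
      pointwise (u ∷ l) = (eq , refl , refl) ∷ pointwise l

    -- Identifying the centres makes the two spokes of each leaf parallel, and parallel weights add
    -- up.
    twoStars-joined : ∀ S (ρ : Labelling V) {v c} α β l → ρ c ≡ ρ v →
                      treeSum S ρ (twoStars v α c β l) ≡ treeSum S ρ (star c (α + β) l)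
    twoStars-joined S ρ α β [] eq = refl
    twoStars-joined S ρ {v} {c} α β (u ∷ l) eq = cases (ρ c ≟ ρ u)
     where
     cases : Dec (ρ c ≡ ρ u) → treeSum S ρ (twoStars v α c β (u ∷ l)) ≡ treeSum S ρ (star c (α + β) (u ∷ l))
     cases (yes cu) = begin
      treeSum S ρ (twoStars v α c β (u ∷ l))    ≡⟨ loop₁ S ρ v u α (spoke c β u ∷ twoStars v α c β l) (trans (sym eq) cu) ⟩
      treeSum S ρ (spoke c β u ∷ twoStars v α c β l) ≡⟨ loop₁ S ρ c u β (twoStars v α c β l) cu ⟩
      treeSum S ρ (twoStars v α c β l)          ≡⟨ twoStars-joined S ρ α β l eq ⟩
      treeSum S ρ (star c (α + β) l)            ≡⟨ loop₁ S ρ c u (α + β) (star c (α + β) l) cu ⟨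
      treeSum S ρ (star c (α + β) (u ∷ l))      ∎
      where open ≡-Reasoning
     cases (no cu) = begin
      treeSum S ρ (twoStars v α c β (u ∷ l))
        ≡⟨ link₁ S ρ v u α (spoke c β u ∷ twoStars v α c β l) (λ e → cu (trans eq e)) ⟩
      treeSum S ρ (spoke c β u ∷ twoStars v α c β l) + α * treeSum S (merge ρ v u) (spoke c β u ∷ twoStars v α c β l)
        ≡⟨ cong₂ (λ a b → a + α * b) (link₁ S ρ c u β (twoStars v α c β l) cu)
             (loop₁ S (merge ρ v u) c u β (twoStars v α c β l) (trans (weaken (merge-⊒ ρ v u) eq) (merge-joins ρ v u))) ⟩
      τ ρ + β * τ (merge ρ c u) + α * τ (merge ρ v u)
        ≡⟨ cong (λ a → τ ρ + β * τ (merge ρ c u) + α * a) (treeSum-cong S (twoStars v α c β l) same) ⟩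
      τ ρ + β * τ (merge ρ c u) + α * τ (merge ρ c u)
        ≡⟨ cong₂ (λ a b → a + β * b + α * b) (twoStars-joined S ρ α β l eq)
              (twoStars-joined S (merge ρ c u) α β l (weaken (merge-⊒ ρ c u) eq)) ⟩
      τ′ ρ + β * τ′ (merge ρ c u) + α * τ′ (merge ρ c u)
        ≡⟨ collect α β (τ′ ρ) (τ′ (merge ρ c u)) ⟩
      τ′ ρ + (α + β) * τ′ (merge ρ c u)
        ≡⟨ link₁ S ρ c u (α + β) (star c (α + β) l) cu ⟨
      treeSum S ρ (star c (α + β) (u ∷ l)) ∎
      where
      open ≡-Reasoning
      τ τ′ : Labelling V → ℕ
      τ σ = treeSum S σ (twoStars v α c β l)
      τ′ σ = treeSum S σ (star c (α + β) l)
      same : merge ρ v u ≈ merge ρ c u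
      same = merge-⊑ (merge-⊒ ρ c u) (trans (sym (weaken (merge-⊒ ρ c u) eq)) (merge-joins ρ c u)) ,
             merge-⊑ (merge-⊒ ρ v u) (trans (weaken (merge-⊒ ρ v u) eq) (merge-joins ρ v u))
      collect : ∀ α β a b → a + β * b + α * b ≡ a + (α + β) * b
      collect = solve-∀

    -- With the weights of the classes of the vertices as unknowns, both sides
    -- are explicit products; the induction avoids speaking of classes.
    twoStars-separate : ∀ S (ρ : Labelling V) {v c} α β l → v ∈ˡ S → c ∈ˡ S → All (_∈ˡ S) l → ρ c ≢ ρ v →
      let s = α + β in
      s * s * treeSum S ρ (twoStars v α c β l) ≡
      β * β * treeSum S ρ (star c s l) + α * α * treeSum S ρ (star v s l) +
      α * β * length l * s * treeSum S (merge ρ c v) (star c s l)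
    twoStars-separate S ρ {v} {c} α β [] v∈ c∈ [] ne
      rewrite treeSum-[]-separated {S = S} {ρ = ρ} c∈ v∈ ne = zeros α β (treeSum S (merge ρ c v) [])
      where
      zeros : ∀ α β b → (α + β) * (α + β) * 0 ≡ β * β * 0 + α * α * 0 + α * β * 0 * (α + β) * b
      zeros = solve-∀
    twoStars-separate S ρ {v} {c} α β (u ∷ l) v∈ c∈ (u∈ ∷ l∈) ne = cases (ρ v ≟ ρ u) (ρ c ≟ ρ u)
     where
     cases : Dec (ρ v ≡ ρ u) → Dec (ρ c ≡ ρ u) →
       (α + β) * (α + β) * treeSum S ρ (twoStars v α c β (u ∷ l)) ≡
       β * β * treeSum S ρ (star c (α + β) (u ∷ l)) + α * α * treeSum S ρ (star v (α + β) (u ∷ l)) +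
       α * β * suc (length l) * (α + β) * treeSum S (merge ρ c v) (star c (α + β) (u ∷ l))
     cases (yes vu) (yes cu) = contradiction (trans cu (sym vu)) ne
     -- The spoke from `c` to `u` links the centres directly. Its coefficient `s * s * β` of the
     -- merged sum splits on the right into `β * β * s` from the star around `c` and `α * β * s`
     -- from the list being longer by one.
     cases (yes vu) (no cu) = begin
      s * s * treeSum S ρ (twoStars v α c β (u ∷ l))
        ≡⟨ cong (s * s *_) (trans (loop₁ S ρ v u α (spoke c β u ∷ twoStars v α c β l) vu) (link₁ S ρ c u β (twoStars v α c β l) cu)) ⟩
      s * s * (A ρ + β * A (merge ρ c u))
        ≡⟨ cong (λ a → s * s * (A ρ + β * a)) (trans (treeSum-cong S (twoStars v α c β l) same) (twoStars-joined S (merge ρ c v) α β l (merge-joins ρ c v))) ⟩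
      s * s * (A ρ + β * B)
        ≡⟨ distribute s β (A ρ) B ⟩
      s * s * A ρ + s * s * β * B
        ≡⟨ cong (_+ s * s * β * B) (twoStars-separate S ρ α β l v∈ c∈ l∈ ne) ⟩
      β * β * C ρ + α * α * D ρ + α * β * length l * s * B + s * s * β * B
        ≡⟨ lemma α β (length l) (C ρ) (D ρ) B ⟩
      β * β * (C ρ + s * B) + α * α * D ρ + α * β * suc (length l) * s * B
        ≡⟨ cong₂ _+_ (cong₂ (λ a b → β * β * a + α * α * b)
             (trans (cong (λ a → C ρ + s * a) (sym (treeSum-cong S (star c s l) same))) (sym (link₁ S ρ c u s (star c s l) cu)))
             (sym (loop₁ S ρ v u s (star v s l) vu)))
           (cong (α * β * suc (length l) * s *_) (sym (loop₁ S (merge ρ c v) c u s (star c s l)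
             (trans (merge-joins ρ c v) (weaken (merge-⊒ ρ c v) vu))))) ⟩
      β * β * treeSum S ρ (star c s (u ∷ l)) + α * α * treeSum S ρ (star v s (u ∷ l)) +
      α * β * suc (length l) * s * treeSum S (merge ρ c v) (star c s (u ∷ l)) ∎
      where
      open ≡-Reasoning
      s = α + β
      A C D : Labelling V → ℕ
      A σ = treeSum S σ (twoStars v α c β l)
      C σ = treeSum S σ (star c s l)
      D σ = treeSum S σ (star v s l)
      B = C (merge ρ c v)
      same : merge ρ c u ≈ merge ρ c v
      same = merge-⊑ (merge-⊒ ρ c v) (trans (merge-joins ρ c v) (weaken (merge-⊒ ρ c v) vu)) ,
             merge-⊑ (merge-⊒ ρ c u) (trans (merge-joins ρ c u) (sym (weaken (merge-⊒ ρ c u) vu)))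
      distribute : ∀ s β a b → s * s * (a + β * b) ≡ s * s * a + s * s * β * b
      distribute = solve-∀
      lemma : ∀ α β n c d b → β * β * c + α * α * d + α * β * n * (α + β) * b + (α + β) * (α + β) * β * b ≡
              β * β * (c + (α + β) * b) + α * α * d + α * β * (1 + n) * (α + β) * b
      lemma = solve-∀
     cases (no vu) (yes cu) = begin
      s * s * treeSum S ρ (twoStars v α c β (u ∷ l))
        ≡⟨ cong (s * s *_) (trans (link₁ S ρ v u α (spoke c β u ∷ twoStars v α c β l) vu)
             (cong₂ (λ a b → a + α * b) (loop₁ S ρ c u β (twoStars v α c β l) cu)
               (loop₁ S (merge ρ v u) c u β (twoStars v α c β l) (weaken (merge-⊒ ρ v u) cu)))) ⟩
      s * s * (A ρ + α * A (merge ρ v u))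
        ≡⟨ cong (λ a → s * s * (A ρ + α * a)) (trans (treeSum-cong S (twoStars v α c β l) same) (twoStars-joined S (merge ρ c v) α β l (merge-joins ρ c v))) ⟩
      s * s * (A ρ + α * B)
        ≡⟨ distribute s α (A ρ) B ⟩
      s * s * A ρ + s * s * α * B
        ≡⟨ cong (_+ s * s * α * B) (twoStars-separate S ρ α β l v∈ c∈ l∈ ne) ⟩
      β * β * C ρ + α * α * D ρ + α * β * length l * s * B + s * s * α * B
        ≡⟨ lemma α β (length l) (C ρ) (D ρ) B ⟩
      β * β * C ρ + α * α * (D ρ + s * B) + α * β * suc (length l) * s * B
        ≡⟨ cong₂ _+_ (cong₂ (λ a b → β * β * a + α * α * b)
             (sym (loop₁ S ρ c u s (star c s l) cu))
             (trans (cong (λ a → D ρ + s * a) (trans (sym (star-recentre S (merge ρ c v) s l (sym (merge-joins ρ c v)))) (sym (treeSum-cong S (star v s l) same))))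
               (sym (link₁ S ρ v u s (star v s l) vu))))
           (cong (α * β * suc (length l) * s *_) (sym (loop₁ S (merge ρ c v) c u s (star c s l)
             (weaken (merge-⊒ ρ c v) cu)))) ⟩
      β * β * treeSum S ρ (star c s (u ∷ l)) + α * α * treeSum S ρ (star v s (u ∷ l)) +
      α * β * suc (length l) * s * treeSum S (merge ρ c v) (star c s (u ∷ l)) ∎
      where
      open ≡-Reasoning
      s = α + β
      A C D : Labelling V → ℕ
      A σ = treeSum S σ (twoStars v α c β l)
      C σ = treeSum S σ (star c s l)
      D σ = treeSum S σ (star v s l)
      B = C (merge ρ c v)
      same : merge ρ v u ≈ merge ρ c v
      same = merge-⊑ (merge-⊒ ρ c v) (trans (sym (merge-joins ρ c v)) (weaken (merge-⊒ ρ c v) cu)) ,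
             merge-⊑ (merge-⊒ ρ v u) (trans (weaken (merge-⊒ ρ v u) cu) (sym (merge-joins ρ v u)))
      distribute : ∀ s β a b → s * s * (a + β * b) ≡ s * s * a + s * s * β * b
      distribute = solve-∀
      lemma : ∀ α β n c d b → β * β * c + α * α * d + α * β * n * (α + β) * b + (α + β) * (α + β) * α * b ≡
              β * β * c + α * α * (d + (α + β) * b) + α * β * (1 + n) * (α + β) * b
      lemma = solve-∀
     -- Such a leaf links the centres by two spokes in series, of conductance `α * β / s`. This is
     -- the origin of the term with `length l`.
     cases (no vu) (no cu) = begin
      s * s * treeSum S ρ (twoStars v α c β (u ∷ l))
        ≡⟨ cong (s * s *_) (trans (link₁ S ρ v u α (spoke c β u ∷ twoStars v α c β l) vu)
             (cong₂ (λ a b → a + α * b) (link₁ S ρ c u β (twoStars v α c β l) cu)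
               (link₁ S ρv c u β (twoStars v α c β l) (merge-≢ v u ne cu cu)))) ⟩
      s * s * (A ρ + β * A ρc + α * (A ρv + β * A (merge ρv c u)))
        ≡⟨ cong (λ a → s * s * (A ρ + β * A ρc + α * (A ρv + β * a)))
             (trans (twoStars-joined S (merge ρv c u) α β l
                       (trans (merge-joins ρv c u) (sym (weaken (merge-⊒ ρv c u) (merge-joins ρ v u)))))
                    (treeSum-cong S (star c s l) all)) ⟩
      s * s * (A ρ + β * A ρc + α * (A ρv + β * B′))
        ≡⟨ distribute s α β (A ρ) (A ρc) (A ρv) B′ ⟩
      s * s * A ρ + β * (s * s * A ρc) + α * (s * s * A ρv) + s * s * α * β * B′
        ≡⟨ cong (_+ s * s * α * β * B′) (cong₂ _+_ (cong₂ (λ a b → a + β * b)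
             (twoStars-separate S ρ α β l v∈ c∈ l∈ ne)
             (trans (twoStars-separate S ρc α β l v∈ c∈ l∈ (≢-sym (merge-≢ c u (≢-sym ne) vu (≢-sym ne))))
               (cong (λ a → β * β * C ρc + α * α * D ρc + α * β * length l * s * a)
                 (treeSum-cong S (star c s l) all-c))))
             (cong (α *_)
             (trans (twoStars-separate S ρv α β l v∈ c∈ l∈ (merge-≢ v u ne cu ne))
               (cong (λ a → β * β * C ρv + α * α * D ρv + α * β * length l * s * a)
                 (treeSum-cong S (star c s l) (merge-cong-all)))))) ⟩
      β * β * C ρ + α * α * D ρ + α * β * length l * s * B +
      β * (β * β * C ρc + α * α * D ρc + α * β * length l * s * B′) +
      α * (β * β * C ρv + α * α * D ρv + α * β * length l * s * B′) + s * s * α * β * B′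
        ≡⟨ cong₂ (λ a b → β * β * C ρ + α * α * D ρ + α * β * length l * s * B +
             β * (β * β * C ρc + α * α * a + α * β * length l * s * B′) +
             α * (β * β * b + α * α * D ρv + α * β * length l * s * B′) + s * s * α * β * B′)
             Dρc Cρv ⟩
      β * β * C ρ + α * α * D ρ + α * β * length l * s * B +
      β * (β * β * C ρc + α * α * (D ρv + B) + α * β * length l * s * B′) +
      α * (β * β * (C ρc + B) + α * α * D ρv + α * β * length l * s * B′) + s * s * α * β * B′
        ≡⟨ lemma α β (length l) (C ρ) (D ρ) (C ρc) (D ρv) B B′ ⟩
      β * β * (C ρ + s * C ρc) + α * α * (D ρ + s * D ρv) + α * β * suc (length l) * s * (B + s * B′)
        ≡⟨ cong₂ _+_ (cong₂ (λ a b → β * β * a + α * α * b)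
             (sym (link₁ S ρ c u s (star c s l) cu)) (sym (link₁ S ρ v u s (star v s l) vu)))
           (cong (α * β * suc (length l) * s *_) (sym (link₁ S (merge ρ c v) c u s (star c s l)
             (≢-sym (merge-≢ c v (≢-sym cu) (≢-sym vu) (≢-sym cu)))))) ⟩
      β * β * treeSum S ρ (star c s (u ∷ l)) + α * α * treeSum S ρ (star v s (u ∷ l)) +
      α * β * suc (length l) * s * treeSum S (merge ρ c v) (star c s (u ∷ l)) ∎
      where
      open ≡-Reasoning
      s = α + β
      A C D : Labelling V → ℕ
      A σ = treeSum S σ (twoStars v α c β l)
      C σ = treeSum S σ (star c s l)
      D σ = treeSum S σ (star v s l)
      ρc = merge ρ c u
      ρv = merge ρ v u
      B = C (merge ρ c v)
      B′ = C (merge (merge ρ c v) c u)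
      all : merge ρv c u ≈ merge (merge ρ c v) c u
      all =
        merge-⊑ (merge-⊑ (⊑-trans (merge-⊒ ρ c v) (merge-⊒ _ c u))
          (trans (sym (weaken (merge-⊒ _ c u) (merge-joins ρ c v))) (merge-joins _ c u))) (merge-joins _ c u) ,
        merge-⊑ (merge-⊑ (⊑-trans (merge-⊒ ρ v u) (merge-⊒ _ c u))
          (trans (merge-joins _ c u) (sym (weaken (merge-⊒ _ c u) (merge-joins ρ v u))))) (merge-joins _ c u)
      all-c : merge ρc c v ≈ merge (merge ρ c v) c u
      all-c = merge-swap ρ c u c v
      merge-cong-all : merge ρv c v ≈ merge (merge ρ c v) c u
      merge-cong-all =
        merge-⊑ (merge-⊑ (⊑-trans (merge-⊒ ρ c v) (merge-⊒ _ c u))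
          (trans (sym (weaken (merge-⊒ _ c u) (merge-joins ρ c v))) (merge-joins _ c u)))
          (weaken (merge-⊒ _ c u) (merge-joins ρ c v)) ,
        merge-⊑ (merge-⊑ (⊑-trans (merge-⊒ ρ v u) (merge-⊒ _ c v)) (merge-joins _ c v))
          (trans (merge-joins _ c v) (weaken (merge-⊒ _ c v) (merge-joins ρ v u)))
      -- The induction hypotheses produce the star around one centre with the leaf contracted into
      -- the other centre. The right-hand side contains no such sum, and `star-three` expresses it
      -- by those that do occur.
      Cρv : C ρv ≡ C ρc + B
      Cρv = begin
        C ρv                            ≡⟨ treeSum-cong S (star c s l) (merge-flip ρ v u) ⟩
        C (merge ρ u v)                 ≡⟨ star-three S s u∈ v∈ c∈ ρ (≢-sym vu) (≢-sym cu) (≢-sym ne) l ⟩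
        C (merge ρ u c) + C (merge ρ v c) ≡⟨ cong₂ _+_ (treeSum-cong S (star c s l) (merge-flip ρ u c)) (treeSum-cong S (star c s l) (merge-flip ρ v c)) ⟩
        C ρc + B                        ∎
      Dρc : D ρc ≡ D ρv + B
      Dρc = begin
        D ρc                            ≡⟨ treeSum-cong S (star v s l) (merge-flip ρ c u) ⟩
        D (merge ρ u c)                 ≡⟨ star-three S s u∈ c∈ v∈ ρ (≢-sym cu) (≢-sym vu) ne l ⟩
        D (merge ρ u v) + D (merge ρ c v) ≡⟨ cong₂ _+_ (treeSum-cong S (star v s l) (merge-flip ρ u v)) (star-recentre S (merge ρ c v) s l (sym (merge-joins ρ c v))) ⟩
        D ρv + B                        ∎
      distribute : ∀ s α β a b c d → s * s * (a + β * b + α * (c + β * d)) ≡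
                   s * s * a + β * (s * s * b) + α * (s * s * c) + s * s * α * β * d
      distribute = solve-∀
      lemma : ∀ α β n c d c′ d′ b b′ →
        β * β * c + α * α * d + α * β * n * (α + β) * b +
        β * (β * β * c′ + α * α * (d′ + b) + α * β * n * (α + β) * b′) +
        α * (β * β * (c′ + b) + α * α * d′ + α * β * n * (α + β) * b′) + (α + β) * (α + β) * α * β * b′ ≡
        β * β * (c + (α + β) * c′) + α * α * (d + (α + β) * d′) + α * β * (1 + n) * (α + β) * (b + (α + β) * b′)
      lemma = solve-∀

  module _ {V : Set} where

    avoids-++ : ∀ {c : V} {es fs} → Avoids c es → Avoids c fs → Avoids c (es ++ fs)
    avoids-++ = All.++⁺

    star-avoids : ∀ {c v : V} w {l} → v ≢ c → c ∉ˡ l → Avoids c (star v w l)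
    star-avoids w {[]}    v≢ c∉ = []
    star-avoids w {u ∷ l} v≢ c∉ = (v≢ , λ eq → c∉ (here (sym eq))) ∷ star-avoids w v≢ (c∉ ∘ there)

    mesh-avoids : ∀ {c : V} {l} → c ∉ˡ l → Avoids c (mesh l)
    mesh-avoids {l = []}    c∉ = []
    mesh-avoids {l = u ∷ l} c∉ =
      avoids-++ (star-avoids 1 (λ eq → c∉ (here (sym eq))) (c∉ ∘ there)) (mesh-avoids (c∉ ∘ there))

    -- Deleting or contracting an edge that avoids `c` acts alike on all sums involved, so the
    -- identity of `twoStars-separate` extends to the edges `cs`. Its term for the star around `v`
    -- vanishes because that star leaves `c` isolated.
    twoStars-fresh : ∀ {S} {v c : V} α β l → v ∈ˡ S → c ∈ˡ S → All (_∈ˡ S) l → v ≢ c → c ∉ˡ l →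
      ∀ ρ cs → Fresh c ρ → Avoids c cs →
      let s = α + β in
      s * s * treeSum S ρ (cs ++ twoStars v α c β l) ≡
      β * β * treeSum S ρ (cs ++ star c s l) +
      α * β * length l * s * treeSum S (merge ρ c v) (cs ++ star c s l)
    twoStars-fresh {S} {v} {c} α β l v∈ c∈ l∈ v≢ c∉ ρ [] fr [] = begin
      s * s * treeSum S ρ (twoStars v α c β l)
        ≡⟨ twoStars-separate S ρ α β l v∈ c∈ l∈ (≢-sym (apart fr v≢)) ⟩
      β * β * a + α * α * treeSum S ρ (star v s l) + b
        ≡⟨ cong (λ d → β * β * a + α * α * d + b)
             (treeSum-isolated c∈ v∈ v≢ ρ (star v s l) fr (star-avoids s v≢ c∉)) ⟩
      β * β * a + α * α * 0 + b
        ≡⟨ lemma (β * β * a) (α * α) b ⟩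
      β * β * a + b ∎
      where
      open ≡-Reasoning
      s = α + β
      a = treeSum S ρ (star c s l)
      b = α * β * length l * s * treeSum S (merge ρ c v) (star c s l)
      lemma : ∀ a d b → a + d * 0 + b ≡ a + b
      lemma = solve-∀
    twoStars-fresh {S} {v} {c} α β l v∈ c∈ l∈ v≢ c∉ ρ (((x , y) , (p , q)) ∷ cs) fr ((x≢ , y≢) ∷ av) =
      cases (ρ x ≟ ρ y)
      where
      open ≡-Reasoning
      s = α + β
      k = α * β * length l * s
      e = ((x , y) , (p , q))
      μ = merge ρ c v
      A C : Labelling V → ℕ
      A σ = treeSum S σ (cs ++ twoStars v α c β l)
      C σ = treeSum S σ (cs ++ star c s l)
      IH : s * s * A ρ ≡ β * β * C ρ + k * C μ
      IH = twoStars-fresh α β l v∈ c∈ l∈ v≢ c∉ ρ cs fr av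
      cases : Dec (ρ x ≡ ρ y) →
        s * s * treeSum S ρ (e ∷ cs ++ twoStars v α c β l) ≡
        β * β * treeSum S ρ (e ∷ cs ++ star c s l) + k * treeSum S μ (e ∷ cs ++ star c s l)
      cases (yes xy) = begin
        s * s * treeSum S ρ (e ∷ cs ++ twoStars v α c β l)
          ≡⟨ cong (s * s *_) (treeSum-loop S ρ x y p q (cs ++ twoStars v α c β l) xy) ⟩
        s * s * (q * A ρ)
          ≡⟨ lemma₁ (s * s) q (A ρ) ⟩
        q * (s * s * A ρ)
          ≡⟨ cong (q *_) IH ⟩
        q * (β * β * C ρ + k * C μ)
          ≡⟨ lemma₂ q (β * β) (C ρ) k (C μ) ⟩
        β * β * (q * C ρ) + k * (q * C μ)
          ≡⟨ cong₂ (λ a b → β * β * a + k * b) (treeSum-loop S ρ x y p q (cs ++ star c s l) xy)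
               (treeSum-loop S μ x y p q (cs ++ star c s l) (weaken (merge-⊒ ρ c v) xy)) ⟨
        β * β * treeSum S ρ (e ∷ cs ++ star c s l) + k * treeSum S μ (e ∷ cs ++ star c s l) ∎
        where
        lemma₁ : ∀ a b c → a * (b * c) ≡ b * (a * c)
        lemma₁ = solve-∀
        lemma₂ : ∀ q b c k d → q * (b * c + k * d) ≡ b * (q * c) + k * (q * d)
        lemma₂ = solve-∀
      cases (no xy) = begin
        s * s * treeSum S ρ (e ∷ cs ++ twoStars v α c β l)
          ≡⟨ cong (s * s *_) (treeSum-link S ρ x y p q (cs ++ twoStars v α c β l) xy) ⟩
        s * s * (q * A ρ + p * A ρ′)
          ≡⟨ lemma₁ (s * s) q (A ρ) p (A ρ′) ⟩
        q * (s * s * A ρ) + p * (s * s * A ρ′)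
          ≡⟨ cong₂ (λ a b → q * a + p * b) IH
               (trans (twoStars-fresh α β l v∈ c∈ l∈ v≢ c∉ ρ′ cs (fresh-merge fr x≢ y≢) av)
                 (cong (λ a → β * β * C ρ′ + k * a) (treeSum-cong S (cs ++ star c s l) (merge-swap ρ x y c v)))) ⟩
        q * (β * β * C ρ + k * C μ) + p * (β * β * C ρ′ + k * C (merge μ x y))
          ≡⟨ lemma₂ q p (β * β) k (C ρ) (C μ) (C ρ′) (C (merge μ x y)) ⟩
        β * β * (q * C ρ + p * C ρ′) + k * (q * C μ + p * C (merge μ x y))
          ≡⟨ cong₂ (λ a b → β * β * a + k * b) (treeSum-link S ρ x y p q (cs ++ star c s l) xy)
               (treeSum-link S μ x y p q (cs ++ star c s l) xy′) ⟨
        β * β * treeSum S ρ (e ∷ cs ++ star c s l) + k * treeSum S μ (e ∷ cs ++ star c s l) ∎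
        where
        ρ′ = merge ρ x y
        xy′ : μ x ≢ μ y
        xy′ eq = xy (merge-avoiding v fr x≢ y≢ (weaken (proj₁ (merge-flip ρ c v)) eq))
        lemma₁ : ∀ s q a p b → s * (q * a + p * b) ≡ q * (s * a) + p * (s * b)
        lemma₁ = solve-∀
        lemma₂ : ∀ q p b k a₁ a₂ a₃ a₄ → q * (b * a₁ + k * a₂) + p * (b * a₃ + k * a₄) ≡
                 b * (q * a₁ + p * a₃) + k * (q * a₂ + p * a₄)
        lemma₂ = solve-∀

    twoStars-↭ : ∀ (v c : V) α β l → star v α l ++ star c β l ↭ twoStars v α c β l
    twoStars-↭ v c α β []      = ↭-refl
    twoStars-↭ v c α β (u ∷ l) = prep _ (↭-trans (Perm.shift _ (star v α l) (star c β l)) (prep _ (twoStars-↭ v c α β l)))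

    -- The factor (length l)² avoids dividing by the total weight of the star; it
    -- is cancelled against the one from the induction hypothesis.
    star-mesh : ∀ {S} {c x : V} → c ∉ˡ S → x ∈ˡ S → ∀ ρ l cs → All (_∈ˡ S) l → Fresh c ρ → Avoids c cs →
      treeSum (c ∷ S) ρ (star c (length l) l ++ cs) ≡ length l * length l * treeSum S ρ (mesh l ++ cs)
    -- Without leaves both sides are zero, the left one because `c` is isolated from `x`.
    star-mesh {S} {c} c∉ x∈ ρ [] cs [] fr av =
      treeSum-isolated (here refl) (there x∈) (λ where refl → c∉ x∈) ρ cs fr av
    -- A single leaf is treated apart because the cancellation below needs `n` to be positive.
    star-mesh {S} {c} c∉ x∈ ρ (v ∷ []) cs (v∈ ∷ []) fr av = begin
      treeSum (c ∷ S) ρ (spoke c 1 v ∷ cs)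
        ≡⟨ link₁ (c ∷ S) ρ c v 1 cs (≢-sym (apart fr v≢)) ⟩
      treeSum (c ∷ S) ρ cs + 1 * treeSum (c ∷ S) (merge ρ c v) cs
        ≡⟨ cong₂ (λ a b → a + 1 * b) (treeSum-isolated (here refl) (there v∈) v≢ ρ cs fr av)
             (trans (treeSum-cong (c ∷ S) cs (merge-flip ρ c v)) (treeSum-eliminate cs c∉ v∈ fr av)) ⟩
      1 * 1 * treeSum S ρ cs ∎
      where
      open ≡-Reasoning
      v≢ : v ≢ c
      v≢ refl = c∉ v∈
    star-mesh {S} {c} c∉ x∈ ρ (v ∷ l@(_ ∷ _)) cs (v∈ ∷ l∈) fr av = *-cancelˡ-≡ _ _ (n * n) (begin
      n * n * T ρ (star c (suc n) (v ∷ l) ++ cs)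
        ≡⟨ cong (n * n *_) (link₁ (c ∷ S) ρ c v (suc n) (star c (suc n) l ++ cs) (≢-sym (apart fr v≢))) ⟩
      n * n * (T ρ (star c (suc n) l ++ cs) + suc n * T (merge ρ c v) (star c (suc n) l ++ cs))
        ≡⟨ lemma₁ n (T ρ (star c (suc n) l ++ cs)) (T (merge ρ c v) (star c (suc n) l ++ cs)) ⟩
      n * n * T ρ (star c (suc n) l ++ cs) + 1 * n * n * suc n * T (merge ρ c v) (star c (suc n) l ++ cs)
        ≡⟨ cong₂ (λ a b → n * n * a + 1 * n * n * suc n * b)
             (treeSum-↭ (Perm.++-comm (star c (suc n) l) cs) ρ) (treeSum-↭ (Perm.++-comm (star c (suc n) l) cs) (merge ρ c v)) ⟩
      n * n * T ρ (cs ++ star c (suc n) l) + 1 * n * n * suc n * T (merge ρ c v) (cs ++ star c (suc n) l)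
        -- The unit spokes of `v` are its mesh edges, and `n` is the weight of the smaller star in
        -- the induction hypothesis; together they make up the weight `suc n` of the given spokes.
        ≡⟨ twoStars-fresh 1 n l (there v∈) (here refl) (All.map there l∈) v≢ c∉l ρ cs fr av ⟨
      suc n * suc n * T ρ (cs ++ twoStars v 1 c n l)
        ≡⟨ cong (suc n * suc n *_) (treeSum-↭ two-stars ρ) ⟩
      suc n * suc n * T ρ (star c n l ++ (star v 1 l ++ cs))
        ≡⟨ cong (suc n * suc n *_) (star-mesh c∉ x∈ ρ l (star v 1 l ++ cs) l∈ fr (avoids-++ (star-avoids 1 v≢ c∉l) av)) ⟩
      suc n * suc n * (n * n * treeSum S ρ (mesh l ++ (star v 1 l ++ cs)))
        ≡⟨ cong (λ a → suc n * suc n * (n * n * a)) (treeSum-↭ (↭-trans (Perm.shifts (mesh l) (star v 1 l)) (↭-sym (Perm.++-assoc (star v 1 l) (mesh l) cs))) ρ) ⟩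
      suc n * suc n * (n * n * treeSum S ρ (mesh (v ∷ l) ++ cs))
        ≡⟨ lemma₂ (suc n * suc n) (n * n) (treeSum S ρ (mesh (v ∷ l) ++ cs)) ⟩
      n * n * (suc n * suc n * treeSum S ρ (mesh (v ∷ l) ++ cs)) ∎)
      where
      open ≡-Reasoning
      n = length l
      T : Labelling V → List (WEdge V) → ℕ
      T = treeSum (c ∷ S)
      v≢ : v ≢ c
      v≢ refl = c∉ v∈
      c∉l : c ∉ˡ l
      c∉l c∈ = c∉ (All.lookup l∈ c∈)
      two-stars : cs ++ twoStars v 1 c n l ↭ star c n l ++ (star v 1 l ++ cs)
      two-stars = ↭-trans (Perm.++-comm cs _) (↭-trans (Perm.++⁺ʳ cs (↭-trans (↭-sym (twoStars-↭ v c 1 n l)) (Perm.++-comm (star v 1 l) (star c n l)))) (Perm.++-assoc (star c n l) (star v 1 l) cs))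
      lemma₁ : ∀ n a b → n * n * (a + suc n * b) ≡ n * n * a + 1 * n * n * suc n * b
      lemma₁ = solve-∀
      lemma₂ : ∀ a b c → a * (b * c) ≡ b * (a * c)
      lemma₂ = solve-∀

  -- Spanning trees as sequences of contractions

  length-filter-map : {A B : Set} {P : B → Set} (P? : Decidable P) (f : A → B) (xs : List A) →
                      length (filter P? (map f xs)) ≡ length (filter (P? ∘ f) xs)
  length-filter-map P? f [] = refl
  length-filter-map P? f (x ∷ xs) with P? (f x)
  ... | yes _ = cong suc (length-filter-map P? f xs)
  ... | no _  = length-filter-map P? f xs

  length-filter-none : {A : Set} {P : A → Set} (P? : Decidable P) → (∀ x → ¬ P x) → ∀ xs → length (filter P? xs) ≡ 0
  length-filter-none P? ¬P [] = refl
  length-filter-none P? ¬P (x ∷ xs) with P? x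
  ... | yes p = contradiction p (¬P x)
  ... | no _  = length-filter-none P? ¬P xs

  module _ {V : Set} (S : List V) where

    -- Being a spanning tree in the manner of Kruskal's algorithm. The recursion is that of
    -- `treeSum`, so the count of such sets needs no graph theory.
    Joining : ∀ {m} → Labelling V → (Fin m → V × V) → Subset m → Set
    Joining ρ ends []            = AllEqual S ρ
    Joining ρ ends (outside ∷ T) = Joining ρ (ends ∘ suc) T
    Joining ρ ends (inside ∷ T)  =
      let (u , v) = ends zero in ρ u ≢ ρ v × Joining (merge ρ u v) (ends ∘ suc) T

    joining? : ∀ {m} ρ (ends : Fin m → V × V) → Decidable (Joining ρ ends)
    joining? ρ ends []            = allEqual? S ρ
    joining? ρ ends (outside ∷ T) = joining? ρ (ends ∘ suc) T
    joining? ρ ends (inside ∷ T)  =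
      let (u , v) = ends zero in ¬? (ρ u ≟ ρ v) ×-dec joining? (merge ρ u v) (ends ∘ suc) T

    count-joining : ∀ m ρ (ends : Fin m → V × V) →
      length (filter (joining? ρ ends) (subsets m)) ≡ treeSum S ρ (tabulate (λ e → ends e , 1 , 1))
    count-joining zero ρ ends with allEqual? S ρ
    ... | yes _ = refl
    ... | no _  = refl
    count-joining (suc m) ρ ends = begin
      length (filter P? (map (inside ∷_) (subsets m) ++ map (outside ∷_) (subsets m)))
        ≡⟨ cong length (filter-++ P? (map (inside ∷_) (subsets m)) _) ⟩
      length (filter P? (map (inside ∷_) (subsets m)) ++ filter P? (map (outside ∷_) (subsets m)))
        ≡⟨ length-++ (filter P? (map (inside ∷_) (subsets m))) ⟩
      length (filter P? (map (inside ∷_) (subsets m))) + length (filter P? (map (outside ∷_) (subsets m)))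
        ≡⟨ cong₂ _+_ (length-filter-map P? (inside ∷_) (subsets m)) (length-filter-map P? (outside ∷_) (subsets m)) ⟩
      length (filter (P? ∘ (inside ∷_)) (subsets m)) + length (filter (joining? ρ (ends ∘ suc)) (subsets m))
        ≡⟨ cong₂ _+_ (first (ρ u ≟ ρ v)) (count-joining m ρ (ends ∘ suc)) ⟩
      unlessLoop (ρ u ≟ ρ v) (1 * treeSum S (merge ρ u v) es) + treeSum S ρ es
        ≡⟨ +-comm (unlessLoop (ρ u ≟ ρ v) (1 * treeSum S (merge ρ u v) es)) _ ⟩
      treeSum S ρ es + unlessLoop (ρ u ≟ ρ v) (1 * treeSum S (merge ρ u v) es)
        ≡⟨ cong (_+ unlessLoop (ρ u ≟ ρ v) (1 * treeSum S (merge ρ u v) es)) (*-identityˡ _) ⟨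
      1 * treeSum S ρ es + unlessLoop (ρ u ≟ ρ v) (1 * treeSum S (merge ρ u v) es) ∎
      where
      open ≡-Reasoning
      P? = joining? ρ ends
      u = proj₁ (ends zero)
      v = proj₂ (ends zero)
      es = tabulate (λ e → ends (suc e) , 1 , 1)
      first : (d : Dec (ρ u ≡ ρ v)) → length (filter (P? ∘ (inside ∷_)) (subsets m)) ≡
              unlessLoop d (1 * treeSum S (merge ρ u v) es)
      first (yes eq) = length-filter-none (P? ∘ (inside ∷_)) (λ _ (ne , _) → ne eq) (subsets m)
      first (no ne) = begin
        length (filter (P? ∘ (inside ∷_)) (subsets m))
          ≡⟨ cong length (filter-≐ (P? ∘ (inside ∷_)) (joining? (merge ρ u v) (ends ∘ suc)) (proj₂ , (ne ,_)) (subsets m)) ⟩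
        length (filter (joining? (merge ρ u v) (ends ∘ suc)) (subsets m))
          ≡⟨ count-joining m (merge ρ u v) (ends ∘ suc) ⟩
        treeSum S (merge ρ u v) es
          ≡⟨ *-identityˡ _ ⟨
        1 * treeSum S (merge ρ u v) es ∎

  -- Connection and cycles in terms of contracted edges

  module _ (G : Graph) where
    open Graph G

    -- Unlike `Walk`, it forgets what it passes, and its edges are taken from a predicate, which is
    -- easily enlarged by the next contracted edge.
    data Conn (A : Edge → Set) : Vertex → Vertex → Set where
      []   : ∀ {u} → Conn A u u
      step : ∀ {u v w} e → A e → Joins e u w → Conn A w v → Conn A u v

    joins-sym : ∀ {e u v} → Joins e u v → Joins e v u
    joins-sym = Sum.swap

    joins-ends : ∀ {e u v a b} → ends e ≡ (u , v) → Joins e a b → (a ≡ u × b ≡ v) ⊎ (a ≡ v × b ≡ u)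
    joins-ends eq (inj₁ eq′) with refl ← trans (sym eq) eq′ = inj₁ (refl , refl)
    joins-ends eq (inj₂ eq′) with refl ← trans (sym eq) eq′ = inj₂ (refl , refl)

    joins-meet : ∀ {e u x w z} → Joins e u x → Joins e w z → u ≡ w ⊎ u ≡ z
    joins-meet (inj₁ eq) j with joins-ends eq j
    ... | inj₁ (refl , _) = inj₁ refl
    ... | inj₂ (_ , refl) = inj₂ refl
    joins-meet (inj₂ eq) j with joins-ends eq j
    ... | inj₁ (_ , refl) = inj₂ refl
    ... | inj₂ (refl , _) = inj₁ refl

    module _ {A : Edge → Set} where

      conn-trans : ∀ {u v w} → Conn A u v → Conn A v w → Conn A u w
      conn-trans []             d = d
      conn-trans (step e a j c) d = step e a j (conn-trans c d)

      conn-sym : ∀ {u v} → Conn A u v → Conn A v u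
      conn-sym []             = []
      conn-sym (step e a j c) = conn-trans (conn-sym c) (step e a (joins-sym j) [])

      conn-mono : ∀ {B : Edge → Set} {u v} → (∀ {e} → A e → B e) → Conn A u v → Conn B u v
      conn-mono f []             = []
      conn-mono f (step e a j c) = step e (f a) j (conn-mono f c)

    module _ {T : Subset size} where

      walk⇒conn : ∀ {A : Edge → Set} {u v vs es} → Walk T u vs es v → All A es → Conn A u v
      walk⇒conn []             []       = []
      walk⇒conn (step e _ j W) (a ∷ as) = step e a j (walk⇒conn W as)

      walk-edges : ∀ {u v vs es} → Walk T u vs es v → All (_∈ T) es
      walk-edges []               = []
      walk-edges (step _ e∈T _ W) = e∈T ∷ walk-edges W

      conn⇒walk : ∀ {u v} → Conn (_∈ T) u v → ∃₂ λ vs es → Walk T u vs es v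
      conn⇒walk []               = _ , _ , []
      conn⇒walk (step e e∈T j c) = let (_ , _ , W) = conn⇒walk c in _ , _ , step e e∈T j W

      -- Since `vs` omits the last vertex, `v ∉ˡ vs` is part of simplicity. It keeps the vertices
      -- distinct when `closing-edge` prepends `v`.
      SimplePath : (Edge → Set) → Vertex → Vertex → Set
      SimplePath A u v = ∃₂ λ vs es → Walk T u vs es v × Unique vs × v ∉ˡ vs × All A es

      cut : ∀ {A : Edge → Set} {u v w vs es} → Walk T w vs es v → Unique vs → v ∉ˡ vs → All A es → u ∈ˡ vs →
            SimplePath A u v
      cut W@(step _ _ _ _) un v∉ as (here refl) = _ , _ , W , un , v∉ , as
      cut (step _ _ _ W) (_ ∷ un) v∉ (_ ∷ as) (there u∈) = cut W un (v∉ ∘ there) as u∈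

      simplePath : ∀ {A : Edge → Set} {u v} → (∀ {e} → A e → e ∈ T) → Conn A u v → SimplePath A u v
      simplePath A⊆T [] = [] , [] , [] , [] , (λ ()) , []
      simplePath {u = u} {v} A⊆T (step e a j c) with simplePath A⊆T c
      ... | vs , es , W , un , v∉ , as with u Fin.≟ v | Any.any? (u Fin.≟_) vs
      ...   | yes refl | _      = [] , [] , [] , [] , (λ ()) , []
      ...   | no _     | yes u∈ = cut W un v∉ as u∈
      ...   | no u≢v   | no u∉  = u ∷ vs , e ∷ es , step e (A⊆T a) j W , ¬Any⇒All¬ vs u∉ ∷ un ,
                                  (λ where (here eq) → u≢v (sym eq) ; (there v∈) → v∉ v∈) , a ∷ as

      walk-start : ∀ {u v vs es} → Walk T u vs es v → u ∈ˡ vs ⊎ u ≡ v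
      walk-start []             = inj₂ refl
      walk-start (step _ _ _ _) = inj₁ (here refl)

      walk-visits : ∀ {u v w x e vs es} → Walk T w vs es v → e ∈ˡ es → Joins e u x → u ∈ˡ vs ⊎ u ≡ v
      walk-visits (step e _ j W) (here refl) j′ with joins-meet j′ j
      ... | inj₁ refl = inj₁ (here refl)
      ... | inj₂ refl = Sum.map₁ there (walk-start W)
      walk-visits (step _ _ _ W) (there e∈) j′ = Sum.map₁ there (walk-visits W e∈ j′)

      -- Using the first edge again would lead back to the start `u`, which does not recur on a
      -- simple path.
      simple⇒unique : ∀ {u v vs es} → Walk T u vs es v → Unique vs → v ∉ˡ vs → Unique es
      simple⇒unique [] un v∉ = []
      simple⇒unique {es = _ ∷ es} (step e _ j W) (u∉ ∷ un) v∉ =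
        ¬Any⇒All¬ es (λ e∈ → [ (λ u∈ → All.lookup u∉ u∈ refl) , (λ where refl → v∉ (here refl)) ]′ (walk-visits W e∈ j)) ∷
        simple⇒unique W un (v∉ ∘ there)

      -- An edge that is a loop when its turn comes closes a cycle with a path of edges contracted
      -- earlier. That `e` is not one of these edges gives the distinct edges demanded by
      -- `HasCycle`.
      closing-edge : ∀ {A : Edge → Set} {e u v} → (∀ {e} → A e → e ∈ T) → e ∈ T → ¬ A e → ends e ≡ (u , v) →
                     Conn A u v → HasCycle T
      closing-edge {e = e} {u} {v} A⊆T e∈T ¬Ae eq c with simplePath A⊆T c
      ... | vs , es , W , un , v∉ , as =
        v , v ∷ vs , e ∷ es , step e e∈T (inj₂ eq) W , (λ ()) , ¬Any⇒All¬ vs v∉ ∷ un ,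
        All.map (λ where a refl → ¬Ae a) as ∷ simple⇒unique W un v∉

      -- A walk without repeated edges through e gives, by leaving out e, walks
      -- that avoid it.
      bypass : ∀ {A : Edge → Set} {e u v vs es} → Walk T u vs es v → Unique es → All (λ f → A f ⊎ f ≡ e) es →
               All A es ⊎ (∃₂ λ a b → Joins e a b × Conn A u a × Conn A b v)
      bypass [] un [] = inj₁ []
      bypass (step f _ j W) (_ ∷ un) (inj₁ a ∷ as) with bypass W un as
      ... | inj₁ as′                   = inj₁ (a ∷ as′)
      ... | inj₂ (_ , _ , j′ , c , c′) = inj₂ (_ , _ , j′ , step f a j c , c′)
      bypass (step e _ j W) (e∉ ∷ _) (inj₂ refl ∷ as) = inj₂ (_ , _ , j , [] , walk⇒conn W (rest e∉ as))
        where
        rest : ∀ {A : Edge → Set} {es} → All (e ≢_) es → All (λ f → A f ⊎ f ≡ e) es → All A es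
        rest []       []              = []
        rest (_ ∷ ns) (inj₁ a ∷ as)   = a ∷ rest ns as
        rest (n ∷ _)  (inj₂ refl ∷ _) = contradiction refl n

    record Describes (ρ : Labelling Vertex) (A : Edge → Set) : Set where
      field
        sound    : ∀ {x y} → ρ x ≡ ρ y → Conn A x y
        complete : ∀ {x y} → Conn A x y → ρ x ≡ ρ y
    open Describes

    describes-merge : ∀ {ρ A e} → Describes ρ A →
      Describes (merge ρ (proj₁ (ends e)) (proj₂ (ends e))) (λ f → A f ⊎ f ≡ e)
    describes-merge {ρ} {A} {e} d .sound = merge-least (Conn A′) conn-sym conn-trans ρ u v
      (conn-mono inj₁ ∘ sound d) (step e (inj₂ refl) (inj₁ refl) [])
      where
      u = proj₁ (ends e)
      v = proj₂ (ends e)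
      A′ = λ f → A f ⊎ f ≡ e
    describes-merge {ρ} {A} {e} d .complete = go
      where
      u = proj₁ (ends e)
      v = proj₂ (ends e)
      go : ∀ {x y} → Conn (λ f → A f ⊎ f ≡ e) x y → merge ρ u v x ≡ merge ρ u v y
      go [] = refl
      go (step f (inj₁ a) j c) = trans (weaken (merge-⊒ ρ u v) (complete d (step f a j []))) (go c)
      go (step f (inj₂ refl) (inj₁ refl) c) = trans (merge-joins ρ u v) (go c)
      go (step f (inj₂ refl) (inj₂ refl) c) = trans (sym (merge-joins ρ u v)) (go c)

    module _ (T : Subset size) where

      -- The edges of T are those already contracted (A) and those still to come.
      record Split {j} (A : Edge → Set) (f : Fin j → Edge) (T′ : Subset j) : Set where
        field
          past    : ∀ {e} → A e → e ∈ T
          future  : ∀ {i} → i ∈ T′ → f i ∈ T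
          cover   : ∀ {e} → e ∈ T → A e ⊎ (∃[ i ] i ∈ T′ × e ≡ f i)
          new     : ∀ i → ¬ A (f i)
          f-inj   : ∀ {i i′} → f i ≡ f i′ → i ≡ i′
      open Split

      split-outside : ∀ {j A} {f : Fin (suc j) → Edge} {T′} → Split A f (outside ∷ T′) → Split A (f ∘ suc) T′
      split-outside s .past   = past s
      split-outside s .future = future s ∘ there
      split-outside s .cover e∈ with cover s e∈
      ... | inj₁ a                    = inj₁ a
      ... | inj₂ (suc i , there i∈ , eq) = inj₂ (i , i∈ , eq)
      split-outside s .new i = new s (suc i)
      split-outside s .f-inj eq with refl ← f-inj s eq = refl

      split-inside : ∀ {j A} {f : Fin (suc j) → Edge} {T′} → Split A f (inside ∷ T′) →
                     Split (λ e → A e ⊎ e ≡ f zero) (f ∘ suc) T′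
      split-inside s .past (inj₁ a)    = past s a
      split-inside s .past (inj₂ refl) = future s here
      split-inside s .future = future s ∘ there
      split-inside s .cover e∈ with cover s e∈
      ... | inj₁ a                       = inj₁ (inj₁ a)
      ... | inj₂ (zero , here , eq)      = inj₁ (inj₂ eq)
      ... | inj₂ (suc i , there i∈ , eq) = inj₂ (i , i∈ , eq)
      split-inside s .new i (inj₁ a)  = new s (suc i) a
      split-inside s .new i (inj₂ eq) with () ← f-inj s eq
      split-inside s .f-inj eq with refl ← f-inj s eq = refl

      cover-[] : ∀ {A f} → Split A f [] → ∀ {e} → e ∈ T → A e
      cover-[] s e∈ with inj₁ a ← cover s e∈ = a

      joining⇒connected : ∀ {j A ρ} {f : Fin j → Edge} T′ → Split A f T′ → Describes ρ A →
        Joining (allFin order) ρ (ends ∘ f) T′ → ∀ u v → Conn (_∈ T) u v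
      joining⇒connected {ρ = ρ} [] s d eq u v =
        conn-mono (past s) (sound d (allEqual⇒ {ρ = ρ} eq (∈-allFin u) (∈-allFin v)))
      joining⇒connected (outside ∷ T′) s d J       = joining⇒connected T′ (split-outside s) d J
      joining⇒connected (inside ∷ T′)  s d (_ , J) = joining⇒connected T′ (split-inside s) (describes-merge d) J

      -- Future edges are excluded from the closed walk starting with the last one. If the walk
      -- contained `f zero` and otherwise only past edges, omitting it would connect its ends by
      -- past edges, although it was not a loop. At the start nothing is past, so the walk is empty
      -- and there is no cycle.
      joining⇒past : ∀ {j A ρ} {f : Fin j → Edge} T′ → Split A f T′ → Describes ρ A →
        Joining (allFin order) ρ (ends ∘ f) T′ →
        ∀ {v vs es} → Walk T v vs es v → Unique es → All A es
      joining⇒past [] s d J W un = All.map (cover-[] s) (walk-edges W)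
      joining⇒past (outside ∷ T′) s d J W un = joining⇒past T′ (split-outside s) d J W un
      joining⇒past {f = f} (inside ∷ T′) s d (ne , J) W un
        with bypass W un (joining⇒past T′ (split-inside s) (describes-merge d) J W un)
      ... | inj₁ as = as
      ... | inj₂ (a , b , j , c , c′) with joins-ends {f zero} refl j
      ...   | inj₁ (refl , refl) = contradiction (complete d (conn-sym (conn-trans c′ c))) ne
      ...   | inj₂ (refl , refl) = contradiction (complete d (conn-trans c′ c)) ne

      tree⇒joining : ∀ {j A ρ} {f : Fin j → Edge} T′ → Split A f T′ → Describes ρ A →
        IsSpanningTree T → Joining (allFin order) ρ (ends ∘ f) T′
      tree⇒joining {ρ = ρ} [] s d ((_ , c) , _) = ⇒allEqual {ρ = ρ} λ {x} {y} _ _ →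
        let (_ , _ , W) = c x y in complete d (walk⇒conn W (All.map (cover-[] s) (walk-edges W)))
      tree⇒joining (outside ∷ T′) s d tree = tree⇒joining T′ (split-outside s) d tree
      tree⇒joining (inside ∷ T′)  s d tree =
        (λ eq → proj₂ tree (closing-edge (past s) (future s here) (new s zero) refl (sound d eq))) ,
        tree⇒joining T′ (split-inside s) (describes-merge d) tree

      split-start : Split (λ _ → ⊥) id T
      split-start = record
        { past = λ () ; future = id ; cover = λ e∈ → inj₂ (_ , e∈ , refl) ; new = λ _ () ; f-inj = id }

      describes-start : Describes toℕ (λ _ → ⊥)
      describes-start .sound eq with refl ← toℕ-injective eq = []
      describes-start .complete [] = refl

    weighted : (Edge → ℕ × ℕ) → List (WEdge Vertex)
    weighted w = map (λ e → ends e , w e) (allFin size)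

    -- In the graph without vertices the empty edge set passes the test `Joining`, but it is no
    -- spanning tree, as that graph does not count as connected.
    t≡treeSum : NonZero order → t G ≡ treeSum (allFin order) toℕ (weighted (λ _ → 1 , 1))
    t≡treeSum nz = begin
      length (filter (isSpanningTree? G) (subsets size))
        ≡⟨ cong length (filter-≐ (isSpanningTree? G) (joining? (allFin order) toℕ ends) ((λ {T} → to T) , (λ {T} → from T)) (subsets size)) ⟩
      length (filter (joining? (allFin order) toℕ ends) (subsets size))
        ≡⟨ count-joining (allFin order) size toℕ ends ⟩
      treeSum (allFin order) toℕ (tabulate (λ e → ends e , 1 , 1))
        ≡⟨ cong (treeSum (allFin order) toℕ) (map-tabulate id (λ e → ends e , 1 , 1)) ⟨
      treeSum (allFin order) toℕ (weighted (λ _ → 1 , 1)) ∎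
      where
      open ≡-Reasoning
      to : ∀ T → IsSpanningTree T → Joining (allFin order) toℕ ends T
      to T = tree⇒joining T T (split-start T) (describes-start T)
      from : ∀ T → Joining (allFin order) toℕ ends T → IsSpanningTree T
      from T J = (nz , λ u v → conn⇒walk (joining⇒connected T T (split-start T) (describes-start T) J u v)) ,
        λ (_ , _ , es , W , ne , _ , un) → empty ne (joining⇒past T T (split-start T) (describes-start T) J W un)
        where
        empty : ∀ {es : List Edge} → es ≢ [] → ¬ All (λ _ → ⊥) es
        empty ne [] = ne refl

  -- Line graphs

  unique⇒↭ : {A : Set} {xs ys : List A} → Unique xs → Unique ys →
             (∀ {z} → z ∈ˡ xs → z ∈ˡ ys) → (∀ {z} → z ∈ˡ ys → z ∈ˡ xs) → xs ↭ ys
  unique⇒↭ u u′ f g = ∼bag⇒↭ (unique∧set⇒bag u u′ (mk⇔ f g))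

  concatMap-unique : {A B : Set} (f : A → List B) {xs : List A} → Unique xs → (∀ x → Unique (f x)) →
                     (∀ {x y z} → z ∈ˡ f x → z ∈ˡ f y → x ≡ y) → Unique (concatMap f xs)
  concatMap-unique f u uf inj = Unique.concat⁺ (All.map⁺ (All.universal uf _))
    (AllPairs.map⁺ (AllPairs.map (λ ne {_} (z∈ , z∈′) → ne (inj z∈ z∈′)) u))

  ∈-concatMap : {A B : Set} (f : A → List B) {xs : List A} {x : A} {y : B} → x ∈ˡ xs → y ∈ˡ f x → y ∈ˡ concatMap f xs
  ∈-concatMap f x∈ y∈ = ∈-concatMap⁺ f (lose x∈ y∈)

  ∈-concatMap-find : {A B : Set} (f : A → List B) (xs : List A) {y : B} → y ∈ˡ concatMap f xs → ∃[ x ] x ∈ˡ xs × y ∈ˡ f x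
  ∈-concatMap-find f xs y∈ = find (∈-concatMap⁻ f y∈)

  mapEnds : {V W : Set} → (V → W) → WEdge V → WEdge W
  mapEnds f ((u , v) , a) = (f u , f v) , a

  treeSum-embed : {V W : Set} (f : V → W) (ρ : Labelling V) (σ : Labelling W) →
                  (∀ {x y} → ρ x ≡ ρ y → σ (f x) ≡ σ (f y)) → (∀ {x y} → σ (f x) ≡ σ (f y) → ρ x ≡ ρ y) →
                  ∀ S es → treeSum S ρ es ≡ treeSum (map f S) σ (map (mapEnds f) es)
  treeSum-embed {V} {W} f ρ σ to from S es = treeSum-related R {S} {map f S} forth back compat (pointwise es)
    where
    R : V → W → Set
    R x x′ = x′ ≡ f x
    forth : ∀ {x} → x ∈ˡ S → ∃[ x′ ] x′ ∈ˡ map f S × R x x′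
    forth x∈ = _ , ∈-map⁺ f x∈ , refl
    back : ∀ {x′} → x′ ∈ˡ map f S → ∃[ x ] x ∈ˡ S × R x x′
    back = ∈-map⁻ f
    compat : ∀ {x x′ y y′} → R x x′ → R y y′ → (ρ x ≡ ρ y → σ x′ ≡ σ y′) × (σ x′ ≡ σ y′ → ρ x ≡ ρ y)
    compat refl refl = to , from
    pointwise : ∀ es → Pointwise (WEdgeRel R {S} {map f S} forth back) es (map (mapEnds f) es)
    pointwise []       = []
    pointwise (_ ∷ es) = (refl , refl , refl) ∷ pointwise es

  pairs : {A : Set} → List A → List (A × A)
  pairs []      = []
  pairs (x ∷ l) = map (x ,_) l ++ pairs l

  module _ {A B : Set} (f : A → B) where

    mesh-map : ∀ l → mesh (map f l) ≡ map (λ (x , y) → (f x , f y) , (1 , 1)) (pairs l)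
    mesh-map []      = refl
    mesh-map (x ∷ l) = begin
      star (f x) 1 (map f l) ++ mesh (map f l)     ≡⟨ cong₂ _++_ (trans (sym (map-∘ l)) (map-∘ l)) (mesh-map l) ⟩
      map g (map (x ,_) l) ++ map g (pairs l)      ≡⟨ map-++ g (map (x ,_) l) (pairs l) ⟨
      map g (pairs (x ∷ l))                        ∎
      where
      open ≡-Reasoning
      g : A × A → WEdge B
      g (x , y) = (f x , f y) , (1 , 1)

  module _ {n : ℕ} where

    -- Pairs drawn from an increasing list satisfy the condition `e < e′` of `Meet`.
    Sorted : List (Fin n) → Set
    Sorted = AllPairs Fin._<_

    ∈-pairs⁻ : ∀ {l e e′} → Sorted l → (e , e′) ∈ˡ pairs l → e Fin.< e′ × e ∈ˡ l × e′ ∈ˡ l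
    ∈-pairs⁻ {x ∷ l} (lt ∷ s) p∈ with ∈-++⁻ (map (x ,_) l) p∈
    ... | inj₁ q with _ , e′∈ , refl ← ∈-map⁻ (x ,_) q = All.lookup lt e′∈ , here refl , there e′∈
    ... | inj₂ q = let (e<e′ , e∈ , e′∈) = ∈-pairs⁻ s q in e<e′ , there e∈ , there e′∈

    ∈-pairs⁺ : ∀ {l e e′} → Sorted l → e Fin.< e′ → e ∈ˡ l → e′ ∈ˡ l → (e , e′) ∈ˡ pairs l
    ∈-pairs⁺ s lt (here refl) (here refl) = contradiction lt (Fin.<-irrefl refl)
    ∈-pairs⁺ s lt (here refl) (there e′∈) = ∈-++⁺ˡ (∈-map⁺ _ e′∈)
    ∈-pairs⁺ (lt′ ∷ _) lt (there e∈) (here refl) = contradiction (All.lookup lt′ e∈) (Fin.<-asym lt)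
    ∈-pairs⁺ {x ∷ l} (_ ∷ s) lt (there e∈) (there e′∈) = ∈-++⁺ʳ (map (x ,_) l) (∈-pairs⁺ s lt e∈ e′∈)

    pairs-unique : ∀ {l} → Sorted l → Unique (pairs l)
    pairs-unique {[]} [] = []
    pairs-unique {x ∷ l} (lt ∷ s) =
      Unique.++⁺ (Unique.map⁺ (cong proj₂) (AllPairs.map Fin.<⇒≢ s)) (pairs-unique s) disjoint
      where
      disjoint : ∀ {z} → ¬ (z ∈ˡ map (x ,_) l × z ∈ˡ pairs l)
      disjoint (p , q) with _ , _ , refl ← ∈-map⁻ (x ,_) p =
        Fin.<-irrefl refl (All.lookup lt (proj₁ (proj₂ (∈-pairs⁻ s q))))

  -- Incidences, and the line graph as a union of cliques

  module _ (G : Graph) where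
    open Graph G

    inc : Vertex → List Edge
    inc v = filter (isEnd? v) (allFin size)

    ∈-inc⁺ : ∀ {v e} → IsEnd v e → e ∈ˡ inc v
    ∈-inc⁺ {v} {e} = ∈-filter⁺ (isEnd? v) (∈-allFin e)

    ∈-inc⁻ : ∀ {v e} → e ∈ˡ inc v → IsEnd v e
    ∈-inc⁻ {v} e∈ = proj₂ (∈-filter⁻ (isEnd? v) {xs = allFin size} e∈)

    inc-sorted : ∀ v → Sorted (inc v)
    inc-sorted v = AllPairs.filter⁺ (isEnd? v) (AllPairs.tabulate⁺-< id)

    inc-unique : ∀ v → Unique (inc v)
    inc-unique v = Unique.filter⁺ (isEnd? v) (Unique.allFin⁺ size)

    incidences incidences′ : List (Vertex × Edge)
    incidences  = concatMap (λ v → map (v ,_) (inc v)) (allFin order)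
    incidences′ = concatMap (λ e → (proj₁ (ends e) , e) ∷ (proj₂ (ends e) , e) ∷ []) (allFin size)

    -- Double counting in the form of lists. It regroups the stars around vertices into halves of
    -- edges (`stars-↭-halves`) and products over vertices into products over edges
    -- (`double-count`).
    incidences-↭ : incidences ↭ incidences′
    incidences-↭ = unique⇒↭
      (concatMap-unique _ (Unique.allFin⁺ order) (λ v → Unique.map⁺ (cong proj₂) (inc-unique v)) same₁)
      (concatMap-unique _ (Unique.allFin⁺ size) (λ e → ((loopless e ∘ cong proj₁) ∷ []) ∷ [] ∷ []) same₂)
      to from
      where
      same₁ : ∀ {x y z} → z ∈ˡ map (x ,_) (inc x) → z ∈ˡ map (y ,_) (inc y) → x ≡ y
      same₁ p q with _ , _ , refl ← ∈-map⁻ _ p | _ , _ , refl ← ∈-map⁻ _ q = refl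
      from-vertex : Vertex → List (Vertex × Edge)
      from-vertex v = map (v ,_) (inc v)
      at : Edge → List (Vertex × Edge)
      at e = (proj₁ (ends e) , e) ∷ (proj₂ (ends e) , e) ∷ []
      edge : ∀ {e z} → z ∈ˡ at e → proj₂ z ≡ e
      edge (here refl)         = refl
      edge (there (here refl)) = refl
      same₂ : ∀ {x y z} → z ∈ˡ at x → z ∈ˡ at y → x ≡ y
      same₂ p q = trans (sym (edge p)) (edge q)
      to : ∀ {z} → z ∈ˡ incidences → z ∈ˡ incidences′
      to z∈ with v , _ , q ← ∈-concatMap-find from-vertex (allFin order) z∈ with e , e∈ , refl ← ∈-map⁻ (v ,_) q with ∈-inc⁻ {v} e∈
      ... | inj₁ refl = ∈-concatMap at (∈-allFin e) (here refl)
      ... | inj₂ refl = ∈-concatMap at (∈-allFin e) (there (here refl))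
      from : ∀ {z} → z ∈ˡ incidences′ → z ∈ˡ incidences
      from z∈ with ∈-concatMap-find at (allFin size) z∈
      ... | e , _ , here refl         = ∈-concatMap from-vertex (∈-allFin _) (∈-map⁺ (_ ,_) (∈-inc⁺ (inj₁ refl)))
      ... | e , _ , there (here refl) = ∈-concatMap from-vertex (∈-allFin _) (∈-map⁺ (_ ,_) (∈-inc⁺ (inj₂ refl)))

    -- Every edge of the line graph stems from exactly one vertex; two parallel edges of `G` meet
    -- once in the clique of each of their ends.
    lineEdges-↭ : lineEdges G ↭ concatMap (λ v → map (λ (e , e′) → e , e′ , v) (pairs (inc v))) (allFin order)
    lineEdges-↭ = unique⇒↭
      (Unique.filter⁺ (meet? G) (Unique.cartesianProduct⁺ (Unique.allFin⁺ size) (Unique.cartesianProduct⁺ (Unique.allFin⁺ size) (Unique.allFin⁺ order))))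
      (concatMap-unique _ (Unique.allFin⁺ order)
        (λ v → Unique.map⁺ (λ where refl → refl) (pairs-unique (inc-sorted v))) same)
      to from
      where
      at : Vertex → List (Triple G)
      at v = map (λ (e , e′) → e , e′ , v) (pairs (inc v))
      same : ∀ {x y z} → z ∈ˡ at x → z ∈ˡ at y → x ≡ y
      same p q with _ , _ , refl ← ∈-map⁻ _ p | _ , _ , refl ← ∈-map⁻ _ q = refl
      to : ∀ {z} → z ∈ˡ lineEdges G → z ∈ˡ concatMap at (allFin order)
      to {e , e′ , v} z∈ with lt , p , q ← proj₂ (∈-filter⁻ (meet? G) {xs = triples G} z∈) =
        ∈-concatMap at (∈-allFin v) (∈-map⁺ _ (∈-pairs⁺ (inc-sorted v) lt (∈-inc⁺ p) (∈-inc⁺ q)))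
      from : ∀ {z} → z ∈ˡ concatMap at (allFin order) → z ∈ˡ lineEdges G
      from z∈ with v , _ , p ← ∈-concatMap-find at (allFin order) z∈ with (e , e′) , q , refl ← ∈-map⁻ _ p
        with lt , e∈ , e′∈ ← ∈-pairs⁻ (inc-sorted v) q =
        ∈-filter⁺ (meet? G) (∈-cartesianProduct⁺ (∈-allFin e) (∈-cartesianProduct⁺ (∈-allFin e′) (∈-allFin v)))
          (lt , ∈-inc⁻ e∈ , ∈-inc⁻ e′∈)

    -- The vertices of the graph in which every clique of the line graph that
    -- stems from a vertex of G is replaced with a star around that vertex.
    U : Set
    U = Edge ⊎ Vertex

    label : Labelling U
    label = [ toℕ , (λ v → size + toℕ v) ]′

    label-injective : ∀ {x y} → label x ≡ label y → x ≡ y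
    label-injective {inj₁ _} {inj₁ _} eq = cong inj₁ (toℕ-injective eq)
    label-injective {inj₂ _} {inj₂ _} eq = cong inj₂ (toℕ-injective (+-cancelˡ-≡ size _ _ eq))
    label-injective {inj₁ e} {inj₂ v} eq = contradiction (subst (size ≤_) (sym eq) (m≤m+n size (toℕ v))) (<⇒≱ (toℕ<n e))
    label-injective {inj₂ v} {inj₁ e} eq = contradiction (subst (size ≤_) eq (m≤m+n size (toℕ v))) (<⇒≱ (toℕ<n e))

    label-fresh : ∀ c → Fresh c label
    label-fresh c .apart ne = ne ∘ label-injective

    meshAt starAt : Vertex → List (WEdge U)
    meshAt v = mesh (map inj₁ (inc v))
    starAt v = star (inj₂ v) (degree v) (map inj₁ (inc v))

    edgesᵁ verticesᵁ : List U
    edgesᵁ    = map inj₁ (allFin size)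
    verticesᵁ = map inj₂ (allFin order)

    line-treeSum : NonZero size → t (L G) ≡ treeSum edgesᵁ label (concatMap meshAt (allFin order))
    line-treeSum nz = begin
      t (L G)
        ≡⟨ t≡treeSum (L G) nz ⟩
      treeSum (allFin size) toℕ (map (λ i → triple⇒edge (lookup (lineEdges G) i)) (allFin (length (lineEdges G))))
        ≡⟨ cong (treeSum (allFin size) toℕ) lookups ⟩
      treeSum (allFin size) toℕ (map triple⇒edge (lineEdges G))
        ≡⟨ treeSum-↭ (Perm.map⁺ triple⇒edge lineEdges-↭) toℕ ⟩
      treeSum (allFin size) toℕ (map triple⇒edge (concatMap at (allFin order)))
        ≡⟨ treeSum-embed inj₁ toℕ label id id (allFin size) (map triple⇒edge (concatMap at (allFin order))) ⟩
      treeSum edgesᵁ label (map (mapEnds inj₁) (map triple⇒edge (concatMap at (allFin order))))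
        ≡⟨ cong (treeSum edgesᵁ label) meshes ⟩
      treeSum edgesᵁ label (concatMap meshAt (allFin order)) ∎
      where
      open ≡-Reasoning
      triple⇒edge : Triple G → WEdge Edge
      triple⇒edge (e , e′ , _) = (e , e′) , (1 , 1)
      at : Vertex → List (Triple G)
      at v = map (λ (e , e′) → e , e′ , v) (pairs (inc v))
      lookups : map (λ i → triple⇒edge (lookup (lineEdges G) i)) (allFin (length (lineEdges G))) ≡ map triple⇒edge (lineEdges G)
      lookups = begin
        map (λ i → triple⇒edge (lookup (lineEdges G) i)) (allFin _) ≡⟨ map-∘ (allFin _) ⟩
        map triple⇒edge (map (lookup (lineEdges G)) (allFin _))      ≡⟨ cong (map triple⇒edge) (map-tabulate id (lookup (lineEdges G))) ⟩
        map triple⇒edge (tabulate (lookup (lineEdges G)))           ≡⟨ cong (map triple⇒edge) (tabulate-lookup (lineEdges G)) ⟩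
        map triple⇒edge (lineEdges G)                               ∎
      meshes : map (mapEnds inj₁) (map triple⇒edge (concatMap at (allFin order))) ≡ concatMap meshAt (allFin order)
      meshes = begin
        map (mapEnds inj₁) (map triple⇒edge (concatMap at (allFin order)))  ≡⟨ map-∘ (concatMap at (allFin order)) ⟨
        map (mapEnds inj₁ ∘ triple⇒edge) (concatMap at (allFin order))      ≡⟨ map-concatMap (mapEnds inj₁ ∘ triple⇒edge) at (allFin order) ⟩
        concatMap (map (mapEnds inj₁ ∘ triple⇒edge) ∘ at) (allFin order)
          ≡⟨ concatMap-cong (λ v → trans (sym (map-∘ (pairs (inc v)))) (sym (mesh-map inj₁ (inc v)))) (allFin order) ⟩
        concatMap meshAt (allFin order)                                     ∎

    squares : List Vertex → ℕ
    squares vs = product (map (λ v → degree v * degree v) vs)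

    star-avoids-vertex : ∀ {v} vs → v ∉ˡ vs → Avoids (inj₂ v) (concatMap starAt vs)
    star-avoids-vertex [] v∉ = []
    star-avoids-vertex {v} (w ∷ vs) v∉ = avoids-++
      (star-avoids (degree w) (λ eq → v∉ (here (sym (inj₂-injective eq)))) (λ v∈ → case-map (∈-map⁻ inj₁ v∈)))
      (star-avoids-vertex vs (v∉ ∘ there))
      where
      case-map : ¬ (∃[ e ] e ∈ˡ inc w × inj₂ v ≡ inj₁ e)
      case-map (_ , _ , ())

    mesh-avoids-vertex : ∀ v w → Avoids (inj₂ v) (meshAt w)
    mesh-avoids-vertex v w = mesh-avoids λ v∈ → case-map (∈-map⁻ inj₁ v∈)
      where
      case-map : ¬ (∃[ e ] e ∈ˡ inc w × inj₂ v ≡ inj₁ e)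
      case-map (_ , _ , ())

    -- `star-mesh` applies at each vertex because no other mesh or star touches its centre; `cs`
    -- holds the meshes whose turn is still to come. The edge `e₀` supplies the vertex besides the
    -- centre that `star-mesh` requires.
    meshes-to-stars : Edge → ∀ vs → Unique vs → ∀ cs → (∀ {v} → v ∈ˡ vs → Avoids (inj₂ v) cs) →
      squares vs * treeSum edgesᵁ label (concatMap meshAt vs ++ cs) ≡
      treeSum (map inj₂ vs ++ edgesᵁ) label (concatMap starAt vs ++ cs)
    meshes-to-stars e₀ [] un cs av = *-identityˡ _
    meshes-to-stars e₀ (v ∷ vs) (v∉ ∷ un) cs av = begin
      squares (v ∷ vs) * treeSum edgesᵁ label ((meshAt v ++ concatMap meshAt vs) ++ cs)
        ≡⟨ *-assoc (d * d) (squares vs) _ ⟩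
      d * d * (squares vs * treeSum edgesᵁ label ((meshAt v ++ concatMap meshAt vs) ++ cs))
        ≡⟨ cong (λ a → d * d * (squares vs * a)) (treeSum-↭ (move (meshAt v) (concatMap meshAt vs)) label) ⟩
      d * d * (squares vs * treeSum edgesᵁ label (concatMap meshAt vs ++ (meshAt v ++ cs)))
        ≡⟨ cong (d * d *_) (meshes-to-stars e₀ vs un (meshAt v ++ cs) (λ {w} w∈ → avoids-++ (mesh-avoids-vertex w v) (av (there w∈)))) ⟩
      d * d * treeSum X label (concatMap starAt vs ++ (meshAt v ++ cs))
        ≡⟨ cong (d * d *_) (treeSum-↭ (Perm.shifts (concatMap starAt vs) (meshAt v)) label) ⟩
      d * d * treeSum X label (meshAt v ++ (concatMap starAt vs ++ cs))
        ≡⟨ cong (λ n → n * n * treeSum X label (meshAt v ++ (concatMap starAt vs ++ cs))) (sym len) ⟩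
      length l * length l * treeSum X label (meshAt v ++ (concatMap starAt vs ++ cs))
        ≡⟨ star-mesh c∉ (∈-++⁺ʳ (map inj₂ vs) (∈-map⁺ inj₁ (∈-allFin e₀))) label l (concatMap starAt vs ++ cs)
             (All.tabulate l⊆) (label-fresh _) (avoids-++ (star-avoids-vertex vs v∉′) (av (here refl))) ⟨
      treeSum (inj₂ v ∷ X) label (star (inj₂ v) (length l) l ++ (concatMap starAt vs ++ cs))
        ≡⟨ cong (λ n → treeSum (inj₂ v ∷ X) label (star (inj₂ v) n l ++ (concatMap starAt vs ++ cs))) len ⟩
      treeSum (inj₂ v ∷ X) label (starAt v ++ (concatMap starAt vs ++ cs))
        ≡⟨ cong (treeSum (inj₂ v ∷ X) label) (++-assoc (starAt v) (concatMap starAt vs) cs) ⟨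
      treeSum (inj₂ v ∷ X) label ((starAt v ++ concatMap starAt vs) ++ cs) ∎
      where
      open ≡-Reasoning
      d = degree v
      l = map inj₁ (inc v)
      X = map inj₂ vs ++ edgesᵁ
      len : length l ≡ d
      len = length-map inj₁ (inc v)
      v∉′ : v ∉ˡ vs
      v∉′ v∈ = All.lookup v∉ v∈ refl
      c∉ : inj₂ v ∉ˡ X
      c∉ c∈ with ∈-++⁻ (map inj₂ vs) c∈
      ... | inj₁ p with _ , v∈ , refl ← ∈-map⁻ inj₂ p = v∉′ v∈
      ... | inj₂ p with _ , _ , () ← ∈-map⁻ inj₁ p
      l⊆ : ∀ {x} → x ∈ˡ l → x ∈ˡ X
      l⊆ x∈ with e , _ , refl ← ∈-map⁻ inj₁ x∈ = ∈-++⁺ʳ (map inj₂ vs) (∈-map⁺ inj₁ (∈-allFin e))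
      move : ∀ (xs ys : List (WEdge U)) → (xs ++ ys) ++ cs ↭ ys ++ (xs ++ cs)
      move xs ys = ↭-trans (Perm.++-assoc xs ys cs) (Perm.shifts xs ys)

    halves : Edge → List (WEdge U)
    halves e = let (u , v) = ends e in
      ((inj₂ u , inj₁ e) , (degree u , 1)) ∷ ((inj₂ v , inj₁ e) , (degree v , 1)) ∷ []

    stars-↭-halves : concatMap starAt (allFin order) ↭ concatMap halves (allFin size)
    stars-↭-halves = ↭-trans (↭-reflexive (sym stars)) (↭-trans (Perm.map⁺ half incidences-↭)
      (↭-reflexive (map-concatMap half _ (allFin size))))
      where
      half : Vertex × Edge → WEdge U
      half (v , e) = (inj₂ v , inj₁ e) , (degree v , 1)
      open ≡-Reasoning
      stars : map half incidences ≡ concatMap starAt (allFin order)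
      stars = begin
        map half incidences ≡⟨ map-concatMap half _ (allFin order) ⟩
        concatMap (λ v → map half (map (v ,_) (inc v))) (allFin order)
          ≡⟨ concatMap-cong (λ v → trans (sym (map-∘ (inc v))) (map-∘ (inc v))) (allFin order) ⟩
        concatMap starAt (allFin order) ∎

    ω : Edge → ℕ × ℕ
    ω e = let (u , v) = ends e in degree u * degree v , degree u + degree v

    whole : Edge → WEdge U
    whole e = mapEnds inj₂ (ends e , ω e)

    halves-avoid : ∀ {e} es → e ∉ˡ es → Avoids (inj₁ e) (concatMap halves es)
    halves-avoid [] e∉ = []
    halves-avoid (f ∷ es) e∉ = ((λ ()) , ne) ∷ ((λ ()) , ne) ∷ halves-avoid es (e∉ ∘ there)
      where
      ne : inj₁ f ≢ inj₁ _
      ne refl = e∉ (here refl)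

    halves-to-wholes : ∀ es → Unique es → ∀ cs → (∀ {e} → e ∈ˡ es → Avoids (inj₁ e) cs) →
      treeSum (map inj₁ es ++ verticesᵁ) label (concatMap halves es ++ cs) ≡
      treeSum verticesᵁ label (map whole es ++ cs)
    halves-to-wholes [] un cs av = refl
    halves-to-wholes (e ∷ es) (e∉ ∷ un) cs av = begin
      treeSum (inj₁ e ∷ X) label (uc ∷ vc ∷ rest)
        ≡⟨ treeSum-∷ (inj₁ e ∷ X) (vc ∷ rest) (cv ∷ rest) uc (λ ρ → treeSum-flip (inj₁ e ∷ X) ρ (inj₂ v) (inj₁ e) (degree v , 1) rest) label ⟩
      treeSum (inj₁ e ∷ X) label (uc ∷ cv ∷ rest)
        ≡⟨ treeSum-series (degree u) 1 (degree v) 1 rest c∉ (vertex u) (vertex v) (label-fresh _)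
             (avoids-++ (halves-avoid es e∉′) (av (here refl))) ⟩
      treeSum X label (((inj₂ u , inj₂ v) , (degree u * degree v , degree u * 1 + degree v * 1)) ∷ rest)
        ≡⟨ cong₂ (λ a b → treeSum X label (((inj₂ u , inj₂ v) , (degree u * degree v , a + b)) ∷ rest)) (*-identityʳ (degree u)) (*-identityʳ (degree v)) ⟩
      treeSum X label (whole e ∷ concatMap halves es ++ cs)
        ≡⟨ treeSum-↭ (Perm.shift (whole e) (concatMap halves es) cs) label ⟨
      treeSum X label (concatMap halves es ++ (whole e ∷ cs))
        ≡⟨ halves-to-wholes es un (whole e ∷ cs) (λ f∈ → ((λ ()) , λ ()) ∷ av (there f∈)) ⟩
      treeSum verticesᵁ label (map whole es ++ (whole e ∷ cs))
        ≡⟨ treeSum-↭ (Perm.shift (whole e) (map whole es) cs) label ⟩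
      treeSum verticesᵁ label (whole e ∷ map whole es ++ cs) ∎
      where
      open ≡-Reasoning
      u = proj₁ (ends e)
      v = proj₂ (ends e)
      uc vc cv : WEdge U
      uc = (inj₂ u , inj₁ e) , (degree u , 1)
      vc = (inj₂ v , inj₁ e) , (degree v , 1)
      cv = (inj₁ e , inj₂ v) , (degree v , 1)
      rest = concatMap halves es ++ cs
      X = map inj₁ es ++ verticesᵁ
      e∉′ : e ∉ˡ es
      e∉′ e∈ = All.lookup e∉ e∈ refl
      vertex : ∀ w → inj₂ w ∈ˡ X
      vertex w = ∈-++⁺ʳ (map inj₁ es) (∈-map⁺ inj₂ (∈-allFin w))
      c∉ : inj₁ e ∉ˡ X
      c∉ c∈ with ∈-++⁻ (map inj₁ es) c∈
      ... | inj₁ p with _ , e∈ , refl ← ∈-map⁻ inj₁ p = e∉′ e∈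
      ... | inj₂ p with _ , _ , () ← ∈-map⁻ inj₂ p

    t-line : NonZero size →
      squares (allFin order) * t (L G) ≡ treeSum (allFin order) toℕ (weighted G ω)
    t-line nz = begin
      squares (allFin order) * t (L G)
        ≡⟨ cong (squares (allFin order) *_) (line-treeSum nz) ⟩
      squares (allFin order) * treeSum edgesᵁ label (concatMap meshAt (allFin order))
        ≡⟨ cong (λ es → squares (allFin order) * treeSum edgesᵁ label es) (++-identityʳ (concatMap meshAt (allFin order))) ⟨
      squares (allFin order) * treeSum edgesᵁ label (concatMap meshAt (allFin order) ++ [])
        ≡⟨ meshes-to-stars (edge nz) (allFin order) (Unique.allFin⁺ order) [] (λ _ → []) ⟩
      treeSum (verticesᵁ ++ edgesᵁ) label (concatMap starAt (allFin order) ++ [])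
        ≡⟨ treeSum-↭ (Perm.++⁺ʳ [] stars-↭-halves) label ⟩
      treeSum (verticesᵁ ++ edgesᵁ) label (concatMap halves (allFin size) ++ [])
        -- The middle vertices of the subdivided edges are eliminated next and have to head the
        -- vertex list.
        ≡⟨ treeSum-sameSet (concatMap halves (allFin size) ++ []) (swapped verticesᵁ edgesᵁ , swapped edgesᵁ verticesᵁ) ≈-refl ⟩
      treeSum (edgesᵁ ++ verticesᵁ) label (concatMap halves (allFin size) ++ [])
        ≡⟨ halves-to-wholes (allFin size) (Unique.allFin⁺ size) [] (λ _ → []) ⟩
      treeSum verticesᵁ label (map whole (allFin size) ++ [])
        ≡⟨ cong (treeSum verticesᵁ label) (trans (++-identityʳ _) (map-∘ (allFin size))) ⟩
      treeSum verticesᵁ label (map (mapEnds inj₂) (weighted G ω))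
        ≡⟨ treeSum-embed inj₂ toℕ label (cong (size +_)) (+-cancelˡ-≡ size _ _) (allFin order) (weighted G ω) ⟨
      treeSum (allFin order) toℕ (weighted G ω) ∎
      where
      open ≡-Reasoning
      edge : ∀ {n} → NonZero n → Fin n
      edge {suc n} _ = zero
      swapped : ∀ (xs ys : List U) {x} → x ∈ˡ xs ++ ys → x ∈ˡ ys ++ xs
      swapped xs ys = Perm.∈-resp-↭ (Perm.++-comm xs ys)

  -- Subdivisions

  module _ {V : Set} (δ : V → ℕ) where

    -- A path from `u` to `v` through `i` inner vertices of degree 2. An edge xy has the resistance
    -- 1 / δ x + 1 / δ y, and each inner vertex adds 1/2 twice, so the total is 1 / δ u + 1 / δ v +
    -- i. The factor `4 ^ i` comes from not cancelling: each series reduction contributes 2 from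
    -- either conductance.
    pathWeight : ℕ → V → V → ℕ × ℕ
    pathWeight i u v = 4 ^ i * (δ u * δ v) , 4 ^ i * (δ u + δ v + i * (δ u * δ v))

    -- Only the first edge can be compound: `i` inner vertices have been absorbed by it. The
    -- elimination proceeds from the left.
    chain : ℕ → V → List V → V → List (WEdge V)
    chain i u []       z = ((u , z) , pathWeight i u z) ∷ []
    chain i u (x ∷ xs) z = ((u , x) , pathWeight i u x) ∷ chain 0 x xs z

    chain-avoids : ∀ {c} i u xs z → u ≢ c → c ∉ˡ xs → z ≢ c → Avoids c (chain i u xs z)
    chain-avoids i u []       z u≢ c∉ z≢ = (u≢ , z≢) ∷ []
    chain-avoids i u (x ∷ xs) z u≢ c∉ z≢ = (u≢ , x≢) ∷ chain-avoids 0 x xs z x≢ (c∉ ∘ there) z≢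
      where
      x≢ : x ≢ _
      x≢ eq = c∉ (here (sym eq))

    chain-step : ∀ {X ρ u x y} i rest → δ x ≡ 2 → x ∉ˡ X → u ∈ˡ X → y ∈ˡ X → Fresh x ρ → Avoids x rest →
      treeSum (x ∷ X) ρ (((u , x) , pathWeight i u x) ∷ ((x , y) , pathWeight 0 x y) ∷ rest) ≡
      treeSum X ρ (((u , y) , pathWeight (suc i) u y) ∷ rest)
    chain-step {X} {ρ} {u} {x} {y} i rest δx x∉ u∈ y∈ fr av = trans
      (treeSum-series (proj₁ (pathWeight i u x)) (proj₂ (pathWeight i u x)) (proj₁ (pathWeight 0 x y)) (proj₂ (pathWeight 0 x y)) rest x∉ u∈ y∈ fr av)
      (cong₂ (λ p q → treeSum X ρ (((u , y) , (p , q)) ∷ rest)) first second)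
      where
      first : 4 ^ i * (δ u * δ x) * (1 * (δ x * δ y)) ≡ 4 ^ suc i * (δ u * δ y)
      first rewrite δx = lemma (4 ^ i) (δ u) (δ y)
        where
        lemma : ∀ k a b → k * (a * 2) * (1 * (2 * b)) ≡ 4 * k * (a * b)
        lemma = solve-∀
      second : 4 ^ i * (δ u * δ x) * (1 * (δ x + δ y + 0)) + 1 * (δ x * δ y) * (4 ^ i * (δ u + δ x + i * (δ u * δ x))) ≡
               4 ^ suc i * (δ u + δ y + suc i * (δ u * δ y))
      second rewrite δx = lemma (4 ^ i) (δ u) (δ y) i
        where
        lemma : ∀ k a b i → k * (a * 2) * (1 * (2 + b + 0)) + 1 * (2 * b) * (k * (a + 2 + i * (a * 2))) ≡
                4 * k * (a + b + (1 + i) * (a * b))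
        lemma = solve-∀

    chain-series : ∀ {X ρ u z} i xs cs → All (λ x → δ x ≡ 2) xs → Unique xs → (∀ {x} → x ∈ˡ xs → x ∉ˡ X) →
      u ∈ˡ X → z ∈ˡ X → (∀ c → Fresh c ρ) → (∀ {x} → x ∈ˡ xs → Avoids x cs) →
      treeSum (xs ++ X) ρ (chain i u xs z ++ cs) ≡ treeSum X ρ (((u , z) , pathWeight (i + length xs) u z) ∷ cs)
    chain-series {X} {ρ} {u} {z} i [] cs δs un X∌ u∈ z∈ fr av =
      cong (λ j → treeSum X ρ (((u , z) , pathWeight j u z) ∷ cs)) (sym (+-identityʳ i))
    chain-series {X} {ρ} {u} {z} i (x ∷ xs) cs (δx ∷ δs) (x∉ ∷ un) X∌ u∈ z∈ fr av = trans (eliminate xs x∉′ un)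
      (trans (chain-series (suc i) xs cs δs un (X∌ ∘ there) u∈ z∈ fr (av ∘ there))
        (cong (λ j → treeSum X ρ (((u , z) , pathWeight j u z) ∷ cs)) (sym (+-suc i (length xs)))))
      where
      x∉′ : x ∉ˡ xs
      x∉′ x∈ = All.lookup x∉ x∈ refl
      z≢ : z ≢ x
      z≢ refl = X∌ (here refl) z∈
      u≢ : u ≢ x
      u≢ refl = X∌ (here refl) u∈
      x∉-++ : ∀ xs → x ∉ˡ xs → x ∉ˡ xs ++ X
      x∉-++ xs x∉ x∈ with ∈-++⁻ xs x∈
      ... | inj₁ p = x∉ p
      ... | inj₂ p = X∌ (here refl) p
      eliminate : ∀ xs → x ∉ˡ xs → Unique xs →
        treeSum (x ∷ xs ++ X) ρ (((u , x) , pathWeight i u x) ∷ chain 0 x xs z ++ cs) ≡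
        treeSum (xs ++ X) ρ (chain (suc i) u xs z ++ cs)
      eliminate [] x∉ _ = chain-step i cs δx (X∌ (here refl)) u∈ z∈ (fr x) (av (here refl))
      eliminate (y ∷ ys) x∉ (_ ∷ un) = chain-step i (chain 0 y ys z ++ cs) δx
        (x∉-++ (y ∷ ys) x∉) (∈-++⁺ʳ (y ∷ ys) u∈) (here refl) (fr x)
        (avoids-++ (chain-avoids 0 y ys z (λ eq → x∉ (here (sym eq))) (x∉ ∘ there) z≢) (av (here refl)))

    -- `src` and `tgt` are `source` and `target` on a single path, detached from the numbering of
    -- the vertices of `S`, which permits induction on `r`.
    src : ∀ {r} → V → (Fin r → V) → Fin (suc r) → V
    src u x zero    = u
    src u x (suc j) = x j

    tgt : ∀ {r} → (Fin r → V) → V → Fin (suc r) → V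
    tgt x z j with view j
    ... | ‵fromℕ     = z
    ... | ‵inject₁ i = x i

    tgt-suc : ∀ {r} (x : Fin (suc r) → V) z j → tgt x z (suc j) ≡ tgt (x ∘ suc) z j
    tgt-suc x z j with view j
    ... | ‵fromℕ     = refl
    ... | ‵inject₁ i = refl

    tabulate-chain : ∀ r u (x : Fin r → V) z →
      tabulate (λ j → (src u x j , tgt x z j) , pathWeight 0 (src u x j) (tgt x z j)) ≡ chain 0 u (tabulate x) z
    tabulate-chain zero    u x z = refl
    tabulate-chain (suc r) u x z = cong (((u , x zero) , pathWeight 0 u (x zero)) ∷_) (begin
      tabulate (λ j → (x j , tgt x z (suc j)) , pathWeight 0 (x j) (tgt x z (suc j)))
        ≡⟨ tabulate-cong (λ j → cong₂ (λ a b → (a , b) , pathWeight 0 a b) (split j) (tgt-suc x z j)) ⟩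
      tabulate (λ j → (src (x zero) (x ∘ suc) j , tgt (x ∘ suc) z j) , pathWeight 0 (src (x zero) (x ∘ suc) j) (tgt (x ∘ suc) z j))
        ≡⟨ tabulate-chain r (x zero) (x ∘ suc) z ⟩
      chain 0 (x zero) (tabulate (x ∘ suc)) z ∎)
      where
      open ≡-Reasoning
      split : ∀ j → x j ≡ src (x zero) (x ∘ suc) j
      split zero    = refl
      split (suc j) = refl

  -- Degrees in the subdivided graph

  module _ (r : ℕ) (G : Graph) where
    open Graph G

    private
      H = S r G
      module H = Graph H

    end₁ end₂ : Edge → H.Vertex
    end₁ e = old r G (proj₁ (ends e))
    end₂ e = old r G (proj₂ (ends e))

    target-last : ∀ e → target r G e (fromℕ r) ≡ end₂ e
    target-last e rewrite view-fromℕ r = refl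

    target-inject₁ : ∀ e i → target r G e (inject₁ i) ≡ inner r G e i
    target-inject₁ e i rewrite view-inject₁ i = refl

    ends-combine : ∀ e j → H.ends (combine e j) ≡ (source r G e j , target r G e j)
    ends-combine e j = cong (λ (e , j) → source r G e j , target r G e j) (Fin.remQuot-combine e j)

    isEnd-combine : ∀ {v e j} → v ≡ source r G e j ⊎ v ≡ target r G e j → H.IsEnd v (combine e j)
    isEnd-combine {v} {e} {j} = subst (λ (a , b) → v ≡ a ⊎ v ≡ b) (sym (ends-combine e j))

    isEnd-combine⁻ : ∀ {v e j} → H.IsEnd v (combine e j) → v ≡ source r G e j ⊎ v ≡ target r G e j
    isEnd-combine⁻ {v} {e} {j} = subst (λ (a , b) → v ≡ a ⊎ v ≡ b) (ends-combine e j)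

    combined : ∀ (P : H.Edge → Set) → (∀ e j → P (combine {size} {suc r} e j)) → ∀ f → P f
    combined P p f = subst P (Fin.combine-remQuot {size} (suc r) f) (p (proj₁ (remQuot {size} (suc r) f)) (proj₂ (remQuot {size} (suc r) f)))

    old-injective : ∀ {u v} → old r G u ≡ old r G v → u ≡ v
    old-injective = Fin.↑ˡ-injective _ _ _

    inner-injective : ∀ {e e′ j j′} → inner r G e j ≡ inner r G e′ j′ → e ≡ e′ × j ≡ j′
    inner-injective eq = Fin.combine-injective _ _ _ _ (Fin.↑ʳ-injective order _ _ eq)

    old-source : ∀ {v e} j → old r G v ≡ source r G e j → j ≡ zero × v ≡ proj₁ (ends e)
    old-source zero    eq = refl , old-injective eq
    old-source (suc j) eq = contradiction eq (old≢inner r G _ _ _)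

    old-target : ∀ {v e} j → old r G v ≡ target r G e j → j ≡ fromℕ r × v ≡ proj₂ (ends e)
    old-target j eq with view j
    ... | ‵fromℕ     = refl , old-injective eq
    ... | ‵inject₁ i = contradiction eq (old≢inner r G _ _ _)

    inner-source : ∀ {e i e′} j → inner r G e i ≡ source r G e′ j → e ≡ e′ × j ≡ suc i
    inner-source zero    eq = contradiction (sym eq) (old≢inner r G _ _ _)
    inner-source (suc j) eq = let (p , q) = inner-injective eq in p , cong suc (sym q)

    inner-target : ∀ {e i e′} j → inner r G e i ≡ target r G e′ j → e ≡ e′ × j ≡ inject₁ i
    inner-target j eq with view j
    ... | ‵fromℕ     = contradiction (sym eq) (old≢inner r G _ _ _)
    ... | ‵inject₁ i = let (p , q) = inner-injective eq in p , cong inject₁ (sym q)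

    -- Each edge at `v` leaves exactly one of its pieces at `v`, the first or the last, depending on
    -- which end `v` is; `loopless` excludes both ends at once.
    degree-old : ∀ v → H.degree (old r G v) ≡ degree v
    degree-old v = trans
      (Perm.↭-length (unique⇒↭ (inc-unique H (old r G v)) (Unique.map⁺ extreme-injective (inc-unique G v)) (to _) from))
      (length-map extreme (inc G v))
      where
      position : ∀ e → Dec (v ≡ proj₁ (ends e)) → Fin (suc r)
      position e (yes _) = zero
      position e (no _)  = fromℕ r
      extreme : Edge → H.Edge
      extreme e = combine e (position e (v Fin.≟ proj₁ (ends e)))
      extreme-injective : ∀ {e e′} → extreme e ≡ extreme e′ → e ≡ e′
      extreme-injective {e} {e′} eq = Fin.combine-injectiveˡ e _ e′ _ eq
      to : ∀ f → f ∈ˡ inc H (old r G v) → f ∈ˡ map extreme (inc G v)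
      to = combined _ go
        where
        go : ∀ e j → combine e j ∈ˡ inc H (old r G v) → combine e j ∈ˡ map extreme (inc G v)
        go e j f∈ with v Fin.≟ proj₁ (ends e) in eq | isEnd-combine⁻ {e = e} {j} (∈-inc⁻ H f∈)
        ... | yes p | inj₁ q with refl , _ ← old-source {e = e} j q =
          subst (_∈ˡ map extreme (inc G v)) (cong (combine e ∘ position e) eq) (∈-map⁺ extreme (∈-inc⁺ G (inj₁ p)))
        ... | no p  | inj₁ q = contradiction (proj₂ (old-source {e = e} j q)) p
        ... | yes p | inj₂ q = contradiction (trans (sym p) (proj₂ (old-target {e = e} j q))) (loopless e)
        ... | no p  | inj₂ q with refl , p′ ← old-target {e = e} j q =
          subst (_∈ˡ map extreme (inc G v)) (cong (combine e ∘ position e) eq) (∈-map⁺ extreme (∈-inc⁺ G (inj₂ p′)))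
      from : ∀ {f} → f ∈ˡ map extreme (inc G v) → f ∈ˡ inc H (old r G v)
      from f∈ with e , e∈ , refl ← ∈-map⁻ extreme f∈ = ∈-inc⁺ H (isEnd-combine {e = e} (ends-at (v Fin.≟ proj₁ (ends e)) (∈-inc⁻ G e∈)))
        where
        ends-at : ∀ {e} (d : Dec (v ≡ proj₁ (ends e))) → IsEnd v e →
                  old r G v ≡ source r G e (position e d) ⊎ old r G v ≡ target r G e (position e d)
        ends-at (yes p) _        = inj₁ (cong (old r G) p)
        ends-at (no p)  (inj₁ q) = contradiction q p
        ends-at (no p)  (inj₂ q) = inj₂ (trans (cong (old r G) q) (sym (target-last _)))

    degree-inner : ∀ e i → H.degree (inner r G e i) ≡ 2
    degree-inner e i = Perm.↭-length (unique⇒↭ {ys = two} (inc-unique H (inner r G e i)) ((ne ∷ []) ∷ [] ∷ []) (to _) from)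
      where
      two : List H.Edge
      two = combine e (suc i) ∷ combine e (inject₁ i) ∷ []
      ne : combine e (suc i) ≢ combine e (inject₁ i)
      ne eq = suc≢inject₁ i (Fin.combine-injectiveʳ e (suc i) e (inject₁ i) eq)
        where
        suc≢inject₁ : ∀ {n} (i : Fin n) → suc i ≢ inject₁ i
        suc≢inject₁ (suc i) eq = suc≢inject₁ i (Fin.suc-injective eq)
      to : ∀ f → f ∈ˡ inc H (inner r G e i) → f ∈ˡ two
      to = combined _ go
        where
        go : ∀ e′ j → combine e′ j ∈ˡ inc H (inner r G e i) → combine e′ j ∈ˡ two
        go e′ j f∈ with isEnd-combine⁻ {e = e′} {j} (∈-inc⁻ H f∈)
        ... | inj₁ q with refl , refl ← inner-source {e′ = e′} j q = here refl
        ... | inj₂ q with refl , refl ← inner-target {e′ = e′} j q = there (here refl)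
      from : ∀ {f} → f ∈ˡ two → f ∈ˡ inc H (inner r G e i)
      from (here refl)         = ∈-inc⁺ H (isEnd-combine {e = e} {suc i} (inj₁ refl))
      from (there (here refl)) = ∈-inc⁺ H (isEnd-combine {e = e} {inject₁ i} (inj₂ (sym (target-inject₁ e i))))

  -- Every term of the sum contains exactly one of the two weights of each edge, so their common
  -- factor comes out.
  treeSum-scaleAll : {V E : Set} (X : List V) (ends : E → V × V) (c p q : E → ℕ) (ρ : Labelling V) (es : List E) →
    treeSum X ρ (map (λ e → ends e , c e * p e , c e * q e) es) ≡
    product (map c es) * treeSum X ρ (map (λ e → ends e , p e , q e) es)
  treeSum-scaleAll X ends c p q ρ [] = sym (*-identityˡ _)
  treeSum-scaleAll {V} {E} X ends c p q ρ (e ∷ es) = cases (ρ u ≟ ρ v)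
    where
    open ≡-Reasoning
    u = proj₁ (ends e)
    v = proj₂ (ends e)
    fs gs : List E → List (WEdge V)
    fs = map (λ e → ends e , c e * p e , c e * q e)
    gs = map (λ e → ends e , p e , q e)
    Π = product (map c es)
    cases : Dec (ρ u ≡ ρ v) → treeSum X ρ (fs (e ∷ es)) ≡ c e * Π * treeSum X ρ (gs (e ∷ es))
    cases (yes eq) = begin
      treeSum X ρ (fs (e ∷ es))              ≡⟨ treeSum-loop X ρ u v (c e * p e) (c e * q e) (fs es) eq ⟩
      c e * q e * treeSum X ρ (fs es)        ≡⟨ cong (c e * q e *_) (treeSum-scaleAll X ends c p q ρ es) ⟩
      c e * q e * (Π * treeSum X ρ (gs es))  ≡⟨ lemma (c e) (q e) Π (treeSum X ρ (gs es)) ⟩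
      c e * Π * (q e * treeSum X ρ (gs es))  ≡⟨ cong (c e * Π *_) (treeSum-loop X ρ u v (p e) (q e) (gs es) eq) ⟨
      c e * Π * treeSum X ρ (gs (e ∷ es))    ∎
      where
      lemma : ∀ c q Π t → c * q * (Π * t) ≡ c * Π * (q * t)
      lemma = solve-∀
    cases (no ne) = begin
      treeSum X ρ (fs (e ∷ es))
        ≡⟨ treeSum-link X ρ u v (c e * p e) (c e * q e) (fs es) ne ⟩
      c e * q e * treeSum X ρ (fs es) + c e * p e * treeSum X (merge ρ u v) (fs es)
        ≡⟨ cong₂ (λ a b → c e * q e * a + c e * p e * b) (treeSum-scaleAll X ends c p q ρ es) (treeSum-scaleAll X ends c p q (merge ρ u v) es) ⟩
      c e * q e * (Π * treeSum X ρ (gs es)) + c e * p e * (Π * treeSum X (merge ρ u v) (gs es))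
        ≡⟨ lemma (c e) (q e) (p e) Π (treeSum X ρ (gs es)) (treeSum X (merge ρ u v) (gs es)) ⟩
      c e * Π * (q e * treeSum X ρ (gs es) + p e * treeSum X (merge ρ u v) (gs es))
        ≡⟨ cong (c e * Π *_) (treeSum-link X ρ u v (p e) (q e) (gs es) ne) ⟨
      c e * Π * treeSum X ρ (gs (e ∷ es))    ∎
      where
      lemma : ∀ c q p Π t t′ → c * q * (Π * t) + c * p * (Π * t′) ≡ c * Π * (q * t + p * t′)
      lemma = solve-∀

  -- Reducing the subdivided edges to single weighted edges

  module _ (r : ℕ) (G : Graph) where
    open Graph G

    private
      H = S r G
      module H = Graph H

    inners : Edge → List H.Vertex
    inners e = tabulate (inner r G e)

    subEdges : Edge → List (WEdge H.Vertex)
    subEdges e = chain H.degree 0 (end₁ r G e) (inners e) (end₂ r G e)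

    -- Not yet a resistance in itself: the quotient of `resistance e` by `conductance e` is the
    -- resistance 1 / deg u + 1 / deg v + r of the path.
    resistance : Edge → ℕ
    resistance e = let (u , v) = ends e in degree u + degree v + r * (degree u * degree v)

    conductance : Edge → ℕ
    conductance e = let (u , v) = ends e in degree u * degree v

    edges-↭ : weighted H (ω H) ↭ concatMap subEdges (allFin size)
    edges-↭ = ↭-trans (Perm.map⁺ toEdge all-edges) (↭-reflexive (trans
        (map-concatMap toEdge parts (allFin size)) (concatMap-cong part≡chain (allFin size))))
      where
      toEdge : H.Edge → WEdge H.Vertex
      toEdge f = H.ends f , ω H f
      parts : Edge → List H.Edge
      parts e = map (combine e) (allFin (suc r))
      all-edges : allFin H.size ↭ concatMap parts (allFin size)
      all-edges = unique⇒↭ (Unique.allFin⁺ H.size)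
        (concatMap-unique parts (Unique.allFin⁺ size)
          (λ e → Unique.map⁺ (λ {i} {j} → Fin.combine-injectiveʳ e i e j) (Unique.allFin⁺ (suc r))) same)
        (λ {f} _ → combined r G (_∈ˡ concatMap parts (allFin size)) (λ e j → ∈-concatMap parts (∈-allFin e) (∈-map⁺ (combine e) (∈-allFin j))) f)
        (λ _ → ∈-allFin _)
        where
        same : ∀ {e e′ f} → f ∈ˡ parts e → f ∈ˡ parts e′ → e ≡ e′
        same {e} {e′} p q with i , _ , refl ← ∈-map⁻ (combine e) p | j , _ , eq ← ∈-map⁻ (combine e′) q =
          Fin.combine-injectiveˡ e i e′ j eq
      part≡chain : ∀ e → map toEdge (parts e) ≡ subEdges e
      part≡chain e = begin
        map toEdge (map (combine e) (allFin (suc r)))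
          ≡⟨ map-∘ (allFin (suc r)) ⟨
        map (toEdge ∘ combine e) (allFin (suc r))
          ≡⟨ map-tabulate id (toEdge ∘ combine e) ⟩
        tabulate (toEdge ∘ combine e)
          ≡⟨ tabulate-cong (λ j → trans (cong (λ (a , b) → (a , b) , H.degree a * H.degree b , H.degree a + H.degree b) (ends-combine r G e j))
               (edge≡ j)) ⟩
        tabulate (λ j → (s j , t′ j) , pathWeight H.degree 0 (s j) (t′ j))
          ≡⟨ tabulate-chain H.degree r (end₁ r G e) (inner r G e) (end₂ r G e) ⟩
        subEdges e ∎
        where
        open ≡-Reasoning
        s = src H.degree (end₁ r G e) (inner r G e)
        t′ = tgt H.degree (inner r G e) (end₂ r G e)
        source≡ : ∀ j → source r G e j ≡ s j
        source≡ zero    = refl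
        source≡ (suc j) = refl
        target≡ : ∀ j → target r G e j ≡ t′ j
        target≡ j with view j
        ... | ‵fromℕ     = refl
        ... | ‵inject₁ i = refl
        edge≡ : ∀ j → ((source r G e j , target r G e j) , H.degree (source r G e j) * H.degree (target r G e j) , H.degree (source r G e j) + H.degree (target r G e j)) ≡
                      ((s j , t′ j) , pathWeight H.degree 0 (s j) (t′ j))
        edge≡ j = trans (cong₂ (λ a b → (a , b) , H.degree a * H.degree b , H.degree a + H.degree b) (source≡ j) (target≡ j))
          (cong₂ (λ p q → (s j , t′ j) , p , q) (sym (+-identityʳ _)) (sym (trans (+-identityʳ _) (+-identityʳ _))))

    oldᴴ : List H.Vertex
    oldᴴ = map (old r G) (allFin order)

    old-or-inner : ∀ (P : H.Vertex → Set) → (∀ v → P (old r G v)) → (∀ e i → P (inner r G e i)) → ∀ x → P x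
    old-or-inner P o i x with splitAt order x in eq
    ... | inj₁ v = subst P (Fin.splitAt⁻¹-↑ˡ eq) (o v)
    ... | inj₂ y = subst P (Fin.splitAt⁻¹-↑ʳ eq)
      (subst (λ z → P (order ↑ʳ z)) (Fin.combine-remQuot {size} r y) (i (proj₁ (remQuot {size} r y)) (proj₂ (remQuot {size} r y))))

    ∈-inners⁻ : ∀ {e x} → x ∈ˡ inners e → ∃[ i ] x ≡ inner r G e i
    ∈-inners⁻ = ∈-tabulate⁻

    inners-unique : ∀ e → Unique (inners e)
    inners-unique e = Unique.tabulate⁺ (proj₂ ∘ inner-injective r G)

    inners-apart : ∀ {e e′ x} → x ∈ˡ inners e → x ∈ˡ inners e′ → e ≡ e′
    inners-apart p q with _ , refl ← ∈-inners⁻ p | _ , eq ← ∈-inners⁻ q = proj₁ (inner-injective r G eq)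

    inners∉old : ∀ {e x} → x ∈ˡ inners e → x ∉ˡ oldᴴ
    inners∉old p q with _ , refl ← ∈-inners⁻ p | _ , _ , eq ← ∈-map⁻ (old r G) q = old≢inner r G _ _ _ (sym eq)

    inners∉others : ∀ {e x} es → e ∉ˡ es → x ∈ˡ inners e → x ∉ˡ concatMap inners es
    inners∉others es e∉ p q with _ , e′∈ , q′ ← ∈-concatMap-find inners es q with refl ← inners-apart p q′ = e∉ e′∈

    vertices-↭ : allFin H.order ↭ concatMap inners (allFin size) ++ oldᴴ
    vertices-↭ = unique⇒↭ (Unique.allFin⁺ H.order)
      (Unique.++⁺ (concatMap-unique inners (Unique.allFin⁺ size) inners-unique inners-apart)
        (Unique.map⁺ (old-injective r G) (Unique.allFin⁺ order))
        (λ (p , q) → let (_ , _ , p′) = ∈-concatMap-find inners (allFin size) p in inners∉old p′ q))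
      (λ {x} _ → old-or-inner (_∈ˡ (concatMap inners (allFin size) ++ oldᴴ))
        (λ v → ∈-++⁺ʳ (concatMap inners (allFin size)) (∈-map⁺ (old r G) (∈-allFin v)))
        (λ e i → ∈-++⁺ˡ (∈-concatMap inners (∈-allFin e) (∈-tabulate⁺ i))) x)
      (λ _ → ∈-allFin _)

    end-weight : Edge → ℕ × ℕ
    end-weight e = 4 ^ r * conductance e , 4 ^ r * resistance e

    collapsed : Edge → WEdge H.Vertex
    collapsed e = mapEnds (old r G) (ends e , end-weight e)

    subEdges-avoid : ∀ {e x} es → e ∉ˡ es → x ∈ˡ inners e → Avoids x (concatMap subEdges es)
    subEdges-avoid [] e∉ x∈ = []
    subEdges-avoid {e} {x} (f ∷ es) e∉ x∈ = avoids-++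
      (chain-avoids H.degree 0 _ (inners f) _ (old≢ _) (λ x∈′ → e∉ (here (inners-apart x∈ x∈′))) (old≢ _))
      (subEdges-avoid es (e∉ ∘ there) x∈)
      where
      old≢ : ∀ v → old r G v ≢ x
      old≢ v refl = inners∉old x∈ (∈-map⁺ (old r G) (∈-allFin v))

    toℕ-fresh : ∀ {n} (c : Fin n) → Fresh c toℕ
    toℕ-fresh c .apart ne = ne ∘ toℕ-injective

    -- Paths of different edges share no inner vertex, so `chain-series` applies to one path after
    -- another; `cs` collects the paths already reduced.
    collapse : ∀ es → Unique es → ∀ cs → (∀ {e x} → e ∈ˡ es → x ∈ˡ inners e → Avoids x cs) →
      treeSum (concatMap inners es ++ oldᴴ) toℕ (concatMap subEdges es ++ cs) ≡
      treeSum oldᴴ toℕ (map collapsed es ++ cs)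
    collapse [] un cs av = refl
    collapse (e ∷ es) (e∉ ∷ un) cs av = begin
      treeSum ((inners e ++ concatMap inners es) ++ oldᴴ) toℕ ((subEdges e ++ concatMap subEdges es) ++ cs)
        ≡⟨ cong₂ (λ X fs → treeSum X toℕ fs) (++-assoc (inners e) _ _) (++-assoc (subEdges e) _ _) ⟩
      treeSum (inners e ++ X) toℕ (subEdges e ++ rest)
        ≡⟨ chain-series H.degree 0 (inners e) rest (All.tabulate⁺ (degree-inner r G e)) (inners-unique e) x∉ (old∈ _) (old∈ _) toℕ-fresh
             (λ x∈ → avoids-++ (subEdges-avoid es e∉′ x∈) (av (here refl) x∈)) ⟩
      treeSum X toℕ (((end₁ r G e , end₂ r G e) , pathWeight H.degree (length (inners e)) (end₁ r G e) (end₂ r G e)) ∷ rest)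
        ≡⟨ cong (λ w → treeSum X toℕ (((end₁ r G e , end₂ r G e) , w) ∷ rest)) weight ⟩
      treeSum X toℕ (collapsed e ∷ concatMap subEdges es ++ cs)
        ≡⟨ treeSum-↭ (Perm.shift (collapsed e) (concatMap subEdges es) cs) toℕ ⟨
      treeSum X toℕ (concatMap subEdges es ++ (collapsed e ∷ cs))
        ≡⟨ collapse es un (collapsed e ∷ cs) (λ {f} f∈ x∈ → (old≢ x∈ _ , old≢ x∈ _) ∷ av (there f∈) x∈) ⟩
      treeSum oldᴴ toℕ (map collapsed es ++ (collapsed e ∷ cs))
        ≡⟨ treeSum-↭ (Perm.shift (collapsed e) (map collapsed es) cs) toℕ ⟩
      treeSum oldᴴ toℕ (collapsed e ∷ map collapsed es ++ cs) ∎
      where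
      open ≡-Reasoning
      X = concatMap inners es ++ oldᴴ
      rest = concatMap subEdges es ++ cs
      e∉′ : e ∉ˡ es
      e∉′ e∈ = All.lookup e∉ e∈ refl
      x∉ : ∀ {x} → x ∈ˡ inners e → x ∉ˡ X
      x∉ x∈ x∈′ with ∈-++⁻ (concatMap inners es) x∈′
      ... | inj₁ p = inners∉others es e∉′ x∈ p
      ... | inj₂ p = inners∉old x∈ p
      old∈ : ∀ v → old r G v ∈ˡ X
      old∈ v = ∈-++⁺ʳ (concatMap inners es) (∈-map⁺ (old r G) (∈-allFin v))
      old≢ : ∀ {f x} → x ∈ˡ inners f → ∀ v → old r G v ≢ x
      old≢ x∈ v refl = inners∉old x∈ (∈-map⁺ (old r G) (∈-allFin v))
      weight : pathWeight H.degree (length (inners e)) (end₁ r G e) (end₂ r G e) ≡ end-weight e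
      weight rewrite length-tabulate (inner r G e) | degree-old r G (proj₁ (ends e)) | degree-old r G (proj₂ (ends e)) = refl

    subdivided-treeSum : treeSum (allFin H.order) toℕ (weighted H (ω H)) ≡
      product (map (λ _ → 4 ^ r) (allFin size)) * treeSum (allFin order) toℕ (weighted G (λ e → conductance e , resistance e))
    subdivided-treeSum = begin
      treeSum (allFin H.order) toℕ (weighted H (ω H))
        ≡⟨ treeSum-↭ edges-↭ toℕ ⟩
      treeSum (allFin H.order) toℕ (concatMap subEdges (allFin size))
        ≡⟨ treeSum-sameSet (concatMap subEdges (allFin size)) (Perm.∈-resp-↭ vertices-↭ , λ _ → ∈-allFin _) ≈-refl ⟩
      treeSum (concatMap inners (allFin size) ++ oldᴴ) toℕ (concatMap subEdges (allFin size))
        ≡⟨ cong (treeSum (concatMap inners (allFin size) ++ oldᴴ) toℕ) (++-identityʳ (concatMap subEdges (allFin size))) ⟨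
      treeSum (concatMap inners (allFin size) ++ oldᴴ) toℕ (concatMap subEdges (allFin size) ++ [])
        ≡⟨ collapse (allFin size) (Unique.allFin⁺ size) [] (λ _ _ → []) ⟩
      treeSum oldᴴ toℕ (map collapsed (allFin size) ++ [])
        ≡⟨ cong (treeSum oldᴴ toℕ) (trans (++-identityʳ _) (map-∘ (allFin size))) ⟩
      treeSum oldᴴ toℕ (map (mapEnds (old r G)) (weighted G end-weight))
        ≡⟨ treeSum-embed (old r G) toℕ toℕ (cong (toℕ ∘ old r G) ∘ toℕ-injective) (cong toℕ ∘ old-injective r G ∘ toℕ-injective) (allFin order) (weighted G end-weight) ⟨
      treeSum (allFin order) toℕ (weighted G end-weight)
        ≡⟨ treeSum-scaleAll (allFin order) ends (λ _ → 4 ^ r) conductance resistance toℕ (allFin size) ⟩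
      product (map (λ _ → 4 ^ r) (allFin size)) * treeSum (allFin order) toℕ (weighted G (λ e → conductance e , resistance e)) ∎
      where open ≡-Reasoning

    squares-subdivided : squares H (allFin H.order) ≡ product (map (λ _ → 4 ^ r) (allFin size)) * squares G (allFin order)
    squares-subdivided = begin
      squares H (allFin H.order)
        ≡⟨ product-↭ (Perm.map⁺ sq vertices-↭) ⟩
      product (map sq (concatMap inners (allFin size) ++ oldᴴ))
        ≡⟨ cong product (map-++ sq (concatMap inners (allFin size)) oldᴴ) ⟩
      product (map sq (concatMap inners (allFin size)) ++ map sq oldᴴ)
        ≡⟨ product-++ (map sq (concatMap inners (allFin size))) (map sq oldᴴ) ⟩
      product (map sq (concatMap inners (allFin size))) * product (map sq oldᴴ)
        ≡⟨ cong₂ _*_ (all-inner (allFin size)) (cong product (trans (sym (map-∘ (allFin order)))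
             (map-cong (λ v → cong₂ _*_ (degree-old r G v) (degree-old r G v)) (allFin order)))) ⟩
      product (map (λ _ → 4 ^ r) (allFin size)) * squares G (allFin order) ∎
      where
      open ≡-Reasoning
      sq : H.Vertex → ℕ
      sq v = H.degree v * H.degree v
      fours : ∀ n (x : Fin n → H.Vertex) → (∀ i → H.degree (x i) ≡ 2) → product (map sq (tabulate x)) ≡ 4 ^ n
      fours zero    x eq = refl
      fours (suc n) x eq = cong₂ _*_ (cong₂ _*_ (eq zero) (eq zero)) (fours n (x ∘ suc) (eq ∘ suc))
      all-inner : ∀ es → product (map sq (concatMap inners es)) ≡ product (map (λ _ → 4 ^ r) es)
      all-inner [] = refl
      all-inner (e ∷ es) = trans (cong product (map-++ sq (inners e) (concatMap inners es)))
        (trans (product-++ (map sq (inners e)) (map sq (concatMap inners es)))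
          (cong₂ _*_ (fours r (inner r G e) (degree-inner r G e)) (all-inner es)))

    -- The inner vertices give a factor `4 ^ r` per edge on both sides, on the left through the
    -- squares of their degrees and on the right through `pathWeight`.
    t-line-subdivided : NonZero size →
      squares G (allFin order) * t (L H) ≡ treeSum (allFin order) toℕ (weighted G (λ e → conductance e , resistance e))
    t-line-subdivided nz = *-cancelˡ-≡ _ _ c {{c≢0 (allFin size)}} (begin
      c * (squares G (allFin order) * t (L H))    ≡⟨ *-assoc c (squares G (allFin order)) (t (L H)) ⟨
      c * squares G (allFin order) * t (L H)      ≡⟨ cong (_* t (L H)) squares-subdivided ⟨
      squares H (allFin H.order) * t (L H)        ≡⟨ t-line H (m*n≢0 size (suc r) {{nz}}) ⟩
      treeSum (allFin H.order) toℕ (weighted H (ω H)) ≡⟨ subdivided-treeSum ⟩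
      c * treeSum (allFin order) toℕ (weighted G (λ e → conductance e , resistance e)) ∎)
      where
      open ≡-Reasoning
      c = product (map (λ _ → 4 ^ r) (allFin size))
      c≢0 : ∀ (es : List Edge) → NonZero (product (map (λ _ → 4 ^ r) es))
      c≢0 []       = _
      c≢0 (_ ∷ es) = m*n≢0 (4 ^ r) _ {{m^n≢0 4 r}} {{c≢0 es}}

  -- Semiregular graphs

  module _ {n : ℕ} {E : Set} (ends : E → Fin n × Fin n) (a b : ℕ) where

    private
      allV = allFin n
      uniform : ℕ → ℕ → List E → List (WEdge (Fin n))
      uniform a b = map (λ e → ends e , a , b)

    record Classes (ρ : Labelling (Fin n)) (j : ℕ) : Set where
      field
        labels : List ℕ
        count  : length labels ≡ j
        unique : Unique labels
        image  : ∀ x → ρ x ∈ˡ labels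
        onto   : ∀ {i} → i ∈ˡ labels → ∃[ x ] ρ x ≡ i
    open Classes

    -- `merge` gives the class of `v` the label of `u`, so the label of `v` is the only one to fall
    -- out of use.
    merge-classes : ∀ {ρ j} u v → ρ u ≢ ρ v → Classes ρ (suc j) → Classes (merge ρ u v) j
    merge-classes {ρ} u v ne c = record
      { labels = I′
      ; count  = suc-injective (trans (sym (Perm.↭-length (unique⇒↭ {ys = ρ v ∷ I′} (unique c) (All.tabulate new ∷ unique′) to from))) (count c))
      ; unique = unique′
      ; image  = image′
      ; onto   = onto′
      }
      where
      I = labels c
      P? = λ i → ¬? (i ≟ ρ v)
      I′ = filter P? I
      new : ∀ {i} → i ∈ˡ I′ → ρ v ≢ i
      new i∈ eq = proj₂ (∈-filter⁻ P? {xs = I} i∈) (sym eq)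
      unique′ : Unique I′
      unique′ = Unique.filter⁺ P? (unique c)
      image′ : ∀ x → merge ρ u v x ∈ˡ I′
      image′ x with merge-label ρ u v x
      ... | inj₁ (_ , eq)   = subst (_∈ˡ I′) (sym eq) (∈-filter⁺ P? (image c u) ne)
      ... | inj₂ (ne′ , eq) = subst (_∈ˡ I′) (sym eq) (∈-filter⁺ P? (image c x) ne′)
      onto′ : ∀ {i} → i ∈ˡ I′ → ∃[ x ] merge ρ u v x ≡ i
      onto′ i∈ with p , ne′ ← ∈-filter⁻ P? {xs = I} i∈ with x , refl ← onto c p with merge-label ρ u v x
      ... | inj₁ (eq , _) = contradiction eq ne′
      ... | inj₂ (_ , eq) = x , eq
      to : ∀ {i} → i ∈ˡ I → i ∈ˡ ρ v ∷ I′
      to {i} i∈ with i ≟ ρ v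
      ... | yes refl = here refl
      ... | no ne′   = there (∈-filter⁺ P? i∈ ne′)
      from : ∀ {i} → i ∈ˡ ρ v ∷ I′ → i ∈ˡ I
      from (here refl) = image c v
      from (there i∈)  = proj₁ (∈-filter⁻ P? {xs = I} i∈)

    one-class : ∀ {ρ} → Classes ρ 1 → ∀ u v → ρ u ≡ ρ v
    one-class c u v with labels c | count c | image c u | image c v
    ... | _ ∷ [] | refl | here p | here q = trans p (sym q)

    few-classes : ∀ {ρ j} → AllEqual allV ρ → Classes ρ (suc j) → j ≡ 0
    few-classes {ρ} {j} eq c = go (labels c) (count c) (unique c) (onto c)
      where
      go : ∀ I → length I ≡ suc j → Unique I → (∀ {i} → i ∈ˡ I → ∃[ x ] ρ x ≡ i) → j ≡ 0
      go (_ ∷ []) refl _ _ = refl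
      go (_ ∷ _ ∷ _) _ ((ne ∷ _) ∷ _) onto
        with x , refl ← onto (here refl) | y , refl ← onto (there (here refl)) =
        contradiction (allEqual⇒ {ρ = ρ} eq (∈-allFin x) (∈-allFin y)) ne

    -- Every spanning tree has one edge less than there are classes.
    treeSum-uniform : ∀ {ρ} j es → Classes ρ (suc j) →
      b ^ j * treeSum allV ρ (uniform a b es) ≡ a ^ j * b ^ length es * treeSum allV ρ (uniform 1 1 es)
    treeSum-uniform {ρ} j [] c with allEqual? allV ρ
    ... | yes eq with refl ← few-classes eq c = refl
    ... | no _ = trans (*-zeroʳ (b ^ j)) (sym (*-zeroʳ (a ^ j * 1)))
    treeSum-uniform {ρ} j (e ∷ es) c = cases j c (ρ u ≟ ρ v)
      where
      open ≡-Reasoning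
      u = proj₁ (ends e)
      v = proj₂ (ends e)
      T T₁ : Labelling (Fin n) → ℕ
      T σ = treeSum allV σ (uniform a b es)
      T₁ σ = treeSum allV σ (uniform 1 1 es)
      B = b ^ length es
      cases : ∀ j → Classes ρ (suc j) → Dec (ρ u ≡ ρ v) →
              b ^ j * treeSum allV ρ (uniform a b (e ∷ es)) ≡ a ^ j * (b * B) * treeSum allV ρ (uniform 1 1 (e ∷ es))
      cases j c (yes eq) = begin
        b ^ j * treeSum allV ρ (uniform a b (e ∷ es))  ≡⟨ cong (b ^ j *_) (treeSum-loop allV ρ u v a b (uniform a b es) eq) ⟩
        b ^ j * (b * T ρ)                              ≡⟨ lemma₁ (b ^ j) b (T ρ) ⟩
        b * (b ^ j * T ρ)                              ≡⟨ cong (b *_) (treeSum-uniform j es c) ⟩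
        b * (a ^ j * B * T₁ ρ)                         ≡⟨ lemma₂ b (a ^ j) B (T₁ ρ) ⟩
        a ^ j * (b * B) * T₁ ρ                         ≡⟨ cong (a ^ j * (b * B) *_) (loop₁ allV ρ u v 1 (uniform 1 1 es) eq) ⟨
        a ^ j * (b * B) * treeSum allV ρ (uniform 1 1 (e ∷ es)) ∎
        where
        lemma₁ : ∀ x b t → x * (b * t) ≡ b * (x * t)
        lemma₁ = solve-∀
        lemma₂ : ∀ b x y t → b * (x * y * t) ≡ x * (b * y) * t
        lemma₂ = solve-∀
      cases zero c (no ne) = contradiction (one-class c u v) ne
      cases (suc j) c (no ne) = begin
        b * b ^ j * treeSum allV ρ (uniform a b (e ∷ es))
          ≡⟨ cong (b * b ^ j *_) (treeSum-link allV ρ u v a b (uniform a b es) ne) ⟩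
        b * b ^ j * (b * T ρ + a * T (merge ρ u v))
          ≡⟨ lemma₁ b (b ^ j) (T ρ) a (T (merge ρ u v)) ⟩
        b * (b * b ^ j * T ρ) + a * b * (b ^ j * T (merge ρ u v))
          ≡⟨ cong₂ (λ x y → b * x + a * b * y) (treeSum-uniform (suc j) es c)
               (treeSum-uniform j es (merge-classes u v ne c)) ⟩
        b * (a * a ^ j * B * T₁ ρ) + a * b * (a ^ j * B * T₁ (merge ρ u v))
          ≡⟨ lemma₂ a b (a ^ j) B (T₁ ρ) (T₁ (merge ρ u v)) ⟩
        a * a ^ j * (b * B) * (T₁ ρ + 1 * T₁ (merge ρ u v))
          ≡⟨ cong (a * a ^ j * (b * B) *_) (link₁ allV ρ u v 1 (uniform 1 1 es) ne) ⟨
        a * a ^ j * (b * B) * treeSum allV ρ (uniform 1 1 (e ∷ es)) ∎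
        where
        lemma₁ : ∀ b x t a t′ → b * x * (b * t + a * t′) ≡ b * (b * x * t) + a * b * (x * t′)
        lemma₁ = solve-∀
        lemma₂ : ∀ a b x y t t′ → b * (a * x * y * t) + a * b * (x * y * t′) ≡ a * x * (b * y) * (t + 1 * t′)
        lemma₂ = solve-∀

  toℕ-classes : ∀ {n j} {E : Set} (ends : E → Fin n × Fin n) (a b : ℕ) → n ≡ j → Classes ends a b toℕ j
  toℕ-classes {n} ends a b eq = record
    { labels = map toℕ (allFin n)
    ; count  = trans (length-map toℕ (allFin n)) (trans (length-tabulate {n = n} id) eq)
    ; unique = Unique.map⁺ toℕ-injective (Unique.allFin⁺ n)
    ; image  = λ x → ∈-map⁺ toℕ (∈-allFin x)
    ; onto   = λ i∈ → let (x , _ , eq) = ∈-map⁻ toℕ i∈ in x , sym eq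
    }

  -- Products of degrees and the weights of a semiregular graph

  product-* : {A : Set} (f g : A → ℕ) (xs : List A) → product (map (λ x → f x * g x) xs) ≡ product (map f xs) * product (map g xs)
  product-* f g [] = refl
  product-* f g (x ∷ xs) = trans (cong (f x * g x *_) (product-* f g xs)) (lemma (f x) (g x) (product (map f xs)) (product (map g xs)))
    where
    lemma : ∀ a b c d → a * b * (c * d) ≡ a * c * (b * d)
    lemma = solve-∀

  product-const : {A : Set} (c : ℕ) (xs : List A) → product (map (λ _ → c) xs) ≡ c ^ length xs
  product-const c []       = refl
  product-const c (_ ∷ xs) = cong (c *_) (product-const c xs)

  length-allFin : ∀ n → length (allFin n) ≡ n
  length-allFin n = length-tabulate id

  module _ (G : Graph) where
    open Graph G

    double-count : (f : Vertex → ℕ) →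
      product (map (λ v → f v ^ degree v) (allFin order)) ≡ product (map (λ e → f (proj₁ (ends e)) * f (proj₂ (ends e))) (allFin size))
    double-count f = begin
      product (map (λ v → f v ^ degree v) (allFin order))   ≡⟨ by-vertex (allFin order) ⟨
      product (map (f ∘ proj₁) (incidences G))              ≡⟨ product-↭ (Perm.map⁺ (f ∘ proj₁) (incidences-↭ G)) ⟩
      product (map (f ∘ proj₁) (incidences′ G))             ≡⟨ by-edge (allFin size) ⟩
      product (map (λ e → f (proj₁ (ends e)) * f (proj₂ (ends e))) (allFin size)) ∎
      where
      open ≡-Reasoning
      at : Vertex → List (Vertex × Edge)
      at v = map (v ,_) (inc G v)
      by-vertex : ∀ vs → product (map (f ∘ proj₁) (concatMap at vs)) ≡ product (map (λ v → f v ^ degree v) vs)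
      by-vertex [] = refl
      by-vertex (v ∷ vs) = trans (cong product (map-++ (f ∘ proj₁) (at v) (concatMap at vs)))
        (trans (product-++ (map (f ∘ proj₁) (at v)) _)
          (cong₂ _*_ (trans (cong product (sym (map-∘ (inc G v)))) (product-const (f v) (inc G v))) (by-vertex vs)))
      by-edge : ∀ es → product (map (f ∘ proj₁) (concatMap (λ e → (proj₁ (ends e) , e) ∷ (proj₂ (ends e) , e) ∷ []) es)) ≡
                product (map (λ e → f (proj₁ (ends e)) * f (proj₂ (ends e))) es)
      by-edge [] = refl
      by-edge (e ∷ es) = trans (cong (λ x → f (proj₁ (ends e)) * (f (proj₂ (ends e)) * x)) (by-edge es)) (sym (*-assoc (f (proj₁ (ends e))) _ _))

    Pendant : Edge → Set
    Pendant e = ∃[ v ] IsEnd v e × (∀ {f} → IsEnd v f → f ≡ e)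

    degree-one : ∀ {v e} → degree v ≡ 1 → IsEnd v e → Pendant e
    degree-one {v} {e} deg end = v , end , λ end′ → same (inc G v) deg (∈-inc⁺ G end′) (∈-inc⁺ G end)
      where
      same : ∀ (es : List Edge) {e f} → length es ≡ 1 → f ∈ˡ es → e ∈ˡ es → f ≡ e
      same (_ ∷ []) _ (here refl) (here refl) = refl

    other-end : ∀ {v e} → IsEnd v e → ∃[ w ] w ≢ v
    other-end {e = e} (inj₁ refl) = proj₂ (ends e) , ≢-sym (loopless e)
    other-end {e = e} (inj₂ refl) = proj₁ (ends e) , loopless e

    -- Every spanning tree contains the pendant edges, so their second weights
    -- do not matter.
    treeSum-pendant : (p q q′ : Edge → ℕ) → (∀ e → q e ≡ q′ e ⊎ Pendant e) →
      treeSum (allFin order) toℕ (weighted G (λ e → p e , q e)) ≡ treeSum (allFin order) toℕ (weighted G (λ e → p e , q′ e))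
    treeSum-pendant p q q′ choice = replace [] (allFin size) (λ _ ()) (Unique.allFin⁺ size)
      where
      open ≡-Reasoning
      T : List (WEdge Vertex) → ℕ
      T = treeSum (allFin order) toℕ
      edge : (Edge → ℕ) → Edge → WEdge Vertex
      edge q e = ends e , p e , q e
      avoid : ∀ {v e} q es → e ∉ˡ es → (∀ {f} → IsEnd v f → f ≡ e) → Avoids v (map (edge q) es)
      avoid q [] e∉ only = []
      avoid q (f ∷ es) e∉ only =
        ((λ eq → e∉ (here (sym (only (inj₁ (sym eq)))))) , (λ eq → e∉ (here (sym (only (inj₂ (sym eq))))))) ∷
        avoid q es (e∉ ∘ there) only
      swap-weight : ∀ e rest → q e ≡ q′ e ⊎ (∃[ v ] IsEnd v e × Avoids v rest) → T (edge q e ∷ rest) ≡ T (edge q′ e ∷ rest)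
      swap-weight e rest (inj₁ eq) = cong (λ x → T ((ends e , p e , x) ∷ rest)) eq
      -- The second weight multiplies the sum without `e`, where `v` is isolated from the other end
      -- `w`; that sum is zero.
      swap-weight e rest (inj₂ (v , end , av)) with w , w≢ ← other-end end = cong
        (λ x → x + unlessLoop (toℕ (proj₁ (ends e)) ≟ toℕ (proj₂ (ends e))) (p e * treeSum (allFin order) (merge toℕ (proj₁ (ends e)) (proj₂ (ends e))) rest))
        (trans (cong (q e *_) zero-rest) (trans (*-zeroʳ (q e)) (sym (trans (cong (q′ e *_) zero-rest) (*-zeroʳ (q′ e))))))
        where
        zero-rest : T rest ≡ 0
        zero-rest = treeSum-isolated (∈-allFin v) (∈-allFin w) w≢ toℕ rest (fresh λ ne → ne ∘ toℕ-injective) av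
      replace : ∀ ps es → (∀ {f} → f ∈ˡ es → f ∉ˡ ps) → Unique es →
        T (map (edge q′) ps ++ map (edge q) es) ≡ T (map (edge q′) ps ++ map (edge q′) es)
      replace ps [] new un = refl
      replace ps (e ∷ es) new (e∉ ∷ un) = begin
        T (map (edge q′) ps ++ edge q e ∷ map (edge q) es)
          ≡⟨ treeSum-↭ (Perm.shift (edge q e) (map (edge q′) ps) (map (edge q) es)) toℕ ⟩
        T (edge q e ∷ map (edge q′) ps ++ map (edge q) es)
          ≡⟨ swap-weight e _ (Sum.map₂ (λ (v , end , only) → v , end ,
               avoids-++ (avoid q′ ps (new (here refl)) only) (avoid q es e∉′ only)) (choice e)) ⟩
        T (map (edge q′) (e ∷ ps) ++ map (edge q) es)
          ≡⟨ replace (e ∷ ps) es (λ where f∈ (here refl) → e∉′ f∈ ; f∈ (there f∈′) → new (there f∈) f∈′) un ⟩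
        T (edge q′ e ∷ map (edge q′) ps ++ map (edge q′) es)
          ≡⟨ treeSum-↭ (Perm.shift (edge q′ e) (map (edge q′) ps) (map (edge q′) es)) toℕ ⟨
        T (map (edge q′) ps ++ edge q′ e ∷ map (edge q′) es) ∎
        where
        e∉′ : e ∉ˡ es
        e∉′ e∈ = All.lookup e∉ e∈ refl

    module _ (k r : ℕ) where

      private
        T : (Edge → ℕ × ℕ) → ℕ
        T w = treeSum (allFin order) toℕ (weighted G w)
        b = 2 + r * k

      -- If both ends have degree `k`, then `k` times the second weight is `k * k * (2 + r * k)`,
      -- that is, `b` times the first weight. At the other edges, which are pendant, the second
      -- weight may be replaced with the same expression. Taking the first weight out of every edge
      -- then leaves the constant weights `k` and `b`.
      regular-treeSum : (∀ v → degree v ≡ 1 ⊎ degree v ≡ k) →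
        k ^ size * T (λ e → conductance r G e , resistance r G e) ≡
        product (map (conductance r G) (allFin size)) * T (λ _ → k , b)
      regular-treeSum deg = begin
        k ^ size * T (λ e → c e , R e)
          ≡⟨ cong (_* T (λ e → c e , R e)) (trans (product-const k (allFin size)) (cong (k ^_) (length-allFin size))) ⟨
        product (map (λ _ → k) (allFin size)) * T (λ e → c e , R e)
          ≡⟨ treeSum-scaleAll (allFin order) ends (λ _ → k) c R toℕ (allFin size) ⟨
        T (λ e → k * c e , k * R e)
          ≡⟨ treeSum-pendant (λ e → k * c e) (λ e → k * R e) (λ e → c e * b) same ⟩
        T (λ e → k * c e , c e * b)
          ≡⟨ cong (treeSum (allFin order) toℕ) (map-cong (λ e → cong (λ x → ends e , x , c e * b) (*-comm k (c e))) (allFin size)) ⟩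
        T (λ e → c e * k , c e * b)
          ≡⟨ treeSum-scaleAll (allFin order) ends c (λ _ → k) (λ _ → b) toℕ (allFin size) ⟩
        product (map c (allFin size)) * T (λ _ → k , b) ∎
        where
        open ≡-Reasoning
        c = conductance r G
        R = resistance r G
        same : ∀ e → k * R e ≡ c e * b ⊎ Pendant e
        same e with deg (proj₁ (ends e)) | deg (proj₂ (ends e))
        ... | inj₁ p | _      = inj₂ (degree-one p (inj₁ refl))
        ... | inj₂ _ | inj₁ q = inj₂ (degree-one q (inj₂ refl))
        ... | inj₂ p | inj₂ q rewrite p | q = inj₁ (lemma k r)
          where
          lemma : ∀ k r → k * (k + k + r * (k * k)) ≡ k * k * (2 + r * k)
          lemma = solve-∀

      uniform-treeSum : ∀ {j} → order ≡ suc j → b ^ j * T (λ _ → k , b) ≡ k ^ j * b ^ size * t G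
      uniform-treeSum {j} eq = begin
        b ^ j * T (λ _ → k , b)
          ≡⟨ treeSum-uniform ends k b j (allFin size) (toℕ-classes ends k b eq) ⟩
        k ^ j * b ^ length (allFin size) * T (λ _ → 1 , 1)
          ≡⟨ cong₂ (λ x y → k ^ j * b ^ x * y) (length-allFin size) (sym (t≡treeSum G (subst NonZero (sym eq) _))) ⟩
        k ^ j * b ^ size * t G ∎
        where open ≡-Reasoning

      module _ (P : Subset order) (deg₁ : ∀ v → v ∈ P → degree v ≡ 1) (degₖ : ∀ v → v ∉ P → degree v ≡ k) where

        private
          choose : Bool → ℕ
          choose true  = k
          choose false = 1

          -- The correction that makes the vertices uniform: `degree v * κ v` is `k` everywhere and
          -- `degree v ^ degree v * κ v` is `k ^ degree v`, so that both products of degrees become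
          -- powers of `k`.
          κ : Vertex → ℕ
          κ v = choose (lookupᵛ P v)

        leaf-or-regular : ∀ v → (degree v ≡ 1 × κ v ≡ k) ⊎ (degree v ≡ k × κ v ≡ 1)
        leaf-or-regular v with lookupᵛ P v in eq
        ... | true  = inj₁ (deg₁ v (lookup⇒[]= v P eq) , refl)
        ... | false = inj₂ (degₖ v (λ v∈ → contradiction (trans (sym ([]=⇒lookup v∈)) eq) λ ()) , refl)

        degree-nonZero : .{{_ : NonZero k}} → ∀ v → degree v ≢ 0
        degree-nonZero v eq with leaf-or-regular v
        ... | inj₁ (p , _) = contradiction (trans (sym p) eq) λ ()
        ... | inj₂ (p , _) = ≢-nonZero⁻¹ k (trans (sym p) eq)

        product-κ : product (map κ (allFin order)) ≡ k ^ ∣ P ∣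
        product-κ = trans (cong product (map-tabulate id κ)) (count P)
          where
          count : ∀ {n} (P : Subset n) → product (tabulate (λ v → choose (lookupᵛ P v))) ≡ k ^ ∣ P ∣
          count []            = refl
          count (inside ∷ P)  = cong (k *_) (count P)
          count (outside ∷ P) = trans (*-identityˡ _) (count P)

        product-degree : product (map degree (allFin order)) * k ^ ∣ P ∣ ≡ k ^ order
        product-degree = begin
          product (map degree (allFin order)) * k ^ ∣ P ∣                      ≡⟨ cong (product (map degree (allFin order)) *_) product-κ ⟨
          product (map degree (allFin order)) * product (map κ (allFin order)) ≡⟨ product-* degree κ (allFin order) ⟨
          product (map (λ v → degree v * κ v) (allFin order))                  ≡⟨ cong product (map-cong pointwise (allFin order)) ⟩
          product (map (λ _ → k) (allFin order))                               ≡⟨ product-const k (allFin order) ⟩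
          k ^ length (allFin order)                                            ≡⟨ cong (k ^_) (length-allFin order) ⟩
          k ^ order                                                            ∎
          where
          open ≡-Reasoning
          pointwise : ∀ v → degree v * κ v ≡ k
          pointwise v with leaf-or-regular v
          ... | inj₁ (p , q) rewrite p | q = *-identityˡ k
          ... | inj₂ (p , q) rewrite p | q = *-identityʳ k

        product-conductance : product (map (conductance r G) (allFin size)) * k ^ ∣ P ∣ ≡ k ^ (size + size)
        product-conductance = begin
          product (map (conductance r G) (allFin size)) * k ^ ∣ P ∣
            ≡⟨ cong₂ _*_ (double-count degree) product-κ ⟨
          product (map (λ v → degree v ^ degree v) (allFin order)) * product (map κ (allFin order))
            ≡⟨ product-* (λ v → degree v ^ degree v) κ (allFin order) ⟨
          product (map (λ v → degree v ^ degree v * κ v) (allFin order))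
            ≡⟨ cong product (map-cong pointwise (allFin order)) ⟩
          product (map (λ v → k ^ degree v) (allFin order))
            ≡⟨ double-count (λ _ → k) ⟩
          product (map (λ _ → k * k) (allFin size))
            ≡⟨ product-* (λ _ → k) (λ _ → k) (allFin size) ⟩
          product (map (λ _ → k) (allFin size)) * product (map (λ _ → k) (allFin size))
            ≡⟨ cong (λ x → x * x) (trans (product-const k (allFin size)) (cong (k ^_) (length-allFin size))) ⟩
          k ^ size * k ^ size
            ≡⟨ ^-distribˡ-+-* k size size ⟨
          k ^ (size + size) ∎
          where
          open ≡-Reasoning
          pointwise : ∀ v → degree v ^ degree v * κ v ≡ k ^ degree v
          pointwise v with leaf-or-regular v
          ... | inj₁ (p , q) rewrite p | q = trans (*-identityˡ k) (sym (*-identityʳ k))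
          ... | inj₂ (p , q) rewrite p | q = *-identityʳ (k ^ k)

        -- The identity is multiplied out to avoid subtraction in exponents. On the left, `k ^ size`
        -- stems from `regular-treeSum`, `order + order` from the squared degrees, and `b ^ j` from
        -- the `j` tree edges, which do not carry the weight `b`.
        t-formula : ∀ {j} → NonZero size → order ≡ suc j →
          k ^ (size + (order + order)) * b ^ j * t (L (S r G)) ≡
          k ^ (∣ P ∣ + (size + size) + j) * b ^ size * t G
        t-formula {j} nz eq = begin
          k ^ (size + (order + order)) * b ^ j * tL
            ≡⟨ cong (λ x → x * b ^ j * tL) (trans (^-distribˡ-+-* k size (order + order)) (cong (k ^ size *_) (^-distribˡ-+-* k order order))) ⟩
          k ^ size * (k ^ order * k ^ order) * b ^ j * tL
            ≡⟨ cong (λ x → k ^ size * (x * x) * b ^ j * tL) product-degree ⟨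
          k ^ size * (D * K * (D * K)) * b ^ j * tL
            ≡⟨ lemma₁ (k ^ size) D K (b ^ j) tL ⟩
          K * K * b ^ j * (k ^ size * (D * D * tL))
            ≡⟨ cong (λ x → K * K * b ^ j * (k ^ size * (x * tL))) (product-* degree degree (allFin order)) ⟨
          K * K * b ^ j * (k ^ size * (squares G (allFin order) * tL))
            ≡⟨ cong (λ x → K * K * b ^ j * (k ^ size * x)) (t-line-subdivided r G nz) ⟩
          K * K * b ^ j * (k ^ size * T (λ e → conductance r G e , resistance r G e))
            ≡⟨ cong (K * K * b ^ j *_) (regular-treeSum deg) ⟩
          K * K * b ^ j * (Π * T (λ _ → k , b))
            ≡⟨ lemma₂ K (b ^ j) Π (T (λ _ → k , b)) ⟩
          K * (Π * K) * (b ^ j * T (λ _ → k , b))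
            ≡⟨ cong₂ (λ x y → K * x * y) product-conductance (uniform-treeSum eq) ⟩
          K * k ^ (size + size) * (k ^ j * b ^ size * t G)
            ≡⟨ lemma₃ K (k ^ (size + size)) (k ^ j) (b ^ size) (t G) ⟩
          K * k ^ (size + size) * k ^ j * b ^ size * t G
            ≡⟨ cong (λ x → x * b ^ size * t G) (trans (^-distribˡ-+-* k (∣ P ∣ + (size + size)) j) (cong (_* k ^ j) (^-distribˡ-+-* k ∣ P ∣ (size + size)))) ⟨
          k ^ (∣ P ∣ + (size + size) + j) * b ^ size * t G ∎
          where
          open ≡-Reasoning
          tL = t (L (S r G))
          D = product (map degree (allFin order))
          K = k ^ ∣ P ∣
          Π = product (map (conductance r G) (allFin size))
          deg : ∀ v → degree v ≡ 1 ⊎ degree v ≡ k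
          deg v = Sum.map proj₁ proj₁ (leaf-or-regular v)
          lemma₁ : ∀ x D K y t → x * (D * K * (D * K)) * y * t ≡ K * K * y * (x * (D * D * t))
          lemma₁ = solve-∀
          lemma₂ : ∀ K y Π t → K * K * y * (Π * t) ≡ K * (Π * K) * (y * t)
          lemma₂ = solve-∀
          lemma₃ : ∀ K x y z t → K * x * (y * z * t) ≡ K * x * y * z * t
          lemma₃ = solve-∀

  -- Integer powers

  open import Data.Integer.Base as ℤ using (ℤ; +_; -[1+_])
  import Data.Integer.Properties as ℤ
  import Data.Integer.Tactic.RingSolver as ℤ
  open import Data.Rational.Base as ℚ using (ℚ; _/_; toℚᵘ)
  open import Data.Rational.Properties using (toℚᵘ-injective; toℚᵘ-homo-*; toℚᵘ-fromℚᵘ; fromℚᵘ-cong)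
  import Data.Rational.Unnormalised.Base as ℚᵘ
  import Data.Rational.Unnormalised.Properties as ℚᵘ

  fraction-≡ : ∀ a b c d .{{_ : NonZero c}} .{{_ : NonZero d}} → a * d ≡ b * c → + a / c ≡ + b / d
  fraction-≡ a b (suc c) (suc d) eq = fromℚᵘ-cong {ℚᵘ.mkℚᵘ (+ a) c} {ℚᵘ.mkℚᵘ (+ b) d}
    (ℚᵘ.*≡* (trans (sym (ℤ.pos-* a (suc d))) (trans (cong +_ eq) (ℤ.pos-* b (suc c)))))

  fraction-* : ∀ a b c d .{{_ : NonZero c}} .{{_ : NonZero d}} →
               (+ a / c) ℚ.* (+ b / d) ≡ _/_ (+ (a * b)) (c * d) {{m*n≢0 c d}}
  fraction-* a b (suc c) (suc d) = toℚᵘ-injective (begin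
    toℚᵘ ((+ a / suc c) ℚ.* (+ b / suc d))             ≈⟨ toℚᵘ-homo-* (+ a / suc c) (+ b / suc d) ⟩
    toℚᵘ (+ a / suc c) ℚᵘ.* toℚᵘ (+ b / suc d)        ≈⟨ ℚᵘ.*-cong (toℚᵘ-fromℚᵘ (ℚᵘ.mkℚᵘ (+ a) c)) (toℚᵘ-fromℚᵘ (ℚᵘ.mkℚᵘ (+ b) d)) ⟩
    ℚᵘ.mkℚᵘ (+ a) c ℚᵘ.* ℚᵘ.mkℚᵘ (+ b) d             ≡⟨ cong (λ x → ℚᵘ.mkℚᵘ x _) (sym (ℤ.pos-* a b)) ⟩
    ℚᵘ.mkℚᵘ (+ (a * b)) (d + c * suc d) ≈⟨ toℚᵘ-fromℚᵘ (ℚᵘ.mkℚᵘ (+ (a * b)) (d + c * suc d)) ⟨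
    toℚᵘ (+ (a * b) / suc (d + c * suc d)) ∎)
    where open ℚᵘ.≃-Reasoning

  -- Writing `z` as a difference of any two natural numbers spares its users the distinction of
  -- signs. Negative exponents do occur: for a cycle, `k` is 2 and its exponent is -1.
  ^ᶻ-fraction : ∀ b .{{_ : NonZero b}} z x y → z ℤ.+ + y ≡ + x →
    ∃[ p ] ∃[ q ] ∃[ nz ] (b ^ᶻ z ≡ _/_ (+ p) q {{nz}} × p * b ^ y ≡ b ^ x * q)
  ^ᶻ-fraction b (+ i) x y eq = b ^ i , 1 , _ , refl ,
    trans (sym (^-distribˡ-+-* b i y)) (trans (cong (b ^_) (ℤ.+-injective eq)) (sym (*-identityʳ (b ^ x))))
  ^ᶻ-fraction b -[1+ i ] x y eq = 1 , b ^ suc i , m^n≢0 b (suc i) , refl ,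
    trans (*-identityˡ (b ^ y)) (trans (cong (b ^_) (ℤ.+-injective y≡)) (^-distribˡ-+-* b x (suc i)))
    where
    y≡ : + y ≡ + (x + suc i)
    y≡ = begin
      + y                                       ≡⟨ ℤ.+-identityˡ (+ y) ⟨
      + 0 ℤ.+ + y                               ≡⟨ cong (λ a → a ℤ.+ + y) (ℤ.+-inverseˡ -[1+ i ]) ⟨
      + suc i ℤ.+ -[1+ i ] ℤ.+ + y              ≡⟨ ℤ.+-assoc (+ suc i) -[1+ i ] (+ y) ⟩
      + suc i ℤ.+ (-[1+ i ] ℤ.+ + y)            ≡⟨ cong (λ a → + suc i ℤ.+ a) eq ⟩
      + suc i ℤ.+ + x                           ≡⟨ ℤ.+-comm (+ suc i) (+ x) ⟩
      + x ℤ.+ + suc i                           ∎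
      where open ≡-Reasoning

  -- The exponents `z` and `w` are the differences `x′ - x` and `y′ - y`, so the claim is the
  -- identity between natural numbers divided by `a ^ x * b ^ y`.
  clear-denominators : ∀ a b .{{_ : NonZero a}} .{{_ : NonZero b}} z w x x′ y y′ t t′ →
    z ℤ.+ + x ≡ + x′ → w ℤ.+ + y ≡ + y′ → a ^ x * b ^ y * t ≡ a ^ x′ * b ^ y′ * t′ →
    + t / 1 ≡ a ^ᶻ z ℚ.* b ^ᶻ w ℚ.* (+ t′ / 1)
  clear-denominators a b z w x x′ y y′ t t′ zx wy eq
    with p , q , nzq , z≡ , p≡ ← ^ᶻ-fraction a z x′ x zx
       | p′ , q′ , nzq′ , w≡ , p′≡ ← ^ᶻ-fraction b w y′ y wy = begin
    + t / 1
      ≡⟨ fraction-≡ t (p * p′ * t′) 1 (q * q′ * 1) {{_}} {{nz₂}} cross ⟩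
    _/_ (+ (p * p′ * t′)) (q * q′ * 1) {{nz₂}}
      ≡⟨ fraction-* (p * p′) t′ (q * q′) 1 {{nz₁}} ⟨
    _/_ (+ (p * p′)) (q * q′) {{nz₁}} ℚ.* (+ t′ / 1)
      ≡⟨ cong (λ a → a ℚ.* (+ t′ / 1)) (fraction-* p p′ q q′ {{nzq}} {{nzq′}}) ⟨
    _/_ (+ p) q {{nzq}} ℚ.* _/_ (+ p′) q′ {{nzq′}} ℚ.* (+ t′ / 1)
      ≡⟨ cong₂ (λ x y → x ℚ.* y ℚ.* (+ t′ / 1)) z≡ w≡ ⟨
    a ^ᶻ z ℚ.* b ^ᶻ w ℚ.* (+ t′ / 1) ∎
    where
    open ≡-Reasoning
    nz₁ : NonZero (q * q′)
    nz₁ = m*n≢0 q q′ {{nzq}} {{nzq′}}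
    nz₂ : NonZero (q * q′ * 1)
    nz₂ = m*n≢0 (q * q′) 1 {{nz₁}}
    cross : t * (q * q′ * 1) ≡ p * p′ * t′ * 1
    cross = *-cancelˡ-≡ _ _ (a ^ x * b ^ y) {{m*n≢0 (a ^ x) (b ^ y) {{m^n≢0 a x}} {{m^n≢0 b y}}}} (begin
      a ^ x * b ^ y * (t * (q * q′ * 1))       ≡⟨ lemma₁ (a ^ x * b ^ y) t q q′ ⟩
      a ^ x * b ^ y * t * q * q′               ≡⟨ cong (λ s → s * q * q′) eq ⟩
      a ^ x′ * b ^ y′ * t′ * q * q′            ≡⟨ lemma₂ (a ^ x′) (b ^ y′) t′ q q′ ⟩
      a ^ x′ * q * (b ^ y′ * q′) * t′          ≡⟨ cong₂ (λ s u → s * u * t′) p≡ p′≡ ⟨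
      p * a ^ x * (p′ * b ^ y) * t′            ≡⟨ lemma₃ p p′ (a ^ x) (b ^ y) t′ ⟩
      a ^ x * b ^ y * (p * p′ * t′ * 1)        ∎)
      where
      lemma₁ : ∀ c t q q′ → c * (t * (q * q′ * 1)) ≡ c * t * q * q′
      lemma₁ = solve-∀
      lemma₂ : ∀ a b t q q′ → a * b * t * q * q′ ≡ a * q * (b * q′) * t
      lemma₂ = solve-∀
      lemma₃ : ∀ p p′ a b t → p * a * (p′ * b) * t ≡ a * b * (p * p′ * t * 1)
      lemma₃ = solve-∀

  -- Needed because `t≡treeSum` is applied to a line graph, whose vertices are edges of `G`.
  size-nonZero : (G : Graph) → NonZero (Graph.order G) → (∀ v → Graph.degree G v ≢ 0) → NonZero (Graph.size G)
  size-nonZero G nz ne = edge (inc G v) (ne v)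
    where
    vertex : ∀ {n} → NonZero n → Fin n
    vertex {suc n} _ = zero
    v = vertex nz
    edge : ∀ {n} (es : List (Fin n)) → length es ≢ 0 → NonZero n
    edge []              ne = contradiction refl ne
    edge {suc n} (_ ∷ _) ne = _

  module _ (n s : ℕ) (m : ℤ) {order size j : ℕ} (order≡ : order ≡ n + s) (size≡ : + size ≡ m ℤ.+ + s) (suc≡ : suc j ≡ order) where

    private
      j≡ : + j ≡ + n ℤ.+ + s ℤ.- + 1
      j≡ = trans (lemma (+ j)) (cong (λ a → a ℤ.- + 1) (cong +_ (trans suc≡ order≡)))
        where
        lemma : ∀ j → j ≡ + 1 ℤ.+ j ℤ.- + 1
        lemma = ℤ.solve-∀

    -- The exponent of `k` is the difference of its two exponents in `t-formula`. The number `m` is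
    -- an integer because it can be -1: a single edge has n = 0, s = 2 and m + s = 1.
    exponent-degree : m ℤ.+ + s ℤ.- + n ℤ.- + 1 ℤ.+ + (size + (order + order)) ≡ + (s + (size + size) + j)
    exponent-degree = begin
      m ℤ.+ + s ℤ.- + n ℤ.- + 1 ℤ.+ (+ size ℤ.+ (+ order ℤ.+ + order))
        ≡⟨ cong₂ (λ e o → e ℤ.- + n ℤ.- + 1 ℤ.+ (+ size ℤ.+ (o ℤ.+ o))) (sym size≡) (cong +_ order≡) ⟩
      + size ℤ.- + n ℤ.- + 1 ℤ.+ (+ size ℤ.+ (+ n ℤ.+ + s ℤ.+ (+ n ℤ.+ + s)))
        ≡⟨ lemma (+ size) (+ n) (+ s) ⟩
      + s ℤ.+ (+ size ℤ.+ + size) ℤ.+ (+ n ℤ.+ + s ℤ.- + 1)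
        ≡⟨ cong (λ j → + s ℤ.+ (+ size ℤ.+ + size) ℤ.+ j) j≡ ⟨
      + s ℤ.+ (+ size ℤ.+ + size) ℤ.+ + j ∎
      where
      open ≡-Reasoning
      lemma : ∀ e n s → e ℤ.- n ℤ.- + 1 ℤ.+ (e ℤ.+ (n ℤ.+ s ℤ.+ (n ℤ.+ s))) ≡ s ℤ.+ (e ℤ.+ e) ℤ.+ (n ℤ.+ s ℤ.- + 1)
      lemma = ℤ.solve-∀

    exponent-cycles : m ℤ.- + n ℤ.+ + 1 ℤ.+ + j ≡ + size
    exponent-cycles = begin
      m ℤ.- + n ℤ.+ + 1 ℤ.+ + j                      ≡⟨ cong (λ j → m ℤ.- + n ℤ.+ + 1 ℤ.+ j) j≡ ⟩
      m ℤ.- + n ℤ.+ + 1 ℤ.+ (+ n ℤ.+ + s ℤ.- + 1)    ≡⟨ lemma m (+ n) (+ s) ⟩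
      m ℤ.+ + s                                      ≡⟨ size≡ ⟨
      + size                                         ∎
      where
      open ≡-Reasoning
      lemma : ∀ m n s → m ℤ.- n ℤ.+ + 1 ℤ.+ (n ℤ.+ s ℤ.- + 1) ≡ m ℤ.+ s
      lemma = ℤ.solve-∀

open import Data.Nat.Base using (ℕ; NonZero; pred) renaming (_+_ to _ℕ+_; _*_ to _ℕ*_; _≤_ to _ℕ≤_)
open import Data.Nat.Properties using (suc-pred)
open import Data.Integer.Base using (ℤ; +_; _+_; _-_)
open import Data.Product.Base using (_,_)
open import Data.Rational.Base using (ℚ; _/_; _*_)
open import Data.Fin.Subset using (Subset; _∈_; _∉_; ∣_∣)
open import Relation.Binary.PropositionalEquality using (_≡_; refl; sym)

corollary5p1 : (k : ℕ) .{{_ : NonZero k}} → 2 ℕ≤ k →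
    (G : Graph) → Graph.Connected G →
    (n s : ℕ) (m : ℤ) →
    Graph.order G ≡ n ℕ+ s → + Graph.size G ≡ m + + s →
    (P : Subset (Graph.order G)) → ∣ P ∣ ≡ s →
    (∀ v → v ∈ P → Graph.degree G v ≡ 1) →
    (∀ v → v ∉ P → Graph.degree G v ≡ k) →
    (r : ℕ) →
    + t (L (S r G)) / 1 ≡ k ^ᶻ (m + + s - + n - + 1) * (2 ℕ+ r ℕ* k) ^ᶻ (m - + n + + 1) * (+ t G / 1)
corollary5p1 k _ G (nz , _) n s m order≡ size≡ P refl deg₁ degₖ r =
  clear-denominators k (2 ℕ+ r ℕ* k) (m + + s - + n - + 1) (m - + n + + 1)
    -- In turn the exponents of `k` and of `2 + r * k` in `t-formula`, the left-hand one first;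
    -- `pred order` is the number of edges of a spanning tree.
    (size ℕ+ (order ℕ+ order)) (s ℕ+ (size ℕ+ size) ℕ+ pred order) (pred order) size (t (L (S r G))) (t G)
    (exponent-degree n s m order≡ size≡ suc≡) (exponent-cycles n s m order≡ size≡ suc≡)
    (t-formula G k r P deg₁ degₖ (size-nonZero G nz (degree-nonZero G k r P deg₁ degₖ)) (sym suc≡))
  where
  open Graph G
  suc≡ = suc-pred order {{nz}}
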